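{- Let $p$ be an odd prime, $k$ a positive integer, $q$ a prime power and $n$ a positive integer. If $q$ is not a power of $p$, then $EGZ(p,\mathbb{F}_q^n,p-1)=\infty$. If $q=p^k$, then, as $n\to\infty$ (with $p,k$ fixed), $$ EGZ(p, \mathbb{F}_q^n, p-1) \leq \begin{cases} q^{n + o(n)} &\text{ for } p=3,5 \text{ and } k=1, \\ (2.756^k +1)^{n + o(n)} &\text{ for } p=3 \text{ and } k \geq 2, \\ \left(2^k \sqrt{q}+1 \right)^{n+o(n)} &\text{ for } p \neq 3 \text{ and } q \geq 7. \end{cases} $$
   Context: $\mathbb{F}_q^n$ is viewed as a commutative ring with coordinatewise operations. For elements $g_1,\dots,g_t$ of a commutative ring $R$, $e_m(g_1,\dots,g_t)=\sum_{1\leq i_1<\cdots<i_m\leq t}\prod_{j=1}^m g_{i_j}$. A sequence over $R$ is a finite list of elements of $R$ (repetitions allowed); a subsequence of length $t$ is obtained by choosing $t$ distinct positions. For a finite commutative ring $R$, $EGZ(t,R,m)$ is the smallest positive integer $\ell$ such that every sequence $S$ over $R$ of length $|S|\geq \ell$ contains a subsequence $S'$ of length $t$ with $e_m(S')=0$ in $R$; if no such $\ell$ exists, $EGZ(t,R,m)=\infty$. -}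

module Defs where

open import Algebra.Bundles using (CommutativeRing; RawSemiring)
import Algebra.Construct.Pointwise as Pointwise
import Algebra.Definitions.RawSemiring as RawSemiringDefs
open import Data.Fin.Base using (Fin)
open import Data.Integer.Base using (+_)
open import Data.List.Base using (List; []; _∷_; _++_; map; foldr; length)
open import Data.List.Relation.Binary.Sublist.Propositional using (_⊆_)
open import Data.Nat.Base using (ℕ; zero; suc; _+_; _*_; _∸_; _^_; _≤_)
import Data.Nat.Base as ℕ
open import Data.Nat.Primality using (Prime)
open import Data.Product using (_×_; ∃-syntax)
import Data.Rational.Base as ℚ
open ℚ using (ℚ)
open import Function.Bundles using (Inverse)
open import Level using (Level; _⊔_; 0ℓ) renaming (suc to lsuc)
open import Relation.Binary.PropositionalEquality using (_≡_; setoid)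
open import Relation.Nullary using (¬_)
open import Relation.Nullary.Construct.Add.Supremum using (_⁺; [_]; ⊤⁺)

PrimePower : ℕ → Set
PrimePower q = ∃[ r ] ∃[ j ] Prime r × 1 ≤ j × q ≡ r ^ j

record FiniteField (c ℓ : Level) (q : ℕ) : Set (lsuc (c ⊔ ℓ)) where
  field
    commutativeRing : CommutativeRing c ℓ

  private
    module R = CommutativeRing commutativeRing

  field
    1≉0        : ¬ (R.1# R.≈ R.0#)
    invertible : ∀ x → ¬ (x R.≈ R.0#) → ∃[ y ] (x R.* y) R.≈ R.1#
    order      : Inverse R.setoid (setoid (Fin q))

-- Functions Fin n → F with coordinatewise operations and equality.
𝔽^ : ∀ {c ℓ q} → FiniteField c ℓ q → ℕ → CommutativeRing c ℓ
𝔽^ F n = Pointwise.commutativeRing (Fin n) (FiniteField.commutativeRing F)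

-- The choices of m positions i₁ < ⋯ < iₘ of a list, each given as the list of
-- entries at those positions.  Positions holding equal entries are kept
-- apart, so the result has (length xs choose m) members.
choices : ∀ {a} {A : Set a} → ℕ → List A → List (List A)
choices zero    _        = [] ∷ []
choices (suc m) []       = []
choices (suc m) (x ∷ xs) = map (x ∷_) (choices m xs) ++ choices (suc m) xs

module _ {c ℓ} (R : CommutativeRing c ℓ) where
  private
    module R = CommutativeRing R

  e : ℕ → List R.Carrier → R.Carrier
  e m gs = foldr R._+_ R.0# (map (foldr R._*_ R.1#) (choices m gs))

  -- _⊆_ is the order-preserving sublist relation; since e m is symmetric, it
  -- is enough to consider subsequences listed in increasing order of position.
  Forces : ℕ → ℕ → ℕ → Set (c ⊔ ℓ)
  Forces t m L = ∀ (S : List R.Carrier) → L ≤ length S →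
    ∃[ S′ ] S′ ⊆ S × length S′ ≡ t × e m S′ R.≈ R.0#

-- IsEGZ t R m v says that EGZ(t, R, m) = v, where ⊤⁺ plays the role of ∞.
IsEGZ : ∀ {c ℓ} → ℕ → CommutativeRing c ℓ → ℕ → ℕ ⁺ → Set (c ⊔ ℓ)
IsEGZ t R m [ L ] = 1 ≤ L × Forces R t m L × (∀ L′ → 1 ≤ L′ → Forces R t m L′ → L ≤ L′)
IsEGZ t R m ⊤⁺    = ∀ L → 1 ≤ L → ¬ Forces R t m L

-- f(n) = o(n), with ε ranging over the reciprocals 1/c.
LittleO : (ℕ → ℕ) → Set
LittleO f = ∀ c → ∃[ N ] ∀ n → N ≤ n → c * f n ≤ n

-- A type of nonnegative real numbers containing the bases of the bounds, with
-- the comparison of a natural number with one of its elements.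
record Scale : Set₁ where
  field
    rawSemiring : RawSemiring 0ℓ 0ℓ

  open RawSemiring rawSemiring public using (Carrier)

  field
    _≼_ : ℕ → Carrier → Set

-- The sequence x satisfies x(n) ≤ b^(n + o(n)) for n ≥ 1; a value ∞ satisfies
-- no such bound.  For a base b > 1, replacing a real-valued error term f by
-- the natural number ⌈|f|⌉ keeps it o(n) and only weakens the bound, so error
-- terms with values in ℕ suffice.
Bounded : ∀ {a} (K : Scale) → Scale.Carrier K → (ℕ → ℕ ⁺ → Set a) → Set a
Bounded K b Is = ∃[ f ] LittleO f ×
    (∀ n → 1 ≤ n → ∃[ L ] Is n [ L ] × L ≼ (b ^ᴷ (n + f n)))
  where
  open Scale K
  open RawSemiringDefs rawSemiring using () renaming (_^_ to _^ᴷ_)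

ℕ-scale : Scale
ℕ-scale = record { rawSemiring = ℕ.+-*-rawSemiring ; _≼_ = _≤_ }

ℚ-scale : Scale
ℚ-scale = record
  { rawSemiring = ℚ.+-*-rawSemiring
  ; _≼_         = λ L x → (+ L) ℚ./ 1 ℚ.≤ x
  }

module _ where
  open RawSemiringDefs ℚ.+-*-rawSemiring using () renaming (_^_ to _^ℚ_)

  base₃ : ℕ → ℚ
  base₃ k = ((+ 2756) ℚ./ 1000) ^ℚ k ℚ.+ ℚ.1ℚ

-- a +√ b stands for the real number a + b√d.  When d is a perfect square one
-- number has several representations, which is harmless: the ring equality is
-- not used, and the comparison below depends only on the number represented.
record ℕ[√_] (d : ℕ) : Set where
  constructor _+√_
  field
    rational : ℕ
    surd     : ℕ

√-scale : ℕ → Scale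
√-scale d = record
  { rawSemiring = record
    { Carrier = ℕ[√ d ]
    ; _≈_     = _≡_
    ; _+_     = λ (a +√ b) (a′ +√ b′) → (a + a′) +√ (b + b′)
    ; _*_     = λ (a +√ b) (a′ +√ b′) → (a * a′ + d * (b * b′)) +√ (a * b′ + b * a′)
    ; 0#      = 0 +√ 0
    ; 1#      = 1 +√ 0
    }
  -- L ≤ a + b√d  iff  max(L - a, 0) ≤ b√d; square both sides.
  ; _≼_       = λ L (a +√ b) → (L ∸ a) ^ 2 ≤ b ^ 2 * d
  }

-- 2^k √q + 1
base√ : ∀ k q → ℕ[√ q ]
base√ k q = 1 +√ (2 ^ k)

-- In a coordinate, e_{p-1} vanishes on p field elements if all of them are zero, and also if none is zero
-- and their reciprocals sum to zero.  If q is not a power of p, the constant sequence 1 has e_{p-1} = p ≠ 0.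
-- If q = p^k, p equal terms give the bound q^(n + o(n)).  For the other bounds, sort the terms of a sequence by
-- support: on a support of size i, the reciprocals are vectors in F_q^i, and one looks for p of them with
-- sum zero.  If s(i) vectors always contain p of them with sum zero, then 1 + Σ_i C(n,i) s(i) terms suffice.
--
-- Let z_1, …, z_L be tuples of p vectors with sum zero, such that no other choice of one entry per position
-- has sum zero.  The tensor Π_c (1 - Π_{j<k} (Σ_a x_{a,c}^(p^j))^(p-1)) is then diagonal on them, and every
-- monomial in it has degree at most (p-1)ik/p in one of the p vectors, the x^(p^j) serving as coordinates
-- over F_p.  Hence L is at most p times the number D of low-degree monomials, where D ≤ 2.756^(ik) for p = 3
-- and D ≤ 4^(ik) in general.
--
-- For p = 3 this already bounds sets without three distinct elements of sum zero.  For p ≥ 5 (Sauermann), a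
-- large set A contains zero-sum p-tuples with j distinct entries for every j ≤ p, by induction on j: otherwise
-- take many disjoint tuples with j distinct entries and a common pattern of equalities, and a value u that
-- occurs twice in this pattern.  If a pair (g, h) of entries at u and at another value b extends to a tuple of
-- this pattern, then g + h has at most 2p representations, since any other one would split u and create more
-- distinct entries.  So there are at most 2p q^i such pairs, and an independent set in the resulting graph is a
-- family to which the diagonal bound applies.

module Submission where

open import Algebra.Bundles using (CommutativeRing; RawSemiring; CommutativeMonoid; RawRing)
open import Algebra.Core using (Op₁; Op₂)
import Algebra.Definitions.RawSemiring as RawSemiringDefs
import Algebra.Morphism.RingMonomorphism as RingMonomorphism
import Algebra.Properties.CommutativeMonoid.Sum
import Algebra.Properties.CommutativeSemiring.Binomial
open import Algebra.Structures using (IsCommutativeRing; IsCommutativeMonoid)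
open import Data.Bool.Base using (true; false; Bool; not)
import Data.Bool.Properties as Bool
open import Data.Fin.Base using (Fin; zero; suc; toℕ; fromℕ; inject₁; punchIn; fromℕ<)
open import Data.Fin.Patterns using (0F; 1F; 2F)
open import Data.Fin.Permutation as Perm using (permutation)
import Data.Fin.Properties as Fin
import Data.Integer.Base as ℤ
import Data.Integer.Properties as ℤ
open import Data.List.Base as List using (List; []; _∷_; _++_; map; filter; length; cartesianProduct;
  cartesianProductWith; allFin; upTo; foldr; deduplicate; take)
open import Data.List.Membership.Propositional using (_∈_; find; lose)
open import Data.List.Membership.Propositional.Properties using (∈-cartesianProductWith⁺; ∈-cartesianProductWith⁻;
  ∈-filter⁻; ∈-map⁻; ∈-lookup; ∈-cartesianProduct⁺; ∈-filter⁺; ∈-allFin; ∈-upTo⁺; ∈-upTo⁻; ∈-map⁺; ∈-deduplicate⁺;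
  ∈-deduplicate⁻; ∈-++⁺ˡ; ∈-++⁺ʳ; ∈-++⁻)
open import Data.List.Properties using (length-++; length-map; filter-++; length-filter; length-tabulate; map-++;
  map-∘; map-cong; map-applyUpTo; ++-identityʳ; filter-complete; filter-all; filter-reject; filter-accept;
  length-take; map-tabulate; length-replicate; map-id)
open import Data.List.Relation.Binary.Permutation.Propositional.Properties using (↭-length)
import Data.List.Relation.Binary.Permutation.Setoid.Properties as ↭ₛ
open import Data.List.Relation.Binary.Sublist.Propositional.Properties using (filter-⊆; take-⊆)
open import Data.List.Relation.Unary.All as All using (All; []; _∷_)
open import Data.List.Relation.Unary.AllPairs as AllPairs using (AllPairs; []; _∷_)
import Data.List.Relation.Unary.AllPairs.Properties as AllPairs
open import Data.List.Relation.Unary.Any using (here; there; any?; Any)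
import Data.List.Relation.Unary.Unique.DecPropositional.Properties as UniqueDec
open import Data.List.Relation.Unary.Unique.Propositional using (Unique)
import Data.List.Relation.Unary.Unique.Propositional.Properties as Unique
open import Data.Nat.Base as ℕ using (ℕ; suc; s≤s; z≤n; zero; _≤_; _∸_; _<_; NonZero; _!)
open import Data.Nat.Combinatorics using (nCn≡1; nCk≡nC[n∸k]; k![n∸k]!∣n!) renaming (_C_ to _choose_)
open import Data.Nat.Combinatorics.Specification using (nCk≡n!/k![n-k]!)
open import Data.Nat.Coprimality using (coprime-Bézout; Coprime)
open import Data.Nat.DivMod using (m/n*n≡m)
open import Data.Nat.Divisibility using (_∣_; divides; ∣⇒≤; ∣m⇒∣m*n; ∣-refl; ∣1⇒≡1; _∤_)
open import Data.Nat.GCD using (module Bézout)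
open import Data.Nat.ListAction.Properties using (sum-++)
open import Data.Nat.Primality using (Prime; prime⇒nonTrivial; prime⇒nonZero; prime⇒irreducible; euclidsLemma;
  ¬prime[0]; ¬prime[1])
import Data.Nat.Properties as ℕ
open import Data.Nat.Tactic.RingSolver using (solve-∀)
open import Data.Product using (_×_; _,_; ∃-syntax; proj₁; proj₂; Σ)
open import Data.Rational.Base as ℚ using (ℚ)
import Data.Rational.Properties as ℚ
import Data.Rational.Unnormalised.Base as ℚᵘ
import Data.Rational.Unnormalised.Properties as ℚᵘ
open import Data.Sum as Sum using (_⊎_; inj₁; inj₂)
open import Data.Vec.Base as Vec using (Vec; []; _∷_; lookup; _[_]≔_; replicate; concat; tabulate; zipWith)
open import Data.Vec.Functional using (removeAt)
open import Data.Vec.Properties as Vec using (lookup∘update; lookup∘update′; []≔-commutes; lookup-replicate)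
open import Data.Vec.Relation.Unary.All as VAll using ([]; _∷_)
import Data.Vec.Relation.Unary.All.Properties as VAll
open import Defs
open import Function.Base using (_∘_; id)
open import Function.Bundles using (Inverse; _↔_)
open import Function.Construct.Identity using (↔-id)
open import Level using (Level; 0ℓ; _⊔_)
open import Relation.Binary.Definitions using (DecidableEquality; Symmetric)
open import Relation.Binary.PropositionalEquality hiding ([_])
open import Relation.Nullary using (¬_; Dec; yes; no; does; contradiction)
open import Relation.Nullary.Construct.Add.Supremum using (_⁺; [_]; ⊤⁺)
open import Relation.Nullary.Decidable using (¬?; _×-dec_; _⊎-dec_; _→-dec_; map′; decidable-stable)
open import Relation.Unary using (Pred; Decidable)

-- The factor √q comes from a trade-off. Let R be the diagonal bound, of order 4^(ik), and E the
-- number of related pairs, of order q^i. For a threshold D, at most E/D of the M disjoint tuples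
-- have degree D or more, and among the others a D-th part is independent, hence of size at most R;
-- so M ≤ E/D + D R. The choice D ≈ √(E/R) gives M of order √(E R), that is (2^k √q)^i up to a
-- factor depending on p only. The sum of β^i over all supports is (β + 1)^n, which explains the
-- summand 1 in two of the bases. Constant factors cost only a constant in the exponent, so every
-- error term below is constant. The product over j < k in the tensor is the power q - 1 of a
-- coordinate sum, because (p - 1)(1 + p + ... + p^(k-1)) = q - 1. Spreading it over k conjugate
-- variables keeps every exponent below p, and the count 4^(ik) depends on that. An upper bound
-- alone does not name a value of EGZ, since that value is a minimum. It is found by search, which
-- requires deciding whether a given length forces a solution.

module Counting where

  open import Data.Nat.Base
  open import Data.Nat.ListAction using (sum)
  open import Data.Nat.Properties

  private variable
    a b r ℓ : Level
    A : Set a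
    B : Set b

  -- Counting in lists: covers, pigeonhole, Markov's inequality, independent sets.

  module _ {P : Pred A ℓ} (P? : Decidable P) where

    count : List A → ℕ
    count = length ∘ filter P?

    count-∷ : ∀ x xs → count xs ≤ count (x ∷ xs)
    count-∷ x xs with does (P? x)
    ... | true  = n≤1+n _
    ... | false = ≤-refl

    count-accept : ∀ {x} xs → P x → count (x ∷ xs) ≡ suc (count xs)
    count-accept {x} xs px with P? x
    ... | yes _ = refl
    ... | no ¬p = contradiction px ¬p

    count-reject : ∀ {x} xs → ¬ P x → count (x ∷ xs) ≡ count xs
    count-reject {x} xs ¬px with P? x
    ... | yes px = contradiction px ¬px
    ... | no _   = refl

    count-++ : ∀ xs ys → count (xs ++ ys) ≡ count xs + count ys
    count-++ xs ys = trans (cong length (filter-++ P? xs ys)) (length-++ (filter P? xs))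

    count-split : ∀ xs → count xs + length (filter (¬? ∘ P?) xs) ≡ length xs
    count-split [] = refl
    count-split (x ∷ xs) with does (P? x)
    ... | true  = cong suc (count-split xs)
    ... | false = trans (+-suc _ _) (cong suc (count-split xs))

    count-none : ∀ xs → (∀ {x} → x ∈ xs → ¬ P x) → count xs ≡ 0
    count-none [] _ = refl
    count-none (x ∷ xs) none with P? x
    ... | yes p = contradiction p (none (here refl))
    ... | no _  = count-none xs (none ∘ there)

  sum-map-mono : ∀ (f g : A → ℕ) xs → (∀ {x} → x ∈ xs → f x ≤ g x) → sum (map f xs) ≤ sum (map g xs)
  sum-map-mono f g []       _   = z≤n
  sum-map-mono f g (x ∷ xs) f≤g = +-mono-≤ (f≤g (here refl)) (sum-map-mono f g xs (f≤g ∘ there))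

  sum-map-const : ∀ c (xs : List A) → sum (map (λ _ → c) xs) ≡ length xs * c
  sum-map-const c []       = refl
  sum-map-const c (x ∷ xs) = cong (c +_) (sum-map-const c xs)

  module _ {P : B → A → Set ℓ} (P? : ∀ b → Decidable (P b)) where

    private
      S : List B → List A → ℕ
      S bs xs = sum (map (λ b → count (P? b) xs) bs)

      S-mono : ∀ x xs bs → S bs xs ≤ S bs (x ∷ xs)
      S-mono x xs bs = sum-map-mono _ _ bs (λ {b} _ → count-∷ (P? b) x xs)

      S-grow : ∀ x xs {b bs} → b ∈ bs → P b x → suc (S bs xs) ≤ S bs (x ∷ xs)
      S-grow x xs {bs = b ∷ bs} (here refl) p =
        +-mono-≤ (≤-reflexive (sym (count-accept (P? b) xs p))) (S-mono x xs bs)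
      S-grow x xs {bs = b ∷ bs} (there b∈) p = begin
        suc (count (P? b) xs + S bs xs)  ≡⟨ sym (+-suc _ _) ⟩
        count (P? b) xs + suc (S bs xs)  ≤⟨ +-mono-≤ (count-∷ (P? b) x xs) (S-grow x xs b∈ p) ⟩
        S (b ∷ bs) (x ∷ xs)              ∎
        where open ≤-Reasoning

    length-cover : ∀ bs xs → (∀ {x} → x ∈ xs → ∃[ b ] b ∈ bs × P b x) → length xs ≤ S bs xs
    length-cover bs [] _ = z≤n
    length-cover bs (x ∷ xs) cov with cov (here refl)
    ... | _ , b∈ , p = ≤-trans (s≤s (length-cover bs xs (cov ∘ there))) (S-grow x xs b∈ p)

    pigeonhole : ∀ (N : B → ℕ) bs xs → (∀ {x} → x ∈ xs → ∃[ b ] b ∈ bs × P b x) →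
      sum (map N bs) < length xs → ∃[ b ] b ∈ bs × N b < count (P? b) xs
    pigeonhole N bs xs cov lt = search bs (≤-trans lt (length-cover bs xs cov))
      where
      search : ∀ cs → sum (map N cs) < S cs xs → ∃[ b ] b ∈ cs × N b < count (P? b) xs
      search (c ∷ cs) lt with N c <? count (P? c) xs
      ... | yes p = c , here refl , p
      ... | no ¬p with search cs (+-cancelˡ-< (N c) _ _ (<-≤-trans lt (+-monoˡ-≤ _ (≮⇒≥ ¬p))))
      ...   | b , b∈ , q = b , there b∈ , q

    count-union : ∀ {Q : Pred A r} (Q? : Decidable Q) bs xs → (∀ {x} → x ∈ xs → Q x → ∃[ b ] b ∈ bs × P b x) →
      count Q? xs ≤ S bs xs
    count-union Q? bs [] _ = z≤n
    count-union Q? bs (x ∷ xs) cov with Q? x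
    ... | no _  = ≤-trans (count-union Q? bs xs (cov ∘ there)) (S-mono x xs bs)
    ... | yes q with cov (here refl) q
    ...   | _ , b∈ , p = ≤-trans (s≤s (count-union Q? bs xs (cov ∘ there))) (S-grow x xs b∈ p)

  module _ (_≟_ : DecidableEquality A) where

    count-unique : ∀ y {xs : List A} → Unique xs → count (_≟ y) xs ≤ 1
    count-unique y [] = z≤n
    count-unique y (_∷_ {x} {xs} x∉ u) with x ≟ y
    ... | no _     = count-unique y u
    ... | yes refl = s≤s (≤-reflexive (count-none (_≟ x) xs λ z∈ z≡x → All.lookup x∉ z∈ (sym z≡x)))

    unique-length : ∀ {xs ys : List A} → Unique xs → (∀ {x} → x ∈ xs → x ∈ ys) → length xs ≤ length ys
    unique-length {xs} {ys} u sub = begin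
      length xs                                   ≤⟨ length-cover (λ y → _≟ y) ys xs (λ {x} x∈ → x , sub x∈ , refl) ⟩
      sum (map (λ y → count (_≟ y) xs) ys)        ≤⟨ sum-map-mono _ _ ys (λ {y} _ → count-unique y u) ⟩
      sum (map (λ _ → 1) ys)                      ≡⟨ sum-map-const 1 ys ⟩
      length ys * 1                               ≡⟨ *-identityʳ _ ⟩
      length ys                                   ∎
      where open ≤-Reasoning

  unique-map : ∀ {f : A → B} {xs} → Unique xs → (∀ {x y} → x ∈ xs → y ∈ xs → f x ≡ f y → x ≡ y) → Unique (map f xs)
  unique-map [] _ = []
  unique-map {f = f} (_∷_ {x} {xs} x∉ u) inj =
    All.tabulate (λ {z} z∈ fx≡z → let w , w∈ , z≡ = ∈-map⁻ f z∈ in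
      All.lookup x∉ w∈ (inj (here refl) (there w∈) (trans fx≡z z≡)))
    ∷ unique-map u (λ x∈ y∈ → inj (there x∈) (there y∈))

  vecs : List A → ∀ n → List (Vec A n)
  vecs xs zero    = [] ∷ []
  vecs xs (suc n) = cartesianProductWith _∷_ xs (vecs xs n)

  ∈-vecs : ∀ {xs : List A} {n} (v : Vec A n) → (∀ i → Vec.lookup v i ∈ xs) → v ∈ vecs xs n
  ∈-vecs []      _ = here refl
  ∈-vecs (x ∷ v) m = ∈-cartesianProductWith⁺ _∷_ (m zero) (∈-vecs v (m ∘ suc))

  ∈-vecs⁻ : ∀ {xs : List A} {n} (v : Vec A n) → v ∈ vecs xs n → ∀ i → Vec.lookup v i ∈ xs
  ∈-vecs⁻ {xs = xs} (x ∷ v) v∈ i with ∈-cartesianProductWith⁻ _∷_ xs (vecs xs _) v∈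
  ∈-vecs⁻ (x ∷ v) v∈ zero    | _ , _ , x∈ , _ , refl = x∈
  ∈-vecs⁻ (x ∷ v) v∈ (suc i) | _ , _ , _ , v∈′ , refl = ∈-vecs⁻ v v∈′ i

  length-cartesianProductWith : ∀ {c} {C : Set c} (f : A → B → C) xs ys →
    length (cartesianProductWith f xs ys) ≡ length xs * length ys
  length-cartesianProductWith f []       ys = refl
  length-cartesianProductWith f (x ∷ xs) ys = trans (length-++ (map (f x) ys))
    (cong₂ _+_ (length-map (f x) ys) (length-cartesianProductWith f xs ys))

  length-vecs : ∀ (xs : List A) n → length (vecs xs n) ≡ length xs ^ n
  length-vecs xs zero    = refl
  length-vecs xs (suc n) = trans (length-cartesianProductWith _∷_ xs (vecs xs n)) (cong (length xs *_) (length-vecs xs n))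

  count-map : ∀ {P : Pred B ℓ} (P? : Decidable P) (f : A → B) xs → count P? (map f xs) ≡ count (P? ∘ f) xs
  count-map P? f [] = refl
  count-map P? f (x ∷ xs) with does (P? (f x))
  ... | true  = cong suc (count-map P? f xs)
  ... | false = count-map P? f xs

  count-cartesianProduct : ∀ {P : Pred (A × B) ℓ} (P? : Decidable P) xs ys →
    count P? (cartesianProduct xs ys) ≡ sum (map (λ x → count (λ y → P? (x , y)) ys) xs)
  count-cartesianProduct P? [] ys = refl
  count-cartesianProduct P? (x ∷ xs) ys = trans (count-++ P? (map (x ,_) ys) _)
    (cong₂ _+_ (count-map P? (x ,_) ys) (count-cartesianProduct P? xs ys))

  markov : ∀ (f : A → ℕ) d xs → count (λ x → d ≤? f x) xs * d ≤ sum (map f xs)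
  markov f d [] = z≤n
  markov f d (x ∷ xs) = step (d ≤? f x)
    where
    big = λ x → d ≤? f x
    step : Dec (d ≤ f x) → count big (x ∷ xs) * d ≤ f x + sum (map f xs)
    step (yes d≤) rewrite count-accept big xs d≤ = +-mono-≤ d≤ (markov f d xs)
    step (no d≰)  rewrite count-reject big xs d≰ = ≤-trans (markov f d xs) (m≤n+m _ (f x))

  lookup-AllPairs : ∀ {R : A → A → Set ℓ} → Symmetric R → ∀ {xs} → AllPairs R xs →
    ∀ {i j} → i ≢ j → R (List.lookup xs i) (List.lookup xs j)
  lookup-AllPairs sy (px ∷ pxs) {zero}  {zero}  i≢j = contradiction refl i≢j
  lookup-AllPairs sy (px ∷ pxs) {zero}  {suc j} i≢j = All.lookup px (∈-lookup j)
  lookup-AllPairs sy (px ∷ pxs) {suc i} {zero}  i≢j = sy (All.lookup px (∈-lookup i))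
  lookup-AllPairs sy (px ∷ pxs) {suc i} {suc j} i≢j = lookup-AllPairs sy pxs (i≢j ∘ cong suc)

  count-filter : ∀ {P : Pred A ℓ} {Q : Pred A r} (P? : Decidable P) (Q? : Decidable Q) xs →
    count P? (filter Q? xs) ≤ count P? xs
  count-filter P? Q? [] = z≤n
  count-filter P? Q? (x ∷ xs) with does (Q? x)
  ... | false = ≤-trans (count-filter P? Q? xs) (count-∷ P? x xs)
  ... | true with does (P? x)
  ...   | true  = s≤s (count-filter P? Q? xs)
  ...   | false = count-filter P? Q? xs

  module _ {R : A → A → Set ℓ} (R? : ∀ x → Decidable (R x)) where

    -- Each vertex kept discards itself and at most `d` neighbours. The relation need not be
    -- symmetric: a later vertex survives only if no earlier kept vertex is related to it, so
    -- independence is asserted in list order.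
    greedy-independent : ∀ d xs → Unique xs → (∀ {x} → x ∈ xs → count (R? x) xs ≤ d) →
      ∃[ ys ] (∀ {y} → y ∈ ys → y ∈ xs) × Unique ys × AllPairs (λ x y → ¬ R x y) ys × length xs ≤ suc d * length ys
    greedy-independent d xs = go (length xs) xs ≤-refl
      where
      go : ∀ n xs → length xs ≤ n → Unique xs → (∀ {x} → x ∈ xs → count (R? x) xs ≤ d) →
        ∃[ ys ] (∀ {y} → y ∈ ys → y ∈ xs) × Unique ys × AllPairs (λ x y → ¬ R x y) ys × length xs ≤ suc d * length ys
      go _ [] _ _ _ = [] , (λ ()) , [] , [] , z≤n
      go (suc n) (x ∷ xs) (s≤s len) (x∉ ∷ uniq) deg =
        let rest = filter (¬? ∘ R? x) xs
            ys , sub , uniq′ , ind , bound = go n rest (≤-trans (length-filter (¬? ∘ R? x) xs) len)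
              (AllPairs.filter⁺ (¬? ∘ R? x) uniq)
              (λ {y} y∈ → ≤-trans (count-filter (R? y) _ xs)
                (≤-trans (count-∷ (R? y) x xs) (deg (there (proj₁ (∈-filter⁻ (¬? ∘ R? x) {xs = xs} y∈))))))
        in x ∷ ys
         , (λ { (here eq) → here eq ; (there y∈) → there (proj₁ (∈-filter⁻ (¬? ∘ R? x) {xs = xs} (sub y∈))) })
         , All.tabulate (λ y∈ → All.lookup x∉ (proj₁ (∈-filter⁻ (¬? ∘ R? x) {xs = xs} (sub y∈)))) ∷ uniq′
         , All.tabulate (λ y∈ → proj₂ (∈-filter⁻ (¬? ∘ R? x) {xs = xs} (sub y∈))) ∷ ind
         , (begin
            suc (length xs)                           ≡⟨ cong suc (sym (count-split (R? x) xs)) ⟩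
            suc (count (R? x) xs + length rest)       ≤⟨ s≤s (+-mono-≤ (≤-trans (count-∷ (R? x) x xs) (deg (here refl))) bound) ⟩
            suc d + suc d * length ys                 ≡⟨ sym (*-suc (suc d) (length ys)) ⟩
            suc d * suc (length ys)                   ∎)
        where open ≤-Reasoning

    -- Markov's inequality leaves enough vertices of degree less than d, to which the greedy choice applies.
    independent-set : ∀ E d xs → Unique xs → sum (map (λ x → count (R? x) xs) xs) ≤ E →
      ∃[ ys ] Unique ys × AllPairs (λ x y → ¬ R x y) ys × length xs * suc d ≤ E + suc d * suc d * length ys
    independent-set E d xs uniq edges =
      let ys , _ , uniq′ , ind , bound = greedy-independent d low (AllPairs.filter⁺ (¬? ∘ big) uniq) (λ {x} x∈ →
            ≤-trans (count-filter (R? x) _ xs) (≤-pred (≰⇒> (proj₂ (∈-filter⁻ (¬? ∘ big) {xs = xs} x∈)))))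
      in ys , uniq′ , ind , (begin
        length xs * suc d                          ≡⟨ cong (_* suc d) (sym (count-split big xs)) ⟩
        (count big xs + length low) * suc d        ≡⟨ *-distribʳ-+ (suc d) (count big xs) _ ⟩
        count big xs * suc d + length low * suc d  ≤⟨ +-mono-≤ (≤-trans (markov deg (suc d) xs) edges) (*-monoˡ-≤ (suc d) bound) ⟩
        E + suc d * length ys * suc d              ≡⟨ cong (E +_) (swap (suc d) (length ys)) ⟩
        E + suc d * suc d * length ys              ∎)
      where
      open ≤-Reasoning
      swap : ∀ m n → m * n * m ≡ m * m * n
      swap m n = trans (*-assoc m n m) (trans (cong (m *_) (*-comm n m)) (sym (*-assoc m m n)))
      deg : _ → ℕ
      deg x = count (R? x) xs
      big : Decidable (λ x → suc d ≤ deg x)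
      big x = suc d ≤? deg x
      low : List _
      low = filter (¬? ∘ big) xs

open Counting

-- The working version of `FiniteField`: propositional equality permits rewriting, decidability
-- permits finite search, and a total inverse can be mapped over vectors.
record DecField : Set₁ where
  infixl 6 _+_
  infixl 7 _*_
  infix  8 -_
  infix  4 _≟_
  field
    Carrier : Set
    _+_ _*_ : Op₂ Carrier
    -_ : Op₁ Carrier
    0# 1# : Carrier
    isCommutativeRing : IsCommutativeRing _≡_ _+_ _*_ -_ 0# 1#
    _≟_ : DecidableEquality Carrier
    1≢0 : 1# ≢ 0#
    _⁻¹ : Carrier → Carrier
    *-inverseʳ : ∀ {x} → x ≢ 0# → x * x ⁻¹ ≡ 1#

  commutativeRing : CommutativeRing 0ℓ 0ℓ
  commutativeRing = record { isCommutativeRing = isCommutativeRing }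

  open CommutativeRing commutativeRing public
    using (+-assoc; +-comm; +-identityˡ; +-identityʳ; -‿inverseˡ; -‿inverseʳ; *-assoc; *-comm; *-identityˡ; *-identityʳ;
           distribˡ; distribʳ; zeroˡ; zeroʳ; ring; commutativeSemiring; semiring; +-commutativeMonoid; *-commutativeMonoid; +-monoid)

-- Slice rank of diagonal tensors.

module SliceRank (F : DecField) {I : Set} (_≟ᴵ_ : DecidableEquality I) (t : ℕ) where
  open DecField F
  open import Algebra.Properties.Ring ring using (-‿distribˡ-*)
  open import Algebra.Solver.Ring.NaturalCoefficients.Default commutativeSemiring using (solve; _:=_; _:+_; _:*_)

  Tensor : Set
  Tensor = Vec I t → Carrier

  -- `rest` is a function of the whole tuple that is invariant under changes at `axis`. Slices along
  -- different axes can then be added and evaluated at the same tuple, without deleting positions.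
  record Slice : Set where
    constructor slice
    field
      axis   : Fin t
      factor : I → Carrier
      rest   : Tensor
      indep  : ∀ x i → rest (x [ axis ]≔ i) ≡ rest x

    eval : Tensor
    eval x = factor (lookup x axis) * rest x

  open Slice

  total : List Slice → Tensor
  total []       x = 0#
  total (s ∷ ss) x = eval s x + total ss x

  Over : List I → Vec I t → Set
  Over is x = ∀ a → lookup x a ∈ is

  NonConstant : Vec I t → Set
  NonConstant x = ∃[ a ] ∃[ b ] lookup x a ≢ lookup x b

  module _ (b : Fin t) (c : I → Carrier) (i₀ : I) where

    shift : Tensor → Tensor
    shift f x = f x + c (lookup x b) * f (x [ b ]≔ i₀)

    -- The linear map `shift` sends slices to slices: along the axis `b` it only changes the factor,
    -- because `rest` ignores that position, and along any other axis it only changes `rest`. So the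
    -- number of slices does not grow.
    shiftSlice : Slice → Slice
    shiftSlice (slice a f g ind) with a Fin.≟ b
    ... | yes refl = slice a (λ i → f i + c i * f i₀) g ind
    ... | no a≢b   = slice a f (shift g) λ x i →
      cong₂ _+_ (ind x i)
        (cong₂ _*_ (cong c (lookup∘update′ (a≢b ∘ sym) x i))
          (trans (cong g ([]≔-commutes x a b a≢b)) (ind (x [ b ]≔ i₀) i)))

    eval-shiftSlice : ∀ s x → eval (shiftSlice s) x ≡ shift (eval s) x
    eval-shiftSlice (slice a f g ind) x with a Fin.≟ b
    ... | yes refl rewrite lookup∘update a x i₀ | ind x i₀ =
      solve 4 (λ u v w z → (u :+ v :* w) :* z := u :* z :+ v :* (w :* z)) refl
        (f (lookup x a)) (c (lookup x a)) (f i₀) (g x)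
    ... | no a≢b rewrite lookup∘update′ a≢b x i₀ =
      solve 4 (λ u v w z → u :* (v :+ w :* z) := u :* v :+ w :* (u :* z)) refl
        (f (lookup x a)) (g x) (c (lookup x b)) (g (x [ b ]≔ i₀))

    total-shiftSlice : ∀ ss x → total (map shiftSlice ss) x ≡ shift (total ss) x
    total-shiftSlice []       x = sym (trans (+-identityˡ _) (zeroʳ _))
    total-shiftSlice (s ∷ ss) x rewrite eval-shiftSlice s x | total-shiftSlice ss x =
      solve 5 (λ u v w z y → (u :+ w :* v) :+ (z :+ w :* y) := (u :+ z) :+ w :* (v :+ y)) refl
        (eval s x) (eval s (x [ b ]≔ i₀)) (c (lookup x b)) (total ss x) (total ss (x [ b ]≔ i₀))

  Over-update : ∀ {is x} b {i} → Over is x → i ∈ is → Over is (x [ b ]≔ i)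
  Over-update {is} {x} b {i} x∈ i∈ a with a Fin.≟ b
  ... | yes refl = subst (_∈ is) (sym (lookup∘update a x i)) i∈
  ... | no a≢b   = subst (_∈ is) (sym (lookup∘update′ a≢b x i)) (x∈ a)

  -- One slice f ⊗ g with f(i₀) ≠ 0 is removed per step: subtracting the multiple f(x_b)/f(i₀) of
  -- T(x[b ≔ i₀]) kills that slice, keeps all other slices, and does not change T off the index i₀.
  diagonal-bound : (∀ (b : Fin t) → ∃[ a ] a ≢ b) → ∀ (T : Tensor) r ss {is} → length ss ℕ.≤ r → Unique is →
    (∀ {i} → i ∈ is → T (replicate t i) ≢ 0#) →
    (∀ x → Over is x → NonConstant x → T x ≡ 0#) →
    (∀ x → Over is x → T x ≡ total ss x) →
    length is ℕ.≤ r
  diagonal-bound other T _ [] {[]} _ _ _ _ _ = z≤n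
  diagonal-bound other T _ [] {i ∷ is} _ _ diag _ T≡ =
    contradiction (T≡ (replicate t i) (λ a → here (lookup-replicate a i))) (diag (here refl))
  diagonal-bound other T (suc r) (s ∷ ss) {is} (s≤s len) uniq diag off T≡ with any? (λ i → ¬? (factor s i ≟ 0#)) is
  ... | no allZero = ℕ.m≤n⇒m≤1+n (diagonal-bound other T r ss len uniq diag off λ x x∈ → trans (T≡ x x∈) (dropped x x∈))
    where
    dropped : ∀ x → Over is x → eval s x + total ss x ≡ total ss x
    dropped x x∈ with factor s (lookup x (axis s)) ≟ 0#
    ... | yes f≡0 rewrite f≡0 = trans (cong (_+ total ss x) (zeroˡ (rest s x))) (+-identityˡ (total ss x))
    ... | no f≢0  = contradiction (lose (x∈ (axis s)) f≢0) allZero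
  ... | yes nz with find nz
  ...   | i₀ , i₀∈ , f₀≢0 = begin
      length is                       ≡⟨ sym (count-split (_≟ᴵ i₀) is) ⟩
      count (_≟ᴵ i₀) is ℕ.+ length is′  ≤⟨ ℕ.+-mono-≤ (count-unique _≟ᴵ_ i₀ uniq)
        (diagonal-bound other T r (map (shiftSlice b c i₀) ss)
          (ℕ.≤-trans (ℕ.≤-reflexive (length-map (shiftSlice b c i₀) ss)) len) (Unique.filter⁺ (¬? ∘ (_≟ᴵ i₀)) uniq)
          (diag ∘ proj₁ ∘ is′⊆) (λ x x∈ → off x (proj₁ ∘ is′⊆ ∘ x∈)) represented) ⟩
      suc r                           ∎
    where
    open ℕ.≤-Reasoning
    b = axis s
    f = factor s
    c : I → Carrier
    c i = - (f i * f i₀ ⁻¹)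
    is′ = filter (¬? ∘ (_≟ᴵ i₀)) is
    is′⊆ : ∀ {i} → i ∈ is′ → i ∈ is × i ≢ i₀
    is′⊆ = ∈-filter⁻ (¬? ∘ (_≟ᴵ i₀))
    killed : ∀ x → shift b c i₀ (eval s) x ≡ 0#
    killed x rewrite lookup∘update b x i₀ | indep s x i₀ = let u = f (lookup x b) ; g = rest s x in ≡.begin
      u * g + - (u * f i₀ ⁻¹) * (f i₀ * g)    ≡.≡⟨ cong (u * g +_) (sym (-‿distribˡ-* _ _)) ⟩
      u * g + - (u * f i₀ ⁻¹ * (f i₀ * g))    ≡.≡⟨ cong (λ z → u * g + - z) (solve 4 (λ u v w g → u :* v :* (w :* g) := u :* (w :* v) :* g) refl u (f i₀ ⁻¹) (f i₀) g) ⟩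
      u * g + - (u * (f i₀ * f i₀ ⁻¹) * g)    ≡.≡⟨ cong (λ z → u * g + - (u * z * g)) (*-inverseʳ f₀≢0) ⟩
      u * g + - (u * 1# * g)                  ≡.≡⟨ cong (λ z → u * g + - (z * g)) (*-identityʳ u) ⟩
      u * g + - (u * g)                       ≡.≡⟨ -‿inverseʳ _ ⟩
      0#                                      ≡.∎
      where module ≡ = ≡-Reasoning
    represented : ∀ x → Over is′ x → T x ≡ total (map (shiftSlice b c i₀) ss) x
    represented x x∈′ = ≡.begin
      T x                                               ≡.≡⟨ sym (+-identityʳ _) ⟩
      T x + 0#                                          ≡.≡⟨ cong (T x +_) (sym (zeroʳ _)) ⟩
      T x + c (lookup x b) * 0#                         ≡.≡⟨ cong (λ z → T x + c (lookup x b) * z) (sym (off y y∈ y-nonconst)) ⟩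
      T x + c (lookup x b) * T y                        ≡.≡⟨ cong₂ (λ u v → u + c (lookup x b) * v) (T≡ x x∈) (T≡ y y∈) ⟩
      shift b c i₀ (total (s ∷ ss)) x                   ≡.≡⟨ solve 5 (λ u v w z y → (u :+ z) :+ w :* (v :+ y) := (u :+ w :* v) :+ (z :+ w :* y)) refl
                                                            (eval s x) (eval s y) (c (lookup x b)) (total ss x) (total ss y) ⟩
      shift b c i₀ (eval s) x + shift b c i₀ (total ss) x ≡.≡⟨ cong₂ _+_ (killed x) (sym (total-shiftSlice b c i₀ ss x)) ⟩
      0# + total (map (shiftSlice b c i₀) ss) x         ≡.≡⟨ +-identityˡ _ ⟩
      total (map (shiftSlice b c i₀) ss) x              ≡.∎
      where
      module ≡ = ≡-Reasoning
      x∈ : Over is x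
      x∈ = proj₁ ∘ is′⊆ ∘ x∈′
      y = x [ b ]≔ i₀
      y∈ : Over is y
      y∈ = Over-update {x = x} b x∈ i₀∈
      -- Position `b` of `y` holds `i₀`, while every other position holds an element of `is′`, from
      -- which `i₀` was removed. A second position exists by `other`.
      y-nonconst : NonConstant y
      y-nonconst = let a , a≢b = other b in a , b , λ eq →
        proj₂ (is′⊆ (x∈′ a)) (trans (sym (lookup∘update′ {i = a} {j = b} a≢b x i₀)) (trans eq (lookup∘update b x i₀)))

-- Degrees of a monomial in the separate blocks of variables.

least-entry : ∀ {n} (u : Vec ℕ (suc n)) → ∃[ a ] ∀ b → lookup u a ≤ lookup u b
least-entry (m ∷ []) = zero , λ { zero → ℕ.≤-refl }
least-entry (m ∷ u@(_ ∷ _)) with least-entry u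
... | a , min with m ℕ.≤? lookup u a
...   | yes m≤ = zero , λ { zero → ℕ.≤-refl ; (suc b) → ℕ.≤-trans m≤ (min b) }
...   | no m≰  = suc a , λ { zero → ℕ.<⇒≤ (ℕ.≰⇒> m≰) ; (suc b) → min b }

sum-lower-bound : ∀ {n} c (u : Vec ℕ n) → (∀ a → c ≤ lookup u a) → n ℕ.* c ≤ Vec.sum u
sum-lower-bound c []      _ = z≤n
sum-lower-bound c (m ∷ u) h = ℕ.+-mono-≤ (h zero) (sum-lower-bound c u (h ∘ suc))

entry≤sum : ∀ {n} (u : Vec ℕ n) a → lookup u a ≤ Vec.sum u
entry≤sum (m ∷ u) zero    = ℕ.m≤m+n m _
entry≤sum (m ∷ u) (suc a) = ℕ.≤-trans (entry≤sum u a) (ℕ.m≤n+m _ m)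

sum-zipWith-+ : ∀ {n} (u w : Vec ℕ n) → Vec.sum (Vec.zipWith ℕ._+_ u w) ≡ Vec.sum u ℕ.+ Vec.sum w
sum-zipWith-+ []      []      = refl
sum-zipWith-+ (m ∷ u) (n ∷ w) rewrite sum-zipWith-+ u w = interchange m n (Vec.sum u) (Vec.sum w)
  where
  interchange : ∀ a b c d → (a ℕ.+ b) ℕ.+ (c ℕ.+ d) ≡ (a ℕ.+ c) ℕ.+ (b ℕ.+ d)
  interchange = solve-∀

sum-zeros : ∀ n → Vec.sum (replicate n 0) ≡ 0
sum-zeros zero    = refl
sum-zeros (suc n) = sum-zeros n

sum-increment : ∀ {n} (u : Vec ℕ n) a → Vec.sum (Vec.updateAt u a suc) ≡ suc (Vec.sum u)
sum-increment (m ∷ u) zero    = refl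
sum-increment (m ∷ u) (suc a) = trans (cong (m ℕ.+_) (sum-increment u a)) (ℕ.+-suc m _)

column : ∀ {t N} → Fin t → Vec (Vec ℕ t) N → Vec ℕ N
column a = Vec.map (λ e → lookup e a)

column-totals : ∀ {t N} → Vec (Vec ℕ t) N → Vec ℕ t
column-totals []       = replicate _ 0
column-totals (e ∷ es) = Vec.zipWith ℕ._+_ e (column-totals es)

lookup-column-totals : ∀ {t N} (es : Vec (Vec ℕ t) N) a → lookup (column-totals es) a ≡ Vec.sum (column a es)
lookup-column-totals []       a = Vec.lookup-replicate a 0
lookup-column-totals (e ∷ es) a =
  trans (Vec.lookup-zipWith ℕ._+_ a e (column-totals es)) (cong (lookup e a ℕ.+_) (lookup-column-totals es a))

sum-column-totals : ∀ {t N} d (es : Vec (Vec ℕ t) N) → VAll.All (λ e → Vec.sum e ≤ d) es →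
  Vec.sum (column-totals es) ≤ N ℕ.* d
sum-column-totals {t} d []       []       = ℕ.≤-reflexive (sum-zeros t)
sum-column-totals     d (e ∷ es) (b ∷ bs) =
  ℕ.≤-trans (ℕ.≤-reflexive (sum-zipWith-+ e (column-totals es))) (ℕ.+-mono-≤ b (sum-column-totals d es bs))

-- The column with the least total is at most the average of all `suc t` columns, and all entries
-- together sum to at most `N * d`.
light-column : ∀ {t N} d (es : Vec (Vec ℕ (suc t)) N) → VAll.All (λ e → Vec.sum e ≤ d) es →
  ∃[ a ] suc t ℕ.* Vec.sum (column a es) ≤ d ℕ.* N
light-column {t} {N} d es bounded = let a , min = least-entry (column-totals es) in a , (begin
  suc t ℕ.* Vec.sum (column a es)          ≡⟨ cong (suc t ℕ.*_) (sym (lookup-column-totals es a)) ⟩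
  suc t ℕ.* lookup (column-totals es) a    ≤⟨ sum-lower-bound _ (column-totals es) min ⟩
  Vec.sum (column-totals es)               ≤⟨ sum-column-totals d es bounded ⟩
  N ℕ.* d                                  ≡⟨ ℕ.*-comm N d ⟩
  d ℕ.* N                                  ∎)
  where open ℕ.≤-Reasoning

-- These exponent vectors index the slices along one axis: the total is at most the t-th part of the
-- largest possible one, with the denominator cleared.
low : (t d N : ℕ) → List (Vec ℕ N)
low t d N = filter (λ β → t ℕ.* Vec.sum β ℕ.≤? d ℕ.* N) (vecs (upTo (suc d)) N)

column-low : ∀ {t N} d (es : Vec (Vec ℕ (suc t)) N) → VAll.All (λ e → Vec.sum e ≤ d) es →
  ∃[ a ] column a es ∈ low (suc t) d N
column-low {t} {N} d es b = let a , light = light-column d es b in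
  a , ∈-filter⁺ (λ β → suc t ℕ.* Vec.sum β ℕ.≤? d ℕ.* N)
        (∈-vecs (column a es) (λ j → ∈-upTo⁺ (s≤s (entries a es b j)))) light
  where
  entries : ∀ {N} a (es : Vec (Vec ℕ (suc t)) N) → VAll.All (λ e → Vec.sum e ≤ d) es → ∀ j → lookup (column a es) j ≤ d
  entries a (e ∷ es) (b ∷ bs) zero    = ℕ.≤-trans (entry≤sum e a) b
  entries a (e ∷ es) (b ∷ bs) (suc j) = entries a es bs j

-- Polynomials as functions of index tuples, and their slice rank.

module Polynomial (F : DecField) {I : Set} (_≟ᴵ_ : DecidableEquality I) where
  open DecField F
  open import Algebra.Properties.Semiring.Exp semiring using (_^_; ^-homo-*)
  open import Algebra.Solver.Ring.NaturalCoefficients.Default commutativeSemiring using (solve; _:=_; _:+_; _:*_)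

  -- A variable comes in `t` copies, one for each block; `v a i` is the value of copy `a` when
  -- position `a` of the tuple holds the index `i`. A polynomial is thereby a tensor from the start.
  Var : ℕ → Set
  Var t = Fin t → I → Carrier

  linear : ∀ {t} → Var t → Vec I t → Carrier
  linear v []      = 0#
  linear v (i ∷ x) = v zero i + linear (v ∘ suc) x

  mono₁ : ∀ {t} → Var t → Vec ℕ t → Vec I t → Carrier
  mono₁ v []      []      = 1#
  mono₁ v (n ∷ e) (i ∷ x) = v zero i ^ n * mono₁ (v ∘ suc) e x

  mono₁-zeros : ∀ {t} (v : Var t) x → mono₁ v (replicate t 0) x ≡ 1#
  mono₁-zeros v []      = refl
  mono₁-zeros v (i ∷ x) = trans (*-identityˡ _) (mono₁-zeros (v ∘ suc) x)

  mono₁-* : ∀ {t} (v : Var t) e f x → mono₁ v e x * mono₁ v f x ≡ mono₁ v (Vec.zipWith ℕ._+_ e f) x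
  mono₁-* v [] [] [] = *-identityˡ 1#
  mono₁-* v (m ∷ e) (n ∷ f) (i ∷ x) rewrite ^-homo-* (v zero i) m n | sym (mono₁-* (v ∘ suc) e f x) =
    solve 4 (λ a b c d → (a :* b) :* (c :* d) := (a :* c) :* (b :* d)) refl (v zero i ^ m) _ (v zero i ^ n) _

  mono₁-increment : ∀ {t} (v : Var t) a e x → mono₁ v (Vec.updateAt e a suc) x ≡ v a (lookup x a) * mono₁ v e x
  mono₁-increment v zero    (n ∷ e) (i ∷ x) = *-assoc _ _ _
  mono₁-increment v (suc a) (n ∷ e) (i ∷ x) rewrite mono₁-increment (v ∘ suc) a e x =
    solve 3 (λ a b c → a :* (b :* c) := b :* (a :* c)) refl (v zero i ^ n) _ _

  mono₁-split : ∀ {t} (v : Var t) a e x → mono₁ v e x ≡ v a (lookup x a) ^ lookup e a * mono₁ v (e [ a ]≔ 0) x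
  mono₁-split v zero    (n ∷ e) (i ∷ x) = cong (v zero i ^ n *_) (sym (*-identityˡ _))
  mono₁-split v (suc a) (n ∷ e) (i ∷ x) rewrite mono₁-split (v ∘ suc) a e x =
    solve 3 (λ a b c → a :* (b :* c) := b :* (a :* c)) refl (v zero i ^ n) _ _

  mono₁-indep : ∀ {t} (v : Var t) a e x i → mono₁ v (e [ a ]≔ 0) (x [ a ]≔ i) ≡ mono₁ v (e [ a ]≔ 0) x
  mono₁-indep v zero    (n ∷ e) (j ∷ x) i = refl
  mono₁-indep v (suc a) (n ∷ e) (j ∷ x) i = cong (v zero j ^ n *_) (mono₁-indep (v ∘ suc) a e x i)

  mono : ∀ {t N} → Vec (Var t) N → Vec (Vec ℕ t) N → Vec I t → Carrier
  mono []       []       x = 1#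
  mono (v ∷ vs) (e ∷ es) x = mono₁ v e x * mono vs es x

  mono-zeros : ∀ {t N} (vs : Vec (Var t) N) x → mono vs (replicate N (replicate t 0)) x ≡ 1#
  mono-zeros []       x = refl
  mono-zeros (v ∷ vs) x = trans (cong₂ _*_ (mono₁-zeros v x) (mono-zeros vs x)) (*-identityˡ 1#)

  mono-++ : ∀ {t M N} (us : Vec (Var t) M) (vs : Vec (Var t) N) ds es x →
    mono us ds x * mono vs es x ≡ mono (us Vec.++ vs) (ds Vec.++ es) x
  mono-++ []       vs []       es x = *-identityˡ _
  mono-++ (u ∷ us) vs (d ∷ ds) es x = trans (*-assoc _ _ _) (cong (mono₁ u d x *_) (mono-++ us vs ds es x))

  power : ∀ {t N} → Fin t → Vec (Var t) N → Vec ℕ N → I → Carrier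
  power a []       []      i = 1#
  power a (v ∷ vs) (n ∷ β) i = v a i ^ n * power a vs β i

  mono-split : ∀ {t N} a (vs : Vec (Var t) N) es x →
    mono vs es x ≡ power a vs (column a es) (lookup x a) * mono vs (Vec.map (_[ a ]≔ 0) es) x
  mono-split a []       []       x = sym (*-identityˡ 1#)
  mono-split a (v ∷ vs) (e ∷ es) x rewrite mono₁-split v a e x | mono-split a vs es x =
    solve 4 (λ a b c d → (a :* b) :* (c :* d) := (a :* c) :* (b :* d)) refl
      (v a (lookup x a) ^ lookup e a) (mono₁ v (e [ a ]≔ 0) x) (power a vs (column a es) (lookup x a)) _

  mono-indep : ∀ {t N} a (vs : Vec (Var t) N) es x i →
    mono vs (Vec.map (_[ a ]≔ 0) es) (x [ a ]≔ i) ≡ mono vs (Vec.map (_[ a ]≔ 0) es) x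
  mono-indep a []       []       x i = refl
  mono-indep a (v ∷ vs) (e ∷ es) x i = cong₂ _*_ (mono₁-indep v a e x i) (mono-indep a vs es x i)

  module _ {X : Set} where

    -- A linear combination with its terms listed. All equations are pointwise and `P` is a
    -- predicate on functions, so a product of two generators need only agree with a generator at
    -- every point.
    data Span (P : (X → Carrier) → Set) (f : X → Carrier) : Set where
      null : (∀ x → f x ≡ 0#) → Span P f
      plus : ∀ c {m g} → P m → Span P g → (∀ x → f x ≡ c * m x + g x) → Span P f

    module _ {P : (X → Carrier) → Set} where

      span-+ : ∀ {f g h} → Span P f → Span P g → (∀ x → h x ≡ f x + g x) → Span P h
      span-+ (null f≡0) (null g≡0) h≡ = null λ x → trans (h≡ x) (trans (cong₂ _+_ (f≡0 x) (g≡0 x)) (+-identityˡ 0#))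
      span-+ (null f≡0) (plus c p s g≡) h≡ = plus c p s λ x →
        trans (h≡ x) (trans (cong₂ _+_ (f≡0 x) (g≡ x)) (+-identityˡ _))
      span-+ (plus c p s f≡) s′ h≡ = plus c p (span-+ s s′ (λ _ → refl)) λ x →
        trans (h≡ x) (trans (cong (_+ _) (f≡ x)) (+-assoc _ _ _))

      span-scale : ∀ {f} k → Span P f → Span P (λ x → k * f x)
      span-scale k (null f≡0) = null λ x → trans (cong (k *_) (f≡0 x)) (zeroʳ k)
      span-scale k (plus c {m} {g} p s f≡) = plus (k * c) p (span-scale k s) λ x →
        trans (cong (k *_) (f≡ x)) (solve 4 (λ k c m g → k :* (c :* m :+ g) := (k :* c) :* m :+ k :* g) refl k c (m x) (g x))

      span-generator : ∀ {f} → P f → Span P f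
      span-generator p = plus 1# p (null {f = λ _ → 0#} (λ _ → refl)) λ x →
        sym (trans (+-identityʳ _) (*-identityˡ _))

      span-cong : ∀ {f g} → (∀ x → f x ≡ g x) → Span P g → Span P f
      span-cong f≡g (null g≡0) = null λ x → trans (f≡g x) (g≡0 x)
      span-cong f≡g (plus c p s g≡) = plus c p s λ x → trans (f≡g x) (g≡ x)

    span-* : ∀ {P Q R : (X → Carrier) → Set} → (∀ {m n} → P m → Q n → R (λ x → m x * n x)) →
      ∀ {f g} → Span P f → Span Q g → Span R (λ x → f x * g x)
    span-* PQ {g = g} (null f≡0) _ = null λ x → trans (cong (_* g x) (f≡0 x)) (zeroˡ (g x))
    span-* {P} {Q} {R} PQ {g = g} (plus c {m} {h} p s f≡) s′ =
      span-+ (row s′) (span-* PQ s s′) λ x →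
        trans (cong (_* g x) (f≡ x)) (distribʳ (g x) (c * m x) (h x))
      where
      row : ∀ {g} → Span Q g → Span R (λ x → c * m x * g x)
      row (null g≡0) = null λ x → trans (cong (c * m x *_) (g≡0 x)) (zeroʳ _)
      row (plus d {n} {k} q r g≡) = plus (c * d) (PQ p q) (row r) λ x →
        trans (cong (c * m x *_) (g≡ x))
          (solve 5 (λ c d m n k → c :* m :* (d :* n :+ k) := (c :* d) :* (m :* n) :+ c :* m :* k) refl c d (m x) (n x) (k x))

  Mono₁ : ∀ {t} → ℕ → Var t → (Vec I t → Carrier) → Set
  Mono₁ n v m = ∃[ e ] Vec.sum e ≤ n × ∀ x → m x ≡ mono₁ v e x

  Mono : ∀ {t N} → ℕ → Vec (Var t) N → (Vec I t → Carrier) → Set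
  Mono d vs m = ∃[ es ] VAll.All (λ e → Vec.sum e ≤ d) es × ∀ x → m x ≡ mono vs es x

  -- The selection `w` of positions is there for the induction: the sum gets shorter while its terms
  -- remain functions of the whole tuple.
  linear-lookup-span : ∀ {t} (P : (Vec I t → Carrier) → Set) {s} (w : Fin s → Fin t) (v : Var t) →
    (∀ a → P (λ x → v (w a) (lookup x (w a)))) → Span P (λ x → linear (v ∘ w) (Vec.tabulate (lookup x ∘ w)))
  linear-lookup-span P {zero}  w v gen = null λ _ → refl
  linear-lookup-span P {suc s} w v gen =
    span-+ (span-generator (gen zero)) (linear-lookup-span P (w ∘ suc) v (gen ∘ suc)) λ _ → refl

  linear-span : ∀ {t} (v : Var t) → Span (Mono₁ 1 v) (linear v)
  linear-span {t} v = span-cong (λ x → cong (linear v) (sym (Vec.tabulate∘lookup x)))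
    (linear-lookup-span (Mono₁ 1 v) id v λ a →
      Vec.updateAt (replicate t 0) a suc
      , ℕ.≤-reflexive (trans (sum-increment (replicate t 0) a) (cong suc (sum-zeros t)))
      , λ x → sym (trans (mono₁-increment v a (replicate t 0) x) (trans (cong (v a (lookup x a) *_) (mono₁-zeros v x)) (*-identityʳ _))))

  linear^-span : ∀ {t} (v : Var t) n → Span (Mono₁ n v) (λ x → linear v x ^ n)
  linear^-span {t} v zero = span-generator (replicate t 0 , ℕ.≤-reflexive (sum-zeros t) , λ x → sym (mono₁-zeros v x))
  linear^-span v (suc n) = span-*
    (λ { {m} {m′} (e , e≤ , m≡) (f , f≤ , m′≡) → Vec.zipWith ℕ._+_ e f
       , ℕ.≤-trans (ℕ.≤-reflexive (sum-zipWith-+ e f)) (ℕ.+-mono-≤ e≤ f≤)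
       , λ x → trans (cong₂ _*_ (m≡ x) (m′≡ x)) (mono₁-* v e f x) })
    (linear-span v) (linear^-span v n)

  block : ∀ {t k} → ℕ → Vec (Var t) k → Vec I t → Carrier
  block d []       x = 1#
  block d (v ∷ vs) x = linear v x ^ d * block d vs x

  1-span : ∀ {t N} d (vs : Vec (Var t) N) → Span (Mono d vs) (λ _ → 1#)
  1-span {t} {N} d vs = span-generator
    (replicate N (replicate t 0) , zeros N , λ x → sym (mono-zeros vs x))
    where
    zeros : ∀ N → VAll.All (λ e → Vec.sum e ≤ d) (replicate N (replicate t 0))
    zeros zero    = []
    zeros (suc N) = ℕ.≤-trans (ℕ.≤-reflexive (sum-zeros t)) z≤n ∷ zeros N

  block-span : ∀ {t k} d (vs : Vec (Var t) k) → Span (Mono d vs) (block d vs)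
  block-span d []       = 1-span d []
  block-span d (v ∷ vs) = span-*
    (λ { (e , e≤ , m≡) (es , es≤ , m′≡) → e ∷ es , e≤ ∷ es≤ , λ x → cong₂ _*_ (m≡ x) (m′≡ x) })
    (linear^-span v d) (block-span d vs)

  -- The tensor of the overview for arbitrary variables: the outer vector runs through the
  -- coordinates, each inner one through the conjugates of that coordinate. Once the blocks take
  -- only the values 0 and 1, a factor is the indicator of a vanishing coordinate.
  cells : ∀ {t k n} → ℕ → Vec (Vec (Var t) k) n → Vec I t → Carrier
  cells d []       x = 1#
  cells d (b ∷ bs) x = (1# + - 1# * block d b x) * cells d bs x

  cells-span : ∀ {t k n} d (bs : Vec (Vec (Var t) k) n) → Span (Mono d (concat bs)) (cells d bs)
  cells-span d []       = 1-span d []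
  cells-span d (b ∷ bs) = span-*
    (λ { (ds , ds≤ , m≡) (es , es≤ , m′≡) → ds Vec.++ es , VAll.++⁺ ds≤ es≤
       , λ x → trans (cong₂ _*_ (m≡ x) (m′≡ x)) (mono-++ b (concat bs) ds es x) })
    (span-+ (1-span d b) (span-scale (- 1#) (block-span d b)) (λ _ → refl)) (cells-span d bs)

  module _ {t N : ℕ} (vs : Vec (Var t) N) where
    open SliceRank F _≟ᴵ_ t

    -- An axis together with the exponents in that block fixes the first factor of a slice. With one
    -- slice reserved for each key and every monomial added into its slice, the number of slices is
    -- the number of keys, however many monomials occur.
    Key : Set
    Key = Fin t × Vec ℕ N

    Rest : Key → Set
    Rest (a , _) = Σ Tensor λ g → ∀ x i → g (x [ a ]≔ i) ≡ g x

    slices : ∀ {κs} → All Rest κs → List Slice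
    slices [] = []
    slices {(a , β) ∷ _} ((g , ind) ∷ gs) = slice a (power a vs β) g ind ∷ slices gs

    length-slices : ∀ {κs} (gs : All Rest κs) → length (slices gs) ≡ length κs
    length-slices []       = refl
    length-slices (_ ∷ gs) = cong suc (length-slices gs)

    zeros : ∀ κs → All Rest κs
    zeros []       = []
    zeros (_ ∷ κs) = ((λ _ → 0#) , λ _ _ → refl) ∷ zeros κs

    total-zeros : ∀ κs x → total (slices (zeros κs)) x ≡ 0#
    total-zeros []       x = refl
    total-zeros (κ ∷ κs) x = trans (cong₂ _+_ (zeroʳ _) (total-zeros κs x)) (+-identityˡ 0#)

    add : ∀ {κ κs} → κ ∈ κs → Rest κ → All Rest κs → All Rest κs
    add (here refl) (g , ind) ((h , jnd) ∷ gs) = ((λ x → g x + h x) , λ x i → cong₂ _+_ (ind x i) (jnd x i)) ∷ gs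
    add (there κ∈)  r         (s ∷ gs)         = s ∷ add κ∈ r gs

    total-add : ∀ {κ κs} (κ∈ : κ ∈ κs) (r : Rest κ) gs x →
      total (slices (add κ∈ r gs)) x ≡ power (proj₁ κ) vs (proj₂ κ) (lookup x (proj₁ κ)) * proj₁ r x + total (slices gs) x
    total-add (here refl) (g , _) ((h , _) ∷ gs) x =
      solve 4 (λ f g h s → f :* (g :+ h) :+ s := f :* g :+ (f :* h :+ s)) refl _ (g x) (h x) (total (slices gs) x)
    total-add (there κ∈) r (s ∷ gs) x rewrite total-add κ∈ r gs x =
      solve 3 (λ a b c → a :+ (b :+ c) := b :+ (a :+ c)) refl _ _ (total (slices gs) x)

  module _ {t N : ℕ} (vs : Vec (Var (suc t)) N) (d : ℕ) where
    open SliceRank F _≟ᴵ_ (suc t)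

    keys : List (Key vs)
    keys = cartesianProduct (allFin (suc t)) (low (suc t) d N)

    length-keys : length keys ≡ suc t ℕ.* length (low (suc t) d N)
    length-keys = trans (length-cartesianProductWith _,_ (allFin (suc t)) (low (suc t) d N))
      (cong (ℕ._* length (low (suc t) d N)) (length-tabulate {n = suc t} id))

    -- Each monomial has low degree in one of the t blocks of variables, and joins the slice of that block.
    span-slices : ∀ {f} → Span (Mono d vs) f → ∃[ gs ] ∀ x → f x ≡ total (slices vs {keys} gs) x
    span-slices (null f≡0) = zeros vs keys , λ x → trans (f≡0 x) (sym (total-zeros vs keys x))
    span-slices (plus c (es , es≤ , m≡) s f≡) =
      let gs , g≡ = span-slices s
          a , low∈ = column-low d es es≤
          κ∈ = ∈-cartesianProduct⁺ (∈-allFin a) low∈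
          r  = (λ x → c * mono vs (Vec.map (_[ a ]≔ 0) es) x) , λ x i → cong (c *_) (mono-indep a vs es x i)
      in add vs κ∈ r gs , λ x → trans (f≡ x) (trans
           (cong₂ _+_ (trans (cong (c *_) (trans (m≡ x) (mono-split a vs es x)))
             (solve 3 (λ c u w → c :* (u :* w) := u :* (c :* w)) refl c _ _)) (g≡ x))
           (sym (total-add vs κ∈ r gs x)))

    span-rank : ∀ {f} → Span (Mono d vs) f →
      ∃[ ss ] length ss ≡ suc t ℕ.* length (low (suc t) d N) × ∀ x → f x ≡ total ss x
    span-rank s = let gs , g≡ = span-slices s in
      slices vs gs , trans (length-slices vs gs) length-keys , g≡

-- The number of monomials of low degree.

module MonomialCount where

  open import Data.Nat.Base
  open import Data.Nat.ListAction using (sum)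
  open import Data.Nat.Properties

  private variable
    a ℓ : Level
    A : Set a

  ^-distribʳ-* : ∀ k m n → (m * n) ^ k ≡ m ^ k * n ^ k
  ^-distribʳ-* zero    m n = refl
  ^-distribʳ-* (suc k) m n = trans (cong (m * n *_) (^-distribʳ-* k m n)) (lemma m n (m ^ k) (n ^ k))
    where
    lemma : ∀ a b c d → a * b * (c * d) ≡ a * c * (b * d)
    lemma = solve-∀

  ^-cancelˡ-≤ : ∀ k .{{_ : NonZero k}} m n → m ^ k ≤ n ^ k → m ≤ n
  ^-cancelˡ-≤ k m n m^≤n^ with m ≤? n
  ... | yes m≤n = m≤n
  ... | no m≰n  = contradiction m^≤n^ (<⇒≱ (^-monoˡ-< k (≰⇒> m≰n)))

  sum-map-*ˡ : ∀ c (f : A → ℕ) xs → sum (map (λ x → c * f x) xs) ≡ c * sum (map f xs)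
  sum-map-*ˡ c f []       = sym (*-zeroʳ c)
  sum-map-*ˡ c f (x ∷ xs) = trans (cong (c * f x +_) (sum-map-*ˡ c f xs)) (sym (*-distribˡ-+ c (f x) _))

  sum-cartesianProductWith : ∀ {N} (f : A → ℕ) (g : Vec A N → ℕ) (h : Vec A (suc N) → ℕ) →
    (∀ x v → h (x ∷ v) ≡ f x * g v) → ∀ xs vs →
    sum (map h (cartesianProductWith _∷_ xs vs)) ≡ sum (map f xs) * sum (map g vs)
  sum-cartesianProductWith f g h h≡ []       vs = refl
  sum-cartesianProductWith f g h h≡ (x ∷ xs) vs = begin
    sum (map h (map (x ∷_) vs ++ rest))                  ≡⟨ cong sum (map-++ h (map (x ∷_) vs) rest) ⟩
    sum (map h (map (x ∷_) vs) ++ map h rest)            ≡⟨ sum-++ (map h (map (x ∷_) vs)) _ ⟩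
    sum (map h (map (x ∷_) vs)) + sum (map h rest)       ≡⟨ cong₂ _+_ (trans (cong sum (trans (sym (map-∘ vs)) (map-cong (h≡ x) vs))) (sum-map-*ˡ (f x) g vs))
                                                                       (sum-cartesianProductWith f g h h≡ xs vs) ⟩
    f x * sum (map g vs) + sum (map f xs) * sum (map g vs) ≡⟨ sym (*-distribʳ-+ (sum (map g vs)) (f x) _) ⟩
    (f x + sum (map f xs)) * sum (map g vs)              ∎
    where
    open ≡-Reasoning
    rest = cartesianProductWith _∷_ xs vs

  sum-map-filter : ∀ {P : Pred A ℓ} (P? : Decidable P) (f : A → ℕ) xs → sum (map f (filter P? xs)) ≤ sum (map f xs)
  sum-map-filter P? f [] = z≤n
  sum-map-filter P? f (x ∷ xs) with does (P? x)
  ... | true  = +-monoʳ-≤ (f x) (sum-map-filter P? f xs)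
  ... | false = ≤-trans (sum-map-filter P? f xs) (m≤n+m _ (f x))

  below-average : ∀ (f : A → ℕ) x xs → ∃[ y ] y ∈ x ∷ xs × length (x ∷ xs) * f y ≤ sum (map f (x ∷ xs))
  below-average f x [] = x , here refl , ≤-refl
  below-average f x (y ∷ ys) with below-average f y ys
  ... | z , z∈ , avg with f z ≤? f x
  ...   | yes fz≤ = z , there z∈ , +-mono-≤ fz≤ avg
  ...   | no fz≰  = x , here refl , +-monoʳ-≤ (f x) (≤-trans (*-monoʳ-≤ (suc (length ys)) (<⇒≤ (≰⇒> fz≰))) avg)

  -- Some value of `f` is at most the average, and its `k`-th power is still at least `μ`. The power
  -- stands in for a k-th root of `μ`, which may be irrational.
  power-mean-bound : ∀ (f : A → ℕ) k .{{_ : NonZero k}} μ xs → (∀ {x} → x ∈ xs → μ ≤ f x ^ k) →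
    length xs ^ k * μ ≤ sum (map f xs) ^ k
  power-mean-bound f (suc k) μ [] _ = z≤n
  power-mean-bound f k μ (x ∷ xs) μ≤ = let y , y∈ , avg = below-average f x xs in begin
    length (x ∷ xs) ^ k * μ           ≤⟨ *-monoʳ-≤ (length (x ∷ xs) ^ k) (μ≤ y∈) ⟩
    length (x ∷ xs) ^ k * f y ^ k     ≡⟨ sym (^-distribʳ-* k (length (x ∷ xs)) (f y)) ⟩
    (length (x ∷ xs) * f y) ^ k       ≤⟨ ^-monoˡ-≤ k avg ⟩
    sum (map f (x ∷ xs)) ^ k          ∎
    where open ≤-Reasoning

  -- Both sides have the same number of factors; on the right, `s - x` of the factors `a` have
  -- become the larger `b`.
  tilt : ∀ {a b} → a ≤ b → ∀ x y s r → x ≤ s → x + y ≡ s + r → a ^ s * b ^ r ≤ a ^ x * b ^ y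
  tilt {a} {b} a≤b x y s r x≤s eq with m≤n⇒∃[o]m+o≡n x≤s
  ... | o , refl = begin
    a ^ (x + o) * b ^ r        ≡⟨ cong (_* b ^ r) (^-distribˡ-+-* a x o) ⟩
    a ^ x * a ^ o * b ^ r      ≤⟨ *-monoˡ-≤ (b ^ r) (*-monoʳ-≤ (a ^ x) (^-monoˡ-≤ o a≤b)) ⟩
    a ^ x * b ^ o * b ^ r      ≡⟨ *-assoc (a ^ x) _ _ ⟩
    a ^ x * (b ^ o * b ^ r)    ≡⟨ cong (a ^ x *_) (trans (sym (^-distribˡ-+-* b o r)) (cong (b ^_) (sym (+-cancelˡ-≡ x _ _ (trans eq (+-assoc x o r)))))) ⟩
    a ^ x * b ^ y              ∎
    where open ≤-Reasoning

  -- Chernoff's bound: weigh an exponent e by a^e b^(d - e) with a ≤ b.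
  module _ (a b d : ℕ) (a≤b : a ≤ b) where

    private
      w₁ : ℕ → ℕ
      w₁ e = a ^ e * b ^ (d ∸ e)

      w : ∀ {N} → Vec ℕ N → ℕ
      w []      = 1
      w (e ∷ β) = w₁ e * w β

      total = sum (map w₁ (upTo (suc d)))

      w-sum : ∀ N → sum (map w (vecs (upTo (suc d)) N)) ≡ total ^ N
      w-sum zero    = refl
      w-sum (suc N) = trans (sum-cartesianProductWith w₁ w w (λ _ _ → refl) (upTo (suc d)) (vecs (upTo (suc d)) N))
        (cong (total *_) (w-sum N))

      w-eval : ∀ {N} (β : Vec ℕ N) → β ∈ vecs (upTo (suc d)) N →
        ∃[ r ] w β ≡ a ^ Vec.sum β * b ^ r × Vec.sum β + r ≡ d * N
      w-eval {zero} [] _ = 0 , refl , sym (*-zeroʳ d)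
      w-eval {suc N} (e ∷ β) β∈ with ∈-cartesianProductWith⁻ _∷_ (upTo (suc d)) (vecs (upTo (suc d)) N) β∈
      ... | _ , _ , e∈ , β∈′ , refl with w-eval β β∈′
      ...   | r , wβ , s+r = d ∸ e + r , (begin
          a ^ e * b ^ (d ∸ e) * w β                            ≡⟨ cong (a ^ e * b ^ (d ∸ e) *_) wβ ⟩
          a ^ e * b ^ (d ∸ e) * (a ^ Vec.sum β * b ^ r)        ≡⟨ arrange (a ^ e) _ _ _ ⟩
          a ^ e * a ^ Vec.sum β * (b ^ (d ∸ e) * b ^ r)        ≡⟨ sym (cong₂ _*_ (^-distribˡ-+-* a e _) (^-distribˡ-+-* b (d ∸ e) r)) ⟩
          a ^ (e + Vec.sum β) * b ^ (d ∸ e + r)                ∎)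
        , (begin
          e + Vec.sum β + (d ∸ e + r)     ≡⟨ arrange₊ e _ _ _ ⟩
          e + (d ∸ e) + (Vec.sum β + r)   ≡⟨ cong₂ _+_ (m+[n∸m]≡n (≤-pred (∈-upTo⁻ e∈))) s+r ⟩
          d + d * N                       ≡⟨ sym (*-suc d N) ⟩
          d * suc N                       ∎)
        where
        open ≡-Reasoning
        arrange : ∀ x y z u → x * y * (z * u) ≡ x * z * (y * u)
        arrange = solve-∀
        arrange₊ : ∀ x y z u → x + y + (z + u) ≡ x + z + (y + u)
        arrange₊ = solve-∀

    -- The weight a^s b^r of a vector falls as its total s grows, so on `low` it is smallest at s =
    -- dN/(d+1). This need not be an integer, hence the power `suc d` throughout. The weights of all
    -- vectors together sum to `total ^ N`.
    low-bound : ∀ N → length (low (suc d) d N) ^ suc d * (a ^ d * b ^ (d * d)) ^ N ≤ (total ^ N) ^ suc d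
    low-bound N = ≤-trans
      (power-mean-bound w (suc d) ((a ^ d * b ^ (d * d)) ^ N) (low (suc d) d N) heavy)
      (^-monoˡ-≤ (suc d) (≤-trans (sum-map-filter _ w (vecs (upTo (suc d)) N)) (≤-reflexive (w-sum N))))
      where
      open ≤-Reasoning
      heavy : ∀ {β} → β ∈ low (suc d) d N → (a ^ d * b ^ (d * d)) ^ N ≤ w β ^ suc d
      heavy {β} β∈ with ∈-filter⁻ (λ β → suc d * Vec.sum β ≤? d * N) {xs = vecs (upTo (suc d)) N} β∈
      ... | β∈′ , light with w-eval β β∈′
      ...   | r , wβ , s+r = begin
        (a ^ d * b ^ (d * d)) ^ N                         ≡⟨ trans (^-distribʳ-* N (a ^ d) _) (cong₂ _*_ (^-*-assoc a d N) (^-*-assoc b (d * d) N)) ⟩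
        a ^ (d * N) * b ^ (d * d * N)                     ≤⟨ tilt a≤b (suc d * s) (suc d * r) (d * N) (d * d * N) light exponents ⟩
        a ^ (suc d * s) * b ^ (suc d * r)                 ≡⟨ cong₂ _*_ (flip a s) (flip b r) ⟩
        (a ^ s) ^ suc d * (b ^ r) ^ suc d                 ≡⟨ sym (^-distribʳ-* (suc d) (a ^ s) (b ^ r)) ⟩
        (a ^ s * b ^ r) ^ suc d                           ≡⟨ cong (_^ suc d) (sym wβ) ⟩
        w β ^ suc d                                       ∎
        where
        s = Vec.sum β
        flip : ∀ a s → a ^ (suc d * s) ≡ (a ^ s) ^ suc d
        flip a s = trans (cong (a ^_) (*-comm (suc d) s)) (sym (^-*-assoc a s (suc d)))
        exponents : suc d * s + suc d * r ≡ d * N + d * d * N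
        exponents = trans (sym (*-distribˡ-+ (suc d) s r)) (trans (cong (suc d *_) s+r) (cong (d * N +_) (sym (*-assoc d d N))))

  -- The exponents 0, 1, 2 get the weights 25, 15, 9 with sum 49, and 5625 = 3^2 · 5^4. The claim
  -- reduces to 49^3 / 5625 ≤ 2.756^3. The ratio 3/5 is close to (√33 - 1)/8 ≈ 0.593, where (1 + x +
  -- x^2) / x^(2/3) is smallest.
  low-bound-3 : ∀ N → length (low 3 2 N) * 1000 ^ N ≤ 2756 ^ N
  low-bound-3 N = ^-cancelˡ-≤ 3 _ _ (*-cancelʳ-≤ _ _ (5625 ^ N) {{m^n≢0 5625 N}} (begin
    (L * 1000 ^ N) ^ 3 * 5625 ^ N           ≡⟨ trans (cong (_* 5625 ^ N) (^-distribʳ-* 3 L (1000 ^ N))) (arrange (L ^ 3) _ _) ⟩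
    L ^ 3 * 5625 ^ N * (1000 ^ N) ^ 3       ≤⟨ *-monoˡ-≤ _ (low-bound 3 5 2 (s≤s (s≤s (s≤s z≤n))) N) ⟩
    (49 ^ N) ^ 3 * (1000 ^ N) ^ 3           ≡⟨ cong₂ _*_ (exchange 49 N) (exchange 1000 N) ⟩
    117649 ^ N * 1000000000 ^ N             ≡⟨ sym (^-distribʳ-* N 117649 1000000000) ⟩
    117649000000000 ^ N                     ≤⟨ ^-monoˡ-≤ N (≤ᵇ⇒≤ 117649000000000 (20933297216 * 5625) _) ⟩
    (20933297216 * 5625) ^ N                ≡⟨ ^-distribʳ-* N 20933297216 5625 ⟩
    20933297216 ^ N * 5625 ^ N              ≡⟨ cong (_* 5625 ^ N) (sym (exchange 2756 N)) ⟩
    (2756 ^ N) ^ 3 * 5625 ^ N               ∎))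
    where
    open ≤-Reasoning
    L = length (low 3 2 N)
    arrange : ∀ x y z → x * y * z ≡ x * z * y
    arrange = solve-∀
    exchange : ∀ c N → (c ^ N) ^ 3 ≡ (c ^ 3) ^ N
    exchange c N = trans (^-*-assoc c N 3) (trans (cong (c ^_) (*-comm N 3)) (sym (^-*-assoc c 3 N)))

  -- With weights 2^(d-e) the total is below 2^(d+1), and (2^(d+1))^(d+1) / 2^(d·d) = 2^(2d+1) is at
  -- most 4^(d+1).
  low-bound-4 : ∀ d N → length (low (suc d) d N) ≤ 4 ^ N
  low-bound-4 d N = ^-cancelˡ-≤ (suc d) L (4 ^ N) (*-cancelʳ-≤ _ _ (2 ^ (d * d * N)) {{m^n≢0 2 (d * d * N)}} (begin
    L ^ suc d * 2 ^ (d * d * N)                       ≡⟨ cong (L ^ suc d *_) (sym (trans (cong (_^ N) (trans (cong (_* 2 ^ (d * d)) (^-zeroˡ d)) (*-identityˡ _))) (^-*-assoc 2 (d * d) N))) ⟩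
    L ^ suc d * (1 ^ d * 2 ^ (d * d)) ^ N             ≤⟨ low-bound 1 2 d (s≤s z≤n) N ⟩
    (sum (map (λ e → 1 ^ e * 2 ^ (d ∸ e)) (upTo (suc d))) ^ N) ^ suc d   ≤⟨ ^-monoˡ-≤ (suc d) (^-monoˡ-≤ N (geometric d)) ⟩
    ((2 ^ suc d) ^ N) ^ suc d                         ≡⟨ trans (cong (_^ suc d) (^-*-assoc 2 (suc d) N)) (^-*-assoc 2 (suc d * N) (suc d)) ⟩
    2 ^ (suc d * N * suc d)                           ≤⟨ ^-monoʳ-≤ 2 (≤-trans (m≤m+n _ N) (≤-reflexive (exponents d N))) ⟩
    2 ^ (2 * (N * suc d) + d * d * N)                 ≡⟨ ^-distribˡ-+-* 2 (2 * (N * suc d)) _ ⟩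
    2 ^ (2 * (N * suc d)) * 2 ^ (d * d * N)           ≡⟨ cong (_* 2 ^ (d * d * N)) (trans (sym (^-*-assoc 2 2 (N * suc d))) (sym (^-*-assoc 4 N (suc d)))) ⟩
    (4 ^ N) ^ suc d * 2 ^ (d * d * N)                 ∎))
    where
    open ≤-Reasoning
    L = length (low (suc d) d N)
    exponents : ∀ d N → suc d * N * suc d + N ≡ 2 * (N * suc d) + d * d * N
    exponents = solve-∀
    shifted : ∀ d → sum (map (λ e → 1 ^ e * 2 ^ (d ∸ e)) (upTo (suc d))) ≡ sum (map (λ e → 2 ^ (d ∸ e)) (upTo (suc d)))
    shifted d = cong sum (map-cong (λ e → trans (cong (_* 2 ^ (d ∸ e)) (^-zeroˡ e)) (*-identityˡ _)) (upTo (suc d)))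
    geometric : ∀ d → sum (map (λ e → 1 ^ e * 2 ^ (d ∸ e)) (upTo (suc d))) ≤ 2 ^ suc d
    geometric d = ≤-trans (≤-reflexive (shifted d)) (<⇒≤ (go d))
      where
      step : ∀ d → sum (map (λ e → 2 ^ (suc d ∸ e)) (upTo (suc (suc d)))) ≡ 2 ^ suc d + sum (map (λ e → 2 ^ (d ∸ e)) (upTo (suc d)))
      step d = cong (λ xs → 2 ^ suc d + sum xs)
        (trans (map-applyUpTo suc (λ e → 2 ^ (suc d ∸ e)) (suc d)) (sym (map-applyUpTo (λ e → e) (λ e → 2 ^ (d ∸ e)) (suc d))))
      go : ∀ d → sum (map (λ e → 2 ^ (d ∸ e)) (upTo (suc d))) < 2 ^ suc d
      go zero    = s≤s (s≤s z≤n)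
      go (suc d) = begin-strict
        sum (map (λ e → 2 ^ (suc d ∸ e)) (upTo (suc (suc d))))        ≡⟨ step d ⟩
        2 ^ suc d + sum (map (λ e → 2 ^ (d ∸ e)) (upTo (suc d)))      <⟨ +-monoʳ-< (2 ^ suc d) (go d) ⟩
        2 ^ suc d + 2 ^ suc d                                         ≡⟨ cong (2 ^ suc d +_) (sym (+-identityʳ _)) ⟩
        2 ^ suc (suc d)                                               ∎

open MonomialCount

open import Data.Nat.ListAction using (sum)

-- Minimal witnesses, supports, and growth rates over an abstract scale.

least : ∀ {ℓ} {P : ℕ → Set ℓ} → Decidable P → ∀ n → P n → ∃[ m ] m ≤ n × P m × (∀ l → P l → m ≤ l)
least {P = P} P? n pn = go n 0 (ℕ.+-identityʳ n) (λ l _ → z≤n)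
  where
  go : ∀ k m → k ℕ.+ m ≡ n → (∀ l → P l → m ≤ l) → ∃[ m ] m ≤ n × P m × (∀ l → P l → m ≤ l)
  go zero    m refl low = m , ℕ.≤-refl , pn , low
  go (suc k) m eq low with P? m
  ... | yes pm = m , subst (m ≤_) eq (ℕ.m≤n+m m (suc k)) , pm , low
  ... | no ¬pm = go k (suc m) (trans (ℕ.+-suc k m) eq) λ l pl → ℕ.≤∧≢⇒< (low l pl) λ { refl → ¬pm pl }

size : ∀ {n} → Vec Bool n → ℕ
size []          = 0
size (true ∷ σ)  = suc (size σ)
size (false ∷ σ) = size σ

bools : List Bool
bools = true ∷ false ∷ []

∈bools : ∀ b → b ∈ bools
∈bools true  = here refl
∈bools false = there (here refl)

-- What the summation over supports needs of a scale. A scale compares only natural numbers with its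
-- elements, so monotonicity appears in mixed form.
record ScaleLaws (K : Scale) : Set where
  open Scale K using (rawSemiring; Carrier; _≼_)
  open RawSemiring rawSemiring using (_+_; _*_; 1#)
  field
    *-assoc     : ∀ x y z → (x * y) * z ≡ x * (y * z)
    *-identityˡ : ∀ x → 1# * x ≡ x
    distribˡ    : ∀ x y z → x * (y + z) ≡ x * y + x * z
    distribʳ    : ∀ x y z → (y + z) * x ≡ y * x + z * x
    ≼-down      : ∀ {L M x} → L ≤ M → M ≼ x → L ≼ x
    +-≼         : ∀ {L M x y} → L ≼ x → M ≼ y → (L ℕ.+ M) ≼ (x + y)
    *-≼         : ∀ {L M x y} → L ≼ x → M ≼ y → (L ℕ.* M) ≼ (x * y)
    1≼1         : 1 ≼ 1#

n≤2^n : ∀ n → n ≤ 2 ℕ.^ n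
n≤2^n zero    = z≤n
n≤2^n (suc n) = ℕ.+-mono-≤ (ℕ.m^n>0 2 n) (ℕ.≤-trans (n≤2^n n) (ℕ.m≤m+n _ 0))

-- This is the sum of (n choose i) · M(i) over i. Running over the supports themselves gives it the
-- shape that the pigeonhole principle asks for.
size-sum : (ℕ → ℕ) → ℕ → ℕ
size-sum M n = sum (map (M ∘ size) (vecs bools n))

size-sum-suc : ∀ M n → size-sum M (suc n) ≡ size-sum (M ∘ suc) n ℕ.+ size-sum M n
size-sum-suc M n = begin
  sum (map f (map (true ∷_) vs ++ (map (false ∷_) vs ++ [])))       ≡⟨ cong (λ ws → sum (map f (map (true ∷_) vs ++ ws))) (++-identityʳ _) ⟩
  sum (map f (map (true ∷_) vs ++ map (false ∷_) vs))               ≡⟨ cong sum (map-++ f (map (true ∷_) vs) _) ⟩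
  sum (map f (map (true ∷_) vs) ++ map f (map (false ∷_) vs))       ≡⟨ sum-++ (map f (map (true ∷_) vs)) _ ⟩
  sum (map f (map (true ∷_) vs)) ℕ.+ sum (map f (map (false ∷_) vs)) ≡⟨ sym (cong₂ ℕ._+_ (cong sum (map-∘ vs)) (cong sum (map-∘ vs))) ⟩
  size-sum (M ∘ suc) n ℕ.+ size-sum M n                             ∎
  where
  open ≡-Reasoning
  f : ∀ {n} → Vec Bool n → ℕ
  f = M ∘ size
  vs = vecs bools n

1≤size-sum : ∀ M → (∀ i → 1 ≤ M i) → ∀ n → 1 ≤ size-sum M n
1≤size-sum M 1≤M zero    = ℕ.≤-trans (1≤M 0) (ℕ.m≤m+n _ 0)
1≤size-sum M 1≤M (suc n) = ℕ.≤-trans (1≤size-sum M 1≤M n) (ℕ.≤-trans (ℕ.m≤n+m _ _) (ℕ.≤-reflexive (sym (size-sum-suc M n))))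

const-littleO : ∀ k → LittleO (λ _ → k)
const-littleO k c = c ℕ.* k , λ _ N≤n → N≤n

module _ {K : Scale} (laws : ScaleLaws K) where
  open Scale K using (rawSemiring; Carrier; _≼_)
  open RawSemiring rawSemiring using (_+_; _*_; 1#)
  open RawSemiringDefs rawSemiring using (_^_)
  open ScaleLaws laws

  ^-≼ : ∀ {L x} n → L ≼ x → (L ℕ.^ n) ≼ (x ^ n)
  ^-≼ zero    _   = 1≼1
  ^-≼ (suc n) L≼x = *-≼ L≼x (^-≼ n L≼x)

  ^-homo-+ : ∀ x m n → x ^ (m ℕ.+ n) ≡ x ^ m * x ^ n
  ^-homo-+ x zero    n = sym (*-identityˡ _)
  ^-homo-+ x (suc m) n = trans (cong (x *_) (^-homo-+ x m n)) (sym (*-assoc x _ _))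

  -- Binomial theorem: subsets of size i, weighted by β^i, sum to (β + 1)^n.
  size-sum-≼ : ∀ {β} n M C → (∀ i → M i ≼ (C * β ^ i)) → size-sum M n ≼ (C * (β + 1#) ^ n)
  size-sum-≼ zero    M C M≼ = ≼-down (ℕ.≤-reflexive (ℕ.+-identityʳ (M 0))) (M≼ 0)
  size-sum-≼ {β} (suc n) M C M≼ = subst₂ _≼_ (sym (size-sum-suc M n)) expand
    (+-≼ (size-sum-≼ n (M ∘ suc) (C * β) (λ i → subst (M (suc i) ≼_) (sym (*-assoc C β _)) (M≼ (suc i)))) (size-sum-≼ n M C M≼))
    where
    open ≡-Reasoning
    X = (β + 1#) ^ n
    expand : (C * β) * X + C * X ≡ C * ((β + 1#) * X)
    expand = begin
      (C * β) * X + C * X          ≡⟨ cong₂ _+_ (*-assoc C β X) (cong (C *_) (sym (*-identityˡ X))) ⟩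
      C * (β * X) + C * (1# * X)   ≡⟨ sym (distribˡ C _ _) ⟩
      C * (β * X + 1# * X)         ≡⟨ cong (C *_) (sym (distribʳ X β 1#)) ⟩
      C * ((β + 1#) * X)           ∎

  -- `M i` is a natural number below β^i that replaces it in the count, as β^i need not be an
  -- integer. The constant factor `suc c` is at most 2^(c+1), hence at most (β + 1)^(c+1), and so
  -- becomes the constant error term `suc c`.
  bounded-by-supports : ∀ {a} (Is : ℕ → ℕ ⁺ → Set a) {β} (M N : ℕ → ℕ) c →
    2 ≼ (β + 1#) → (∀ i → 1 ≤ M i) → (∀ i → M i ≼ (β ^ i)) → (∀ i → N i ≤ c ℕ.* M i) →
    (∀ n → ∃[ L ] L ≤ suc (size-sum N n) × Is n [ L ]) →
    Bounded K (β + 1#) Is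
  bounded-by-supports Is {β} M N c 2≼ 1≤M M≼ N≤ is = (λ _ → suc c) , const-littleO (suc c) , λ n _ →
    let L , L≤ , Is-L = is n in L , Is-L , ≼-down (L≤Σ n L L≤)
      (subst ((size-sum M n ℕ.* 2 ℕ.^ suc c) ≼_) (sym (^-homo-+ (β + 1#) n (suc c)))
        (*-≼ (subst (size-sum M n ≼_) (*-identityˡ _) (size-sum-≼ n M 1# (λ i → subst (M i ≼_) (sym (*-identityˡ _)) (M≼ i)))) (^-≼ (suc c) 2≼)))
    where
    open ℕ.≤-Reasoning
    L≤Σ : ∀ n L → L ≤ suc (size-sum N n) → L ≤ size-sum M n ℕ.* 2 ℕ.^ suc c
    L≤Σ n L L≤ = begin
      L                                   ≤⟨ L≤ ⟩
      -- The additional term 1 is paid for by one copy of `size-sum M n`, which is at least 1.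
      suc (size-sum N n)                  ≤⟨ ℕ.+-mono-≤ (1≤size-sum M 1≤M n) (sum-map-mono (N ∘ size) (λ σ → c ℕ.* M (size σ)) (vecs bools n) (λ {σ} _ → N≤ (size σ))) ⟩
      size-sum M n ℕ.+ sum (map (λ σ → c ℕ.* M (size σ)) (vecs bools n))  ≡⟨ cong (size-sum M n ℕ.+_) (sum-map-*ˡ c (M ∘ size) (vecs bools n)) ⟩
      suc c ℕ.* size-sum M n              ≡⟨ ℕ.*-comm (suc c) _ ⟩
      size-sum M n ℕ.* suc c              ≤⟨ ℕ.*-monoʳ-≤ (size-sum M n) (n≤2^n (suc c)) ⟩
      size-sum M n ℕ.* 2 ℕ.^ suc c        ∎

-- The rational scale.

ι : ℕ → ℚ
ι n = (ℤ.+ n) ℚ./ 1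

private
  ι-unnormalised : ∀ n → ℚ.toℚᵘ (ι n) ℚᵘ.≃ ℚᵘ.mkℚᵘ (ℤ.+ n) 0
  ι-unnormalised n = ℚ.toℚᵘ-fromℚᵘ (ℚᵘ.mkℚᵘ (ℤ.+ n) 0)

ι-+ : ∀ m n → ι (m ℕ.+ n) ≡ ι m ℚ.+ ι n
ι-+ m n = ℚ.toℚᵘ-injective (begin-equality
  ℚ.toℚᵘ (ι (m ℕ.+ n))                         ≃⟨ ι-unnormalised (m ℕ.+ n) ⟩
  ℚᵘ.mkℚᵘ (ℤ.+ (m ℕ.+ n)) 0                      ≃⟨ ℚᵘ.*≡* (cong (ℤ._* ℤ.+ 1) (sym (cong₂ ℤ._+_ (ℤ.*-identityʳ (ℤ.+ m)) (ℤ.*-identityʳ (ℤ.+ n))))) ⟩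
  ℚᵘ.mkℚᵘ (ℤ.+ m) 0 ℚᵘ.+ ℚᵘ.mkℚᵘ (ℤ.+ n) 0         ≃⟨ ℚᵘ.+-cong (ℚᵘ.≃-sym (ι-unnormalised m)) (ℚᵘ.≃-sym (ι-unnormalised n)) ⟩
  ℚ.toℚᵘ (ι m) ℚᵘ.+ ℚ.toℚᵘ (ι n)               ≃⟨ ℚᵘ.≃-sym (ℚ.toℚᵘ-homo-+ (ι m) (ι n)) ⟩
  ℚ.toℚᵘ (ι m ℚ.+ ι n)                         ∎)
  where open ℚᵘ.≤-Reasoning

ι-* : ∀ m n → ι (m ℕ.* n) ≡ ι m ℚ.* ι n
ι-* m n = ℚ.toℚᵘ-injective (begin-equality
  ℚ.toℚᵘ (ι (m ℕ.* n))                         ≃⟨ ι-unnormalised (m ℕ.* n) ⟩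
  ℚᵘ.mkℚᵘ (ℤ.+ (m ℕ.* n)) 0                      ≃⟨ ℚᵘ.*≡* (cong (ℤ._* ℤ.+ 1) (ℤ.pos-* m n)) ⟩
  ℚᵘ.mkℚᵘ (ℤ.+ m) 0 ℚᵘ.* ℚᵘ.mkℚᵘ (ℤ.+ n) 0         ≃⟨ ℚᵘ.*-cong (ℚᵘ.≃-sym (ι-unnormalised m)) (ℚᵘ.≃-sym (ι-unnormalised n)) ⟩
  ℚ.toℚᵘ (ι m) ℚᵘ.* ℚ.toℚᵘ (ι n)               ≃⟨ ℚᵘ.≃-sym (ℚ.toℚᵘ-homo-* (ι m) (ι n)) ⟩
  ℚ.toℚᵘ (ι m ℚ.* ι n)                         ∎)
  where open ℚᵘ.≤-Reasoning

ι-mono : ∀ {m n} → m ≤ n → ι m ℚ.≤ ι n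
ι-mono {m} {n} m≤n = ℚ.toℚᵘ-cancel-≤ (begin
  ℚ.toℚᵘ (ι m)       ≃⟨ ι-unnormalised m ⟩
  ℚᵘ.mkℚᵘ (ℤ.+ m) 0    ≤⟨ ℚᵘ.*≤* (ℤ.*-monoʳ-≤-nonNeg (ℤ.+ 1) (ℤ.+≤+ m≤n)) ⟩
  ℚᵘ.mkℚᵘ (ℤ.+ n) 0    ≃⟨ ℚᵘ.≃-sym (ι-unnormalised n) ⟩
  ℚ.toℚᵘ (ι n)       ∎)
  where open ℚᵘ.≤-Reasoning

ℚ-laws : ScaleLaws ℚ-scale
ℚ-laws = record
  { *-assoc     = ℚ.*-assoc
  ; *-identityˡ = ℚ.*-identityˡ
  ; distribˡ    = ℚ.*-distribˡ-+
  ; distribʳ    = ℚ.*-distribʳ-+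
  ; ≼-down      = λ L≤M M≼x → ℚ.≤-trans (ι-mono L≤M) M≼x
  ; +-≼         = λ {L} {M} {x} {y} L≼ M≼ → subst (ℚ._≤ x ℚ.+ y) (sym (ι-+ L M)) (ℚ.+-mono-≤ L≼ M≼)
  ; *-≼         = λ {L} {M} {x} {y} L≼ M≼ → subst (ℚ._≤ x ℚ.* y) (sym (ι-* L M)) (ℚ.≤-trans
      (ℚ.*-monoʳ-≤-nonNeg (ι M) {{ℚ.nonNegative (ι-mono {0} {M} z≤n)}} L≼)
      (ℚ.*-monoˡ-≤-nonNeg x {{ℚ.nonNegative (ℚ.≤-trans (ι-mono {0} {L} z≤n) L≼)}} M≼))
  ; 1≼1         = ℚ.≤-refl
  }

module _ where
  open RawSemiringDefs ℚ.+-*-rawSemiring using () renaming (_^_ to _^ℚ_)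

  private
    2·756 : ℚ
    2·756 = (ℤ.+ 2756) ℚ./ 1000

    clear-denominator : ∀ m → 2·756 ^ℚ m ℚ.* ι (1000 ℕ.^ m) ≡ ι (2756 ℕ.^ m)
    clear-denominator zero    = refl
    clear-denominator (suc m) = begin
      (2·756 ℚ.* x) ℚ.* ι (1000 ℕ.* 1000 ℕ.^ m)      ≡⟨ cong ((2·756 ℚ.* x) ℚ.*_) (ι-* 1000 (1000 ℕ.^ m)) ⟩
      (2·756 ℚ.* x) ℚ.* (ι 1000 ℚ.* ι (1000 ℕ.^ m))  ≡⟨ interchange 2·756 x (ι 1000) _ ⟩
      (2·756 ℚ.* ι 1000) ℚ.* (x ℚ.* ι (1000 ℕ.^ m))  ≡⟨ cong (ι 2756 ℚ.*_) (clear-denominator m) ⟩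
      ι 2756 ℚ.* ι (2756 ℕ.^ m)                      ≡⟨ sym (ι-* 2756 (2756 ℕ.^ m)) ⟩
      ι (2756 ℕ.^ suc m)                             ∎
      where
      open ≡-Reasoning
      open import Algebra.Properties.CommutativeSemigroup (CommutativeMonoid.commutativeSemigroup ℚ.*-1-commutativeMonoid) using (interchange)
      x = 2·756 ^ℚ m

  ≼-2·756 : ∀ {L} m → L ℕ.* 1000 ℕ.^ m ≤ 2756 ℕ.^ m → ι L ℚ.≤ 2·756 ^ℚ m
  ≼-2·756 {L} m L≤ = ℚ.*-cancelʳ-≤-pos (ι (1000 ℕ.^ m)) {{ι-positive (1000 ℕ.^ m) (ℕ.m^n>0 1000 m)}}
    (subst₂ ℚ._≤_ (ι-* L (1000 ℕ.^ m)) (sym (clear-denominator m)) (ι-mono L≤))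
    where
    ι-positive : ∀ n → 1 ≤ n → ℚ.Positive (ι n)
    ι-positive n 1≤n = ℚ.positive (ℚ.<-≤-trans (ℚ.positive⁻¹ (ι 1)) (ι-mono 1≤n))

  ^ℚ-assoc : ∀ x k i → (x ^ℚ k) ^ℚ i ≡ x ^ℚ (i ℕ.* k)
  ^ℚ-assoc x k zero    = refl
  ^ℚ-assoc x k (suc i) = trans (cong (x ^ℚ k ℚ.*_) (^ℚ-assoc x k i)) (sym (^-homo-+ ℚ-laws x k (i ℕ.* k)))

-- The scale of numbers a + b√d.

module SurdArithmetic (d : ℕ) where
  open import Data.Nat.Base using (_+_; _*_)

  square-cancel : ∀ {m n} → m * m ≤ n * n → m ≤ n
  square-cancel mm≤nn = ℕ.≮⇒≥ λ n<m → ℕ.<⇒≱ (ℕ.*-mono-< n<m n<m) mm≤nn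

  sq : ∀ n → n ℕ.^ 2 ≡ n * n
  sq n = cong (n *_) (ℕ.*-identityʳ n)

  -- The excess u = L ∸ a over the rational part is at most b√d.
  Excess : ℕ → ℕ → Set
  Excess u b = u * u ≤ b * b * d

  cross : ∀ {u v b c} → Excess u b → Excess v c → u * v ≤ d * (b * c)
  cross {u} {v} {b} {c} eu ev = square-cancel (begin
    u * v * (u * v)                        ≡⟨ arrange u v ⟩
    u * u * (v * v)                        ≤⟨ ℕ.*-mono-≤ eu ev ⟩
    b * b * d * (c * c * d)            ≡⟨ arrange′ b c d ⟩
    d * (b * c) * (d * (b * c))        ∎)
    where
    open ℕ.≤-Reasoning
    arrange : ∀ u v → u * v * (u * v) ≡ u * u * (v * v)
    arrange = solve-∀
    arrange′ : ∀ b c d → b * b * d * (c * c * d) ≡ d * (b * c) * (d * (b * c))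
    arrange′ = solve-∀

  -- One estimate for both operations: coefficients 1 and 1 give the sum, and the two rational parts
  -- as coefficients give the mixed terms of the product (a + u)(a′ + v). The term u v is settled by
  -- `cross`.
  excess-combination : ∀ {u v b c} s t → Excess u b → Excess v c → Excess (s * u + t * v) (s * b + t * c)
  excess-combination {u} {v} {b} {c} s t eu ev = begin
    (s * u + t * v) * (s * u + t * v)                                    ≡⟨ expand s t u v ⟩
    s * s * (u * u) + t * t * (v * v) + 2 * s * t * (u * v)     ≤⟨ ℕ.+-mono-≤ (ℕ.+-mono-≤ (ℕ.*-monoʳ-≤ (s * s) eu) (ℕ.*-monoʳ-≤ (t * t) ev)) (ℕ.*-monoʳ-≤ (2 * s * t) (cross {u} {v} {b} {c} eu ev)) ⟩
    s * s * (b * b * d) + t * t * (c * c * d) + 2 * s * t * (d * (b * c))  ≡⟨ collect s t b c d ⟩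
    (s * b + t * c) * (s * b + t * c) * d                              ∎
    where
    open ℕ.≤-Reasoning
    expand : ∀ s t u v → (s * u + t * v) * (s * u + t * v) ≡ s * s * (u * u) + t * t * (v * v) + 2 * s * t * (u * v)
    expand = solve-∀
    collect : ∀ s t b c d → s * s * (b * b * d) + t * t * (c * c * d) + 2 * s * t * (d * (b * c)) ≡ (s * b + t * c) * (s * b + t * c) * d
    collect = solve-∀

  assoc₁ : ∀ d a b a′ b′ a″ b″ → (a * a′ + d * (b * b′)) * a″ + d * ((a * b′ + b * a′) * b″) ≡ a * (a′ * a″ + d * (b′ * b″)) + d * (b * (a′ * b″ + b′ * a″))
  assoc₁ = solve-∀
  assoc₂ : ∀ d a b a′ b′ a″ b″ → (a * a′ + d * (b * b′)) * b″ + (a * b′ + b * a′) * a″ ≡ a * (a′ * b″ + b′ * a″) + b * (a′ * a″ + d * (b′ * b″))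
  assoc₂ = solve-∀
  id₁ : ∀ d a b → 1 * a + d * (0 * b) ≡ a
  id₁ = solve-∀
  id₂ : ∀ d a b → 1 * b + 0 * a ≡ b
  id₂ = solve-∀
  distribˡ₁ : ∀ d a b a′ b′ a″ b″ → a * (a′ + a″) + d * (b * (b′ + b″)) ≡ (a * a′ + d * (b * b′)) + (a * a″ + d * (b * b″))
  distribˡ₁ = solve-∀
  distribˡ₂ : ∀ d a b a′ b′ a″ b″ → a * (b′ + b″) + b * (a′ + a″) ≡ (a * b′ + b * a′) + (a * b″ + b * a″)
  distribˡ₂ = solve-∀
  distribʳ₁ : ∀ d a b a′ b′ a″ b″ → (a′ + a″) * a + d * ((b′ + b″) * b) ≡ (a′ * a + d * (b′ * b)) + (a″ * a + d * (b″ * b))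
  distribʳ₁ = solve-∀
  distribʳ₂ : ∀ d a b a′ b′ a″ b″ → (a′ + a″) * b + (b′ + b″) * a ≡ (a′ * b + b′ * a) + (a″ * b + b″ * a)
  distribʳ₂ = solve-∀

module Surd (d : ℕ) where
  open RawSemiring (Scale.rawSemiring (√-scale d)) using (_+_; _*_; 1#)
  open RawSemiringDefs (Scale.rawSemiring (√-scale d)) using (_^_)
  open Scale (√-scale d) using (_≼_)
  open SurdArithmetic d

  private
    excess : ∀ {L a b} → L ≼ (a +√ b) → Excess (L ∸ a) b
    excess {L} {a} {b} = subst₂ (λ x y → x ≤ y ℕ.* d) (sq (L ∸ a)) (sq b)

    intro : ∀ L a b u → L ≤ a ℕ.+ u → Excess u b → L ≼ (a +√ b)
    intro L a b u L≤ exc = subst₂ (λ x y → x ≤ y ℕ.* d) (sym (sq (L ∸ a))) (sym (sq b))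
      (ℕ.≤-trans (ℕ.*-mono-≤ L∸a≤ L∸a≤) exc)
      where
      L∸a≤ : L ∸ a ≤ u
      L∸a≤ = ℕ.m≤n+o⇒m∸n≤o L a L≤

  laws : ScaleLaws (√-scale d)
  laws = record
    { *-assoc     = λ (a +√ b) (a′ +√ b′) (a″ +√ b″) → cong₂ _+√_ (assoc₁ d a b a′ b′ a″ b″) (assoc₂ d a b a′ b′ a″ b″)
    ; *-identityˡ = λ (a +√ b) → cong₂ _+√_ (id₁ d a b) (id₂ d a b)
    ; distribˡ    = λ (a +√ b) (a′ +√ b′) (a″ +√ b″) → cong₂ _+√_ (distribˡ₁ d a b a′ b′ a″ b″) (distribˡ₂ d a b a′ b′ a″ b″)
    ; distribʳ    = λ (a +√ b) (a′ +√ b′) (a″ +√ b″) → cong₂ _+√_ (distribʳ₁ d a b a′ b′ a″ b″) (distribʳ₂ d a b a′ b′ a″ b″)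
    ; ≼-down      = λ {L} {M} {x} → down {L} {M} {x}
    ; +-≼         = λ {L} {M} {x} {y} → plus {L} {M} {x} {y}
    ; *-≼         = λ {L} {M} {x} {y} → times {L} {M} {x} {y}
    ; 1≼1         = z≤n
    }
    where
    down : ∀ {L M x} → L ≤ M → M ≼ x → L ≼ x
    down {L} {M} {a +√ b} L≤M M≼ = intro L a b (M ∸ a) (ℕ.≤-trans L≤M (ℕ.m≤n+m∸n M a)) (excess {M} {a} {b} M≼)

    plus : ∀ {L M x y} → L ≼ x → M ≼ y → (L ℕ.+ M) ≼ (x + y)
    plus {L} {M} {a +√ b} {a′ +√ b′} L≼ M≼ = intro (L ℕ.+ M) (a ℕ.+ a′) (b ℕ.+ b′) (1 ℕ.* u ℕ.+ 1 ℕ.* v)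
      (begin
        L ℕ.+ M                                  ≤⟨ ℕ.+-mono-≤ (ℕ.m≤n+m∸n L a) (ℕ.m≤n+m∸n M a′) ⟩
        (a ℕ.+ u) ℕ.+ (a′ ℕ.+ v)                 ≡⟨ arrange a u a′ v ⟩
        (a ℕ.+ a′) ℕ.+ (1 ℕ.* u ℕ.+ 1 ℕ.* v)     ∎)
      (subst (Excess (1 ℕ.* u ℕ.+ 1 ℕ.* v)) (cong₂ ℕ._+_ (ℕ.*-identityˡ b) (ℕ.*-identityˡ b′))
        (excess-combination {u} {v} {b} {b′} 1 1 (excess {L} {a} {b} L≼) (excess {M} {a′} {b′} M≼)))
      where
      open ℕ.≤-Reasoning
      u = L ∸ a
      v = M ∸ a′
      arrange : ∀ a u a′ v → (a ℕ.+ u) ℕ.+ (a′ ℕ.+ v) ≡ (a ℕ.+ a′) ℕ.+ (1 ℕ.* u ℕ.+ 1 ℕ.* v)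
      arrange = solve-∀

    times : ∀ {L M x y} → L ≼ x → M ≼ y → (L ℕ.* M) ≼ (x * y)
    times {L} {M} {a +√ b} {a′ +√ b′} L≼ M≼ = intro (L ℕ.* M) (a ℕ.* a′ ℕ.+ d ℕ.* (b ℕ.* b′)) (a ℕ.* b′ ℕ.+ b ℕ.* a′) (a ℕ.* v ℕ.+ a′ ℕ.* u)
      (begin
        L ℕ.* M                                                             ≤⟨ ℕ.*-mono-≤ (ℕ.m≤n+m∸n L a) (ℕ.m≤n+m∸n M a′) ⟩
        (a ℕ.+ u) ℕ.* (a′ ℕ.+ v)                                            ≡⟨ arrange a u a′ v ⟩
        a ℕ.* a′ ℕ.+ u ℕ.* v ℕ.+ (a ℕ.* v ℕ.+ a′ ℕ.* u)                     ≤⟨ ℕ.+-monoˡ-≤ _ (ℕ.+-monoʳ-≤ (a ℕ.* a′) (cross {u} {v} {b} {b′} eu ev)) ⟩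
        a ℕ.* a′ ℕ.+ d ℕ.* (b ℕ.* b′) ℕ.+ (a ℕ.* v ℕ.+ a′ ℕ.* u)            ∎)
      (subst (Excess (a ℕ.* v ℕ.+ a′ ℕ.* u)) (cong (a ℕ.* b′ ℕ.+_) (ℕ.*-comm a′ b))
        (excess-combination {v} {u} {b′} {b} a a′ ev eu))
      where
      open ℕ.≤-Reasoning
      u = L ∸ a
      v = M ∸ a′
      eu = excess {L} {a} {b} L≼
      ev = excess {M} {a′} {b′} M≼
      arrange : ∀ a u a′ v → (a ℕ.+ u) ℕ.* (a′ ℕ.+ v) ≡ a ℕ.* a′ ℕ.+ u ℕ.* v ℕ.+ (a ℕ.* v ℕ.+ a′ ℕ.* u)
      arrange = solve-∀

  √s : ℕ → ℕ[√ d ]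
  √s s = 0 +√ s

  -- Even powers of s√d are integers and odd ones are integer multiples of √d. In either case the
  -- square of the power is (s^2 d)^i, so a comparison with it can be made between squares.
  power-shape : ∀ s i → ∃[ x ]
    ((√s s ^ i ≡ x +√ 0 × x ℕ.* x ≡ (s ℕ.* s ℕ.* d) ℕ.^ i) ⊎ (√s s ^ i ≡ 0 +√ x × x ℕ.* x ℕ.* d ≡ (s ℕ.* s ℕ.* d) ℕ.^ i))
  power-shape s zero = 1 , inj₁ (refl , refl)
  power-shape s (suc i) with power-shape s i
  ... | x , inj₁ (eq , xx) = s ℕ.* x , inj₂
    ( trans (cong (√s s *_) eq) (cong₂ _+√_ (shape₁ d s x) (shape₂ s x))
    , trans (arrange d s x) (cong (s ℕ.* s ℕ.* d ℕ.*_) xx))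
    where
    shape₁ : ∀ d s x → 0 ℕ.* x ℕ.+ d ℕ.* (s ℕ.* 0) ≡ 0
    shape₁ = solve-∀
    shape₂ : ∀ s x → 0 ℕ.* 0 ℕ.+ s ℕ.* x ≡ s ℕ.* x
    shape₂ = solve-∀
    arrange : ∀ d s x → s ℕ.* x ℕ.* (s ℕ.* x) ℕ.* d ≡ s ℕ.* s ℕ.* d ℕ.* (x ℕ.* x)
    arrange = solve-∀
  ... | x , inj₂ (eq , xx) = d ℕ.* (s ℕ.* x) , inj₁
    ( trans (cong (√s s *_) eq) (cong₂ _+√_ (shape₁ d s x) (shape₂ s x))
    , trans (arrange d s x) (cong (s ℕ.* s ℕ.* d ℕ.*_) xx))
    where
    shape₁ : ∀ d s x → 0 ℕ.* 0 ℕ.+ d ℕ.* (s ℕ.* x) ≡ d ℕ.* (s ℕ.* x)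
    shape₁ = solve-∀
    shape₂ : ∀ s x → 0 ℕ.* x ℕ.+ s ℕ.* 0 ≡ 0
    shape₂ = solve-∀
    arrange : ∀ d s x → d ℕ.* (s ℕ.* x) ℕ.* (d ℕ.* (s ℕ.* x)) ≡ s ℕ.* s ℕ.* d ℕ.* (x ℕ.* x ℕ.* d)
    arrange = solve-∀

  ≼-power : ∀ {M} s i → M ℕ.* M ≤ (s ℕ.* s ℕ.* d) ℕ.^ i → M ≼ (√s s ^ i)
  ≼-power {M} s i M≤ with power-shape s i
  ... | x , inj₁ (eq , xx) = subst (M ≼_) (sym eq)
    (intro M x 0 0 (subst (M ≤_) (sym (ℕ.+-identityʳ x)) (square-cancel (subst (M ℕ.* M ≤_) (sym xx) M≤))) z≤n)
  ... | x , inj₂ (eq , xx) = subst (M ≼_) (sym eq) (intro M 0 x M ℕ.≤-refl (subst (M ℕ.* M ≤_) (sym xx) M≤))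

-- The integer part of √W. As it is at least 1, rounding down loses at most a factor 2.
integer-root : ∀ W → 1 ≤ W → ∃[ M ] 1 ≤ M × M ℕ.* M ≤ W × W ≤ (2 ℕ.* M) ℕ.* (2 ℕ.* M)
integer-root W 1≤W with least (λ m → W ℕ.<? suc m ℕ.* suc m) W (ℕ.m≤m*n (suc W) (suc W))
... | zero , _ , W< , _ = 1 , s≤s z≤n , 1≤W , ℕ.≤-trans (ℕ.<⇒≤ W<) (s≤s z≤n)
... | suc m , _ , W< , min = suc m , s≤s z≤n , ℕ.≮⇒≥ (λ W<′ → ℕ.1+n≰n (min m W<′))
  , ℕ.≤-trans (ℕ.<⇒≤ W<) (ℕ.*-mono-≤ double double)
  where
  double : suc (suc m) ≤ 2 ℕ.* suc m
  double = ℕ.≤-trans (ℕ.≤-reflexive (ℕ.+-comm 1 (suc m))) (ℕ.+-monoʳ-≤ (suc m) (s≤s z≤n))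

-- Primes, binomial coefficients and coprimality.

prime∤! : ∀ {p} → Prime p → ∀ k → k < p → ¬ p ∣ k !
prime∤! pp zero    _   p∣ = ℕ.nonTrivial⇒≢1 {{prime⇒nonTrivial pp}} (∣1⇒≡1 p∣)
prime∤! pp (suc k) k<p p∣ with euclidsLemma (suc k) (k !) pp p∣
... | inj₁ p∣k  = ℕ.<⇒≱ k<p (∣⇒≤ p∣k)
... | inj₂ p∣k! = prime∤! pp k (ℕ.<-trans (ℕ.n<1+n k) k<p) p∣k!

n∣n! : ∀ n .{{_ : NonZero n}} → n ∣ n !
n∣n! (suc m) = ∣m⇒∣m*n (m !) ∣-refl

prime∣C : ∀ {p} → Prime p → ∀ k → 0 < k → k < p → p ∣ p choose k
prime∣C {p} pp k 0<k k<p with euclidsLemma (p choose k) (k ! ℕ.* (p ℕ.∸ k) !) pp (subst (p ∣_) (sym C*) p∣p!)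
  where
  C* : (p choose k) ℕ.* (k ! ℕ.* (p ℕ.∸ k) !) ≡ p !
  C* = trans (cong (ℕ._* (k ! ℕ.* (p ℕ.∸ k) !)) (nCk≡n!/k![n-k]! (ℕ.<⇒≤ k<p)))
    (m/n*n≡m {{k ℕ.!* (p ℕ.∸ k) !≢0}} (k![n∸k]!∣n! (ℕ.<⇒≤ k<p)))
  p∣p! : p ∣ p !
  p∣p! = n∣n! p {{prime⇒nonZero pp}}
... | inj₁ d = d
... | inj₂ d with euclidsLemma (k !) _ pp d
...   | inj₁ d′ = contradiction d′ (prime∤! pp k k<p)
...   | inj₂ d′ = contradiction d′ (prime∤! pp (p ℕ.∸ k) (ℕ.∸-monoʳ-< 0<k (ℕ.<⇒≤ k<p)))

primes-coprime : ∀ {p r} → Prime p → Prime r → p ≢ r → Coprime p r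
primes-coprime pp rp p≢r (d∣p , d∣r) with prime⇒irreducible pp d∣p
... | inj₁ d≡1 = d≡1
... | inj₂ refl with prime⇒irreducible rp d∣r
...   | inj₁ d≡1 = d≡1
...   | inj₂ p≡r = contradiction p≡r p≢r

-- Characteristic, the Frobenius map and Fermat's theorem.

module FieldFacts (F : DecField) where
  open DecField F
  open import Algebra.Properties.Semiring.Exp semiring using (_^_; ^-assocʳ) public
  open import Algebra.Properties.Semiring.Mult semiring using () renaming (_×_ to _·_) public
  open import Algebra.Properties.Semiring.Mult semiring using (×1-homo-*; ×-assoc-*; ×-homo-1; ×-assocˡ) public
  open import Algebra.Properties.Ring ring using (+-cancelˡ)
  module BinomialThm = Algebra.Properties.CommutativeSemiring.Binomial commutativeSemiring
  open import Algebra.Properties.Monoid.Sum +-monoid renaming (sum to sumᶠ) using (sum-init-last; sum-cong-≗; sum-replicate-zero)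

  *-cancel : ∀ {x y z} → x ≢ 0# → x * y ≡ x * z → y ≡ z
  *-cancel {x} {y} {z} x≢0 eq = trans (sym (unfold y)) (trans (cong (x ⁻¹ *_) eq) (unfold z))
    where
    unfold : ∀ y → x ⁻¹ * (x * y) ≡ y
    unfold y = trans (sym (*-assoc _ _ _)) (trans (cong (_* y) (trans (*-comm _ _) (*-inverseʳ x≢0))) (*-identityˡ y))

  integral : ∀ {x y} → x ≢ 0# → y ≢ 0# → x * y ≢ 0#
  integral x≢0 y≢0 xy≡0 = y≢0 (*-cancel x≢0 (trans xy≡0 (sym (zeroʳ _))))

  char-annihilates : ∀ n x → n · 1# ≡ 0# → n · x ≡ 0#
  char-annihilates n x n1≡0 = trans (cong (n ·_) (sym (*-identityˡ x))) (trans (sym (×-assoc-* n 1# x)) (trans (cong (_* x) n1≡0) (zeroˡ x)))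

  ^-char : ∀ p j → (p ℕ.^ j) · 1# ≡ 0# → p · 1# ≡ 0#
  ^-char p zero    e = contradiction (trans (sym (×-homo-1 1#)) e) 1≢0
  ^-char p (suc j) e with p · 1# ≟ 0#
  ... | yes p1≡0 = p1≡0
  ... | no p1≢0 = ^-char p j (*-cancel p1≢0 (trans (sym (×1-homo-* p (p ℕ.^ j))) (trans e (sym (zeroʳ _)))))

  coprime-char : ∀ {m n} → Coprime m n → m · 1# ≡ 0# → n · 1# ≢ 0#
  coprime-char cop m1≡0 n1≡0 = 1≢0 (case m1≡0 n1≡0 (coprime-Bézout cop))
    where
    multiple : ∀ x n → n · 1# ≡ 0# → (x ℕ.* n) · 1# ≡ 0#
    multiple x n e = trans (×1-homo-* x n) (trans (cong (x · 1# *_) e) (zeroʳ _))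
    clash : ∀ x y m n → m · 1# ≡ 0# → n · 1# ≡ 0# → 1 ℕ.+ y ℕ.* n ≡ x ℕ.* m → 1# ≡ 0#
    clash x y m n m0 n0 eq = begin
      1#                           ≡⟨ sym (+-identityʳ 1#) ⟩
      1# + 0#                      ≡⟨ cong (1# +_) (sym (multiple y n n0)) ⟩
      (1 ℕ.+ y ℕ.* n) · 1#         ≡⟨ cong (_· 1#) eq ⟩
      (x ℕ.* m) · 1#               ≡⟨ multiple x m m0 ⟩
      0#                           ∎
      where open ≡-Reasoning
    case : ∀ {m n} → m · 1# ≡ 0# → n · 1# ≡ 0# → Bézout.Identity 1 m n → 1# ≡ 0#
    case {m} {n} m0 n0 (Bézout.+- x y eq) = clash x y m n m0 n0 eq
    case {m} {n} m0 n0 (Bézout.-+ x y eq) = clash y x n m n0 m0 eq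

  0^ : ∀ n .{{_ : NonZero n}} → 0# ^ n ≡ 0#
  0^ (suc n) = zeroˡ _

  module _ {p : ℕ} (pp : Prime p) (char : p · 1# ≡ 0#) where

    frobenius : ∀ x y → (x + y) ^ p ≡ x ^ p + y ^ p
    frobenius x y = go p refl
      where
      open ≡-Reasoning
      go : ∀ n → p ≡ n → (x + y) ^ n ≡ x ^ n + y ^ n
      go zero    refl = contradiction refl (ℕ.≢-nonZero⁻¹ 0 {{prime⇒nonZero pp}})
      go (suc m) refl = begin
        (x + y) ^ suc m                                  ≡⟨ BinomialThm.theorem (suc m) x y ⟩
        T zero + sumᶠ (T ∘ suc)                           ≡⟨ cong₂ _+_ first (sum-init-last (T ∘ suc)) ⟩
        y ^ suc m + (sumᶠ (T ∘ suc ∘ inject₁) + T (suc (fromℕ m)))  ≡⟨ cong (y ^ suc m +_) (cong₂ _+_ (trans (sum-cong-≗ middle) (sum-replicate-zero m)) last) ⟩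
        y ^ suc m + (0# + x ^ suc m)                     ≡⟨ cong (y ^ suc m +_) (+-identityˡ _) ⟩
        y ^ suc m + x ^ suc m                            ≡⟨ +-comm _ _ ⟩
        x ^ suc m + y ^ suc m                            ∎
        where
        T : Fin (suc (suc m)) → Carrier
        T = BinomialThm.binomialTerm x y (suc m)
        first : T zero ≡ y ^ suc m
        first = trans (cong (_· (1# * y ^ suc m)) (trans (nCk≡nC[n∸k] {k = 0} {n = suc m} z≤n) (nCn≡1 (suc m)))) (trans (×-homo-1 _) (*-identityˡ _))
        last : T (suc (fromℕ m)) ≡ x ^ suc m
        last rewrite Fin.toℕ-fromℕ m | nCn≡1 (suc m) | ℕ.n∸n≡0 m = trans (×-homo-1 _) (*-identityʳ _)
        middle : ∀ k → T (suc (inject₁ k)) ≡ 0#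
        middle k with prime∣C pp (suc (toℕ (inject₁ k))) (s≤s z≤n) (s≤s (subst (_< m) (sym (Fin.toℕ-inject₁ k)) (Fin.toℕ<n k)))
        ... | divides u eq rewrite eq =
          trans (sym (×-assocˡ _ u (suc m))) (trans (cong (u ·_) (char-annihilates (suc m) _ char)) (annihilate u))
          where
          annihilate : ∀ u → u · 0# ≡ 0#
          annihilate zero    = refl
          annihilate (suc u) = trans (+-identityˡ _) (annihilate u)

    frobenius^ : ∀ j x y → (x + y) ^ (p ℕ.^ j) ≡ x ^ (p ℕ.^ j) + y ^ (p ℕ.^ j)
    frobenius^ zero    x y = trans (*-identityʳ _) (sym (cong₂ _+_ (*-identityʳ x) (*-identityʳ y)))
    frobenius^ (suc j) x y = begin
      (x + y) ^ (p ℕ.* p ℕ.^ j)                        ≡⟨ sym (^-assocʳ (x + y) p (p ℕ.^ j)) ⟩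
      ((x + y) ^ p) ^ (p ℕ.^ j)                        ≡⟨ cong (_^ (p ℕ.^ j)) (frobenius x y) ⟩
      (x ^ p + y ^ p) ^ (p ℕ.^ j)                      ≡⟨ frobenius^ j (x ^ p) (y ^ p) ⟩
      (x ^ p) ^ (p ℕ.^ j) + (y ^ p) ^ (p ℕ.^ j)        ≡⟨ cong₂ _+_ (^-assocʳ x p (p ℕ.^ j)) (^-assocʳ y p (p ℕ.^ j)) ⟩
      x ^ (p ℕ.* p ℕ.^ j) + y ^ (p ℕ.* p ℕ.^ j)        ∎
      where open ≡-Reasoning

  module Finite {q : ℕ} (enum : Carrier ↔ Fin q) where
    open Inverse enum using (to; from; strictlyInverseˡ; strictlyInverseʳ)
    module Sum⁺ = Algebra.Properties.CommutativeMonoid.Sum +-commutativeMonoid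
    module Prod = Algebra.Properties.CommutativeMonoid.Sum *-commutativeMonoid

    Π-single : ∀ {n} (t : Fin n → Carrier) i → (∀ j → j ≢ i → t j ≡ 1#) → Prod.sum t ≡ t i
    Π-single {suc n} t i off = begin
      Prod.sum t                        ≡⟨ Prod.sum-remove {i = i} t ⟩
      t i * Prod.sum (removeAt t i)     ≡⟨ cong (t i *_) (Prod.sum-cong-≗ (λ j → off (punchIn i j) (Fin.punchInᵢ≢i i j))) ⟩
      t i * Prod.sum {n} (λ _ → 1#)     ≡⟨ cong (t i *_) (Prod.sum-replicate-zero n) ⟩
      t i * 1#                       ≡⟨ *-identityʳ _ ⟩
      t i                            ∎
      where open ≡-Reasoning

    private
      translation : Carrier → Perm.Permutation q q
      translation x = permutation (λ i → to (from i + x)) (λ i → to (from i + - x))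
        (λ i → trans (cong (λ z → to (z + x)) (strictlyInverseʳ _)) (trans (cong to (cancel (from i) (- x) x (-‿inverseˡ x))) (strictlyInverseˡ i)))
        (λ i → trans (cong (λ z → to (z + - x)) (strictlyInverseʳ _)) (trans (cong to (cancel (from i) x (- x) (-‿inverseʳ x))) (strictlyInverseˡ i)))
        where
        cancel : ∀ y u v → u + v ≡ 0# → y + u + v ≡ y
        cancel y u v e = trans (+-assoc y u v) (trans (cong (y +_) e) (+-identityʳ y))

      dilation : ∀ x → x ≢ 0# → Perm.Permutation q q
      dilation x x≢0 = permutation (λ i → to (x * from i)) (λ i → to (x ⁻¹ * from i))
        (λ i → trans (cong (λ z → to (x * z)) (strictlyInverseʳ _)) (trans (cong to (cancel x (x ⁻¹) (from i) (*-inverseʳ x≢0))) (strictlyInverseˡ i)))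
        (λ i → trans (cong (λ z → to (x ⁻¹ * z)) (strictlyInverseʳ _)) (trans (cong to (cancel (x ⁻¹) x (from i) (trans (*-comm _ _) (*-inverseʳ x≢0)))) (strictlyInverseˡ i)))
        where
        cancel : ∀ u v y → u * v ≡ 1# → u * (v * y) ≡ y
        cancel u v y e = trans (sym (*-assoc u v y)) (trans (cong (_* y) e) (*-identityˡ y))

    -- The sum of all elements is invariant under translation by 1.
    order-char : q · 1# ≡ 0#
    order-char = +-cancelˡ S _ _ (begin
      S + q · 1#                              ≡⟨ cong (S +_) (sym (Sum⁺.sum-replicate q)) ⟩
      S + Sum⁺.sum {q} (λ _ → 1#)                ≡⟨ sym (Sum⁺.∑-distrib-+ from (λ _ → 1#)) ⟩
      Sum⁺.sum (λ i → from i + 1#)               ≡⟨ Sum⁺.sum-cong-≗ (λ i → sym (strictlyInverseʳ (from i + 1#))) ⟩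
      Sum⁺.sum (λ i → from (to (from i + 1#)))   ≡⟨ sym (Sum⁺.sum-permute from (translation 1#)) ⟩
      S                                       ≡⟨ sym (+-identityʳ S) ⟩
      S + 0#                                  ∎)
      where
      open ≡-Reasoning
      S = Sum⁺.sum from

    -- The product of the nonzero elements is invariant under dilation by x.
    fermat : ∀ x → x ≢ 0# → x ^ q ≡ x
    fermat x x≢0 = begin
      x ^ q                                             ≡⟨ sym (Prod.sum-replicate q) ⟩
      Prod.sum {q} (λ _ → x)                               ≡⟨ Prod.sum-cong-≗ (λ i → sym (g*δ (from i))) ⟩
      Prod.sum (λ i → g (from i) * δ (from i))             ≡⟨ Prod.∑-distrib-+ (g ∘ from) (δ ∘ from) ⟩
      Prod.sum (g ∘ from) * Prod.sum (δ ∘ from)               ≡⟨ cong₂ _*_ Πg≡1 Πδ≡x ⟩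
      1# * x                                            ≡⟨ *-identityˡ x ⟩
      x                                                 ∎
      where
      open ≡-Reasoning
      -- `h` turns 0 into 1, so that its product over the field is the product of the nonzero
      -- elements. `g` is the factor that `h` acquires under dilation, and `δ` carries the one
      -- remaining factor `x`, at the element 0; this is why the exponent is `q` and not `q - 1`.
      h g δ : Carrier → Carrier
      h y with y ≟ 0#
      ... | yes _ = 1#
      ... | no _  = y
      g y with y ≟ 0#
      ... | yes _ = 1#
      ... | no _  = x
      δ y with y ≟ 0#
      ... | yes _ = x
      ... | no _  = 1#
      g*δ : ∀ y → g y * δ y ≡ x
      g*δ y with y ≟ 0#
      ... | yes _ = *-identityˡ x
      ... | no _  = *-identityʳ x
      h≢0 : ∀ y → h y ≢ 0#
      h≢0 y with y ≟ 0#
      ... | yes _   = 1≢0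
      ... | no y≢0  = y≢0
      h-dilate : ∀ y → h (x * y) ≡ g y * h y
      h-dilate y with y ≟ 0# | x * y ≟ 0#
      ... | yes _    | yes _    = sym (*-identityˡ 1#)
      ... | yes refl | no xy≢0  = contradiction (zeroʳ x) xy≢0
      ... | no y≢0   | yes xy≡0 = contradiction xy≡0 (integral x≢0 y≢0)
      ... | no _     | no _     = refl
      Π≢0 : ∀ {n} (t : Fin n → Carrier) → (∀ i → t i ≢ 0#) → Prod.sum t ≢ 0#
      Π≢0 {zero}  t _  = 1≢0
      Π≢0 {suc n} t nz = integral (nz zero) (Π≢0 (t ∘ suc) (nz ∘ suc))
      P = Prod.sum (h ∘ from)
      Πg≡1 : Prod.sum (g ∘ from) ≡ 1#
      Πg≡1 = *-cancel (Π≢0 (h ∘ from) (h≢0 ∘ from)) (begin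
        P * Prod.sum (g ∘ from)                      ≡⟨ *-comm P _ ⟩
        Prod.sum (g ∘ from) * P                      ≡⟨ sym (Prod.∑-distrib-+ (g ∘ from) (h ∘ from)) ⟩
        Prod.sum (λ i → g (from i) * h (from i))     ≡⟨ Prod.sum-cong-≗ (λ i → sym (trans (cong h (strictlyInverseʳ (x * from i))) (h-dilate (from i)))) ⟩
        Prod.sum (λ i → h (from (to (x * from i))))  ≡⟨ sym (Prod.sum-permute (h ∘ from) (dilation x x≢0)) ⟩
        P                                         ≡⟨ sym (*-identityʳ P) ⟩
        P * 1#                                    ∎)
      Πδ≡x : Prod.sum (δ ∘ from) ≡ x
      Πδ≡x = trans (Π-single (δ ∘ from) (to 0#) off) at0
        where
        at0 : δ (from (to 0#)) ≡ x
        at0 with from (to 0#) ≟ 0#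
        ... | yes _ = refl
        ... | no ne = contradiction (strictlyInverseʳ 0#) ne
        off : ∀ j → j ≢ to 0# → δ (from j) ≡ 1#
        off j j≢ with from j ≟ 0#
        ... | yes e = contradiction (trans (sym (strictlyInverseˡ j)) (cong to e)) j≢
        ... | no _  = refl

-- Coloured families of vectors and the diagonal bound.

module VectorSpace (F : DecField) where
  open DecField F

  0ᵛ : ∀ {n} → Vec Carrier n
  0ᵛ = replicate _ 0#

  sumᵛ : ∀ {n t} → Vec (Vec Carrier n) t → Vec Carrier n
  sumᵛ = Vec.foldr _ (zipWith _+_) 0ᵛ

lookup-injective : ∀ {a} {A : Set a} {n} (u v : Vec A n) → (∀ c → lookup u c ≡ lookup v c) → u ≡ v
lookup-injective u v eq = trans (sym (Vec.tabulate∘lookup u)) (trans (Vec.tabulate-cong eq) (Vec.tabulate∘lookup v))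

-- Position `a` is filled from the `a`-th colour class, out of the tuple numbered `lookup x a`;
-- constant `x` give back the original tuples.
mix : ∀ {a b} {I : Set a} {G : Set b} {t} → (Fin t → I → G) → Vec I t → Vec G t
mix z x = tabulate (λ a → z a (lookup x a))

another : ∀ {n} → 2 ≤ n → ∀ (b : Fin n) → ∃[ a ] a ≢ b
another (s≤s (s≤s _)) zero    = suc zero , λ ()
another (s≤s (s≤s _)) (suc b) = zero , λ ()

module Colored (F : DecField) {q k d : ℕ} (enum : DecField.Carrier F ↔ Fin q)
  (pp : Prime (suc d)) (1≤k : 1 ≤ k) (q≡ : q ≡ suc d ℕ.^ k) where
  open DecField F
  open FieldFacts F
  open Finite enum
  open VectorSpace F

  p = suc d

  char : p · 1# ≡ 0#
  char = ^-char p k (trans (cong (_· 1#) (sym q≡)) order-char)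

  private instance
    d-nonZero : NonZero d
    d-nonZero = ℕ.>-nonZero (ℕ.≤-pred (ℕ.nonTrivial⇒n>1 p {{prime⇒nonTrivial pp}}))

  module _ {L n : ℕ} (z : Fin p → Fin L → Vec Carrier n) where
    open SliceRank F {Fin L} Fin._≟_ p
    open Polynomial F {Fin L} Fin._≟_

    private
      coordinate : Fin n → Var p
      coordinate c a i = lookup (z a i) c

      S : Fin n → Vec (Fin L) p → Carrier
      S c = linear (coordinate c)

      lookup-sumᵛ-mix : ∀ {t n} (z : Fin t → Fin L → Vec Carrier n) x c →
        lookup (sumᵛ (mix z x)) c ≡ linear (λ a i → lookup (z a i) c) x
      lookup-sumᵛ-mix {n = n} z [] c = Vec.lookup-replicate c 0#
      lookup-sumᵛ-mix z (i ∷ x) c = trans (Vec.lookup-zipWith _+_ c (z zero i) (sumᵛ (mix (z ∘ suc) x)))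
        (cong (lookup (z zero i) c +_) (lookup-sumᵛ-mix (z ∘ suc) x c))

      linear-frobenius : ∀ {t} m (u : Var t) x → linear (λ a i → u a i ^ (p ℕ.^ m)) x ≡ linear u x ^ (p ℕ.^ m)
      linear-frobenius m u []      = sym (0^ (p ℕ.^ m) {{ℕ.m^n≢0 p m}})
      linear-frobenius m u (i ∷ x) = trans (cong (u zero i ^ (p ℕ.^ m) +_) (linear-frobenius m (u ∘ suc) x))
        (sym (frobenius^ pp char m (u zero i) (linear (u ∘ suc) x)))

      -- The first exponent p^m is a parameter so that the telescoping can proceed by induction.
      -- Since Frobenius is additive, the sum of a conjugate over the blocks is the conjugate of the
      -- sum.
      conjugates : Fin n → ℕ → ∀ k → Vec (Var p) k
      conjugates c m zero    = []
      conjugates c m (suc k) = (λ a i → coordinate c a i ^ (p ℕ.^ m)) ∷ conjugates c (suc m) k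

      -- (S^(p^m))^(p-1) ⋯ (S^(p^(m+k-1)))^(p-1) · S^(p^m) telescopes.
      block-conjugates : ∀ c x m k → block d (conjugates c m k) x * S c x ^ (p ℕ.^ m) ≡ S c x ^ (p ℕ.^ (m ℕ.+ k))
      block-conjugates c x m zero    = trans (*-identityˡ _) (cong (λ e → S c x ^ (p ℕ.^ e)) (sym (ℕ.+-identityʳ m)))
      block-conjugates c x m (suc k) = begin
        linear (λ a i → coordinate c a i ^ P) x ^ d * B * s ^ P  ≡⟨ cong (λ l → l ^ d * B * s ^ P) (linear-frobenius m (coordinate c) x) ⟩
        (s ^ P) ^ d * B * s ^ P                 ≡⟨ trans (cong (_* s ^ P) (*-comm _ B)) (*-assoc B _ _) ⟩
        B * ((s ^ P) ^ d * s ^ P)               ≡⟨ cong (B *_) (trans (*-comm _ _) (^-assocʳ s P p)) ⟩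
        B * s ^ (P ℕ.* p)                       ≡⟨ cong (λ e → B * s ^ e) (ℕ.*-comm P p) ⟩
        B * s ^ (p ℕ.^ suc m)                   ≡⟨ block-conjugates c x (suc m) k ⟩
        s ^ (p ℕ.^ (suc m ℕ.+ k))               ≡⟨ cong (λ e → s ^ (p ℕ.^ e)) (sym (ℕ.+-suc m k)) ⟩
        s ^ (p ℕ.^ (m ℕ.+ suc k))               ∎
        where
        open ≡-Reasoning
        s = S c x
        P = p ℕ.^ m
        B = block d (conjugates c (suc m) k) x

      block-zero : ∀ c x → S c x ≡ 0# → ∀ k → 1 ≤ k → block d (conjugates c 0 k) x ≡ 0#
      block-zero c x S≡0 (suc k) _ = trans (cong (λ l → l ^ d * rest) (trans (linear-frobenius 0 (coordinate c) x) (trans (*-identityʳ _) S≡0)))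
        (trans (cong (_* rest) (0^ d)) (zeroˡ rest))
        where rest = block d (conjugates c 1 k) x

      -- The block is S^(q-1) in disguise: multiplied by S it telescopes to S^q, which equals S, and
      -- S cancels.
      block-one : ∀ c x → S c x ≢ 0# → block d (conjugates c 0 k) x ≡ 1#
      block-one c x S≢0 = *-cancel S≢0 (begin
        s * B                ≡⟨ trans (*-comm s B) (cong (B *_) (sym (*-identityʳ s))) ⟩
        B * s ^ 1            ≡⟨ block-conjugates c x 0 k ⟩
        s ^ (p ℕ.^ k)        ≡⟨ cong (s ^_) (sym q≡) ⟩
        s ^ q                ≡⟨ fermat s S≢0 ⟩
        s                    ≡⟨ sym (*-identityʳ s) ⟩
        s * 1#               ∎)
        where
        open ≡-Reasoning
        s = S c x
        B = block d (conjugates c 0 k) x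

      cells-one : ∀ {k n} (f : Fin n → Vec (Var p) k) x → (∀ c → block d (f c) x ≡ 0#) → cells d (tabulate f) x ≡ 1#
      cells-one {n = zero}  f x _ = refl
      cells-one {n = suc n} f x b≡0 = trans (cong₂ (λ b r → (1# + - 1# * b) * r) (b≡0 zero) (cells-one (f ∘ suc) x (b≡0 ∘ suc)))
        (trans (*-identityʳ _) (trans (cong (1# +_) (zeroʳ _)) (+-identityʳ 1#)))

      cells-zero : ∀ {k n} (f : Fin n → Vec (Var p) k) x c → block d (f c) x ≡ 1# → cells d (tabulate f) x ≡ 0#
      cells-zero f x zero b≡1 = trans (cong (_* rest) (trans (cong (λ b → 1# + - 1# * b) b≡1) (trans (cong (1# +_) (*-identityʳ _)) (-‿inverseʳ 1#)))) (zeroˡ rest)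
        where rest = cells d (tabulate (f ∘ suc)) x
      cells-zero f x (suc c) b≡1 = trans (cong ((1# + - 1# * block d (f zero) x) *_) (cells-zero (f ∘ suc) x c b≡1)) (zeroʳ _)

      blocks : Vec (Vec (Var p) k) n
      blocks = tabulate (λ c → conjugates c 0 k)

      T : Tensor
      T = cells d blocks

    colored : (∀ i → sumᵛ (tabulate (λ a → z a i)) ≡ 0ᵛ) → p ℕ.* length (low p d (n ℕ.* k)) < L →
      ∃[ x ] NonConstant x × sumᵛ (mix z x) ≡ 0ᵛ
    -- The diagonal bound only refutes the absence of a solution. Searching all index tuples turns
    -- this into a solution.
    colored diag L> with any? solution? (vecs (allFin L) p)
      where
      solution? : ∀ x → Dec (NonConstant x × sumᵛ (mix z x) ≡ 0ᵛ)
      solution? x = Fin.any? (λ a → Fin.any? (λ b → ¬? (lookup x a Fin.≟ lookup x b))) ×-dec Vec.≡-dec _≟_ (sumᵛ (mix z x)) 0ᵛ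
    ... | yes s = let x , _ , sol = find s in x , sol
    ... | no ¬s = contradiction L> (ℕ.≤⇒≯ L≤)
      where
      vanish : ∀ x → sumᵛ (mix z x) ≡ 0ᵛ → ∀ c → S c x ≡ 0#
      vanish x e c = trans (sym (lookup-sumᵛ-mix z x c)) (trans (cong (λ v → lookup v c) e) (Vec.lookup-replicate c 0#))
      T-diag : ∀ {i} → T (replicate p i) ≢ 0#
      T-diag {i} T≡0 = 1≢0 (trans (sym (cells-one (λ c → conjugates c 0 k) (replicate p i) λ c →
        block-zero c (replicate p i) (vanish (replicate p i) diag′ c) k 1≤k)) T≡0)
        where
        diag′ : sumᵛ (mix z (replicate p i)) ≡ 0ᵛ
        diag′ = trans (cong sumᵛ (Vec.tabulate-cong (λ a → cong (z a) (Vec.lookup-replicate a i)))) (diag i)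
      T-off : ∀ x → Over (allFin L) x → NonConstant x → T x ≡ 0#
      T-off x _ nc with Fin.all? (λ c → S c x ≟ 0#)
      ... | no ¬all = let c , S≢0 = Fin.¬∀⟶∃¬ n (λ c → S c x ≡ 0#) (λ c → S c x ≟ 0#) ¬all in
        cells-zero (λ c → conjugates c 0 k) x c (block-one c x S≢0)
      ... | yes all = contradiction
        (lose (∈-vecs x (λ a → ∈-allFin (lookup x a))) (nc , lookup-injective _ _ λ c → trans (lookup-sumᵛ-mix z x c) (trans (all c) (sym (Vec.lookup-replicate c 0#)))))
        ¬s
      L≤ : L ≤ p ℕ.* length (low p d (n ℕ.* k))
      L≤ = let ss , len , T≡ = span-rank (concat blocks) d (cells-span d blocks) in
        subst (_≤ _) (length-tabulate {n = L} id)
          (diagonal-bound (another (ℕ.nonTrivial⇒n>1 p {{prime⇒nonTrivial pp}})) T _ ss (ℕ.≤-reflexive len) (Unique.allFin⁺ L)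
            (λ _ → T-diag) T-off (λ x _ → T≡ x))

open import Data.Nat.Base using (_^_)

-- Patterns of equal entries in a tuple.

module Pattern {G : Set} (_≟_ : DecidableEquality G) where

  firstIndex : ∀ {n} → Vec G n → Fin n → Fin n
  firstIndex (g ∷ x) zero = zero
  firstIndex (g ∷ x) (suc a) with g ≟ lookup x a
  ... | yes _ = zero
  ... | no _  = suc (firstIndex x a)

  lookup-firstIndex : ∀ {n} (x : Vec G n) a → lookup x (firstIndex x a) ≡ lookup x a
  lookup-firstIndex (g ∷ x) zero = refl
  lookup-firstIndex (g ∷ x) (suc a) with g ≟ lookup x a
  ... | yes eq = eq
  ... | no _   = lookup-firstIndex x a

  firstIndex-cong : ∀ {n} (x : Vec G n) a b → lookup x a ≡ lookup x b → firstIndex x a ≡ firstIndex x b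
  firstIndex-cong (g ∷ x) zero zero _ = refl
  firstIndex-cong (g ∷ x) zero (suc b) eq with g ≟ lookup x b
  ... | yes _ = refl
  ... | no ne = contradiction eq ne
  firstIndex-cong (g ∷ x) (suc a) zero eq with g ≟ lookup x a
  ... | yes _ = refl
  ... | no ne = contradiction (sym eq) ne
  firstIndex-cong (g ∷ x) (suc a) (suc b) eq with g ≟ lookup x a | g ≟ lookup x b
  ... | yes _ | yes _ = refl
  ... | yes e | no ne = contradiction (trans e eq) ne
  ... | no ne | yes e = contradiction (trans e (sym eq)) ne
  ... | no _  | no _  = cong suc (firstIndex-cong x a b eq)

  -- A tuple's pattern sends each position to the first one with the same entry, so that its fixed points
  -- are representatives of the distinct entries.
  pattern′ : ∀ {n} → Vec G n → Vec (Fin n) n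
  pattern′ x = tabulate (firstIndex x)

  reps : ∀ {n} → Vec (Fin n) n → List (Fin n)
  reps {n} π = filter (λ a → lookup π a Fin.≟ a) (allFin n)

  module _ {n} {x : Vec G n} {π} (π≡ : pattern′ x ≡ π) where

    pattern-firstIndex : ∀ a → lookup π a ≡ firstIndex x a
    pattern-firstIndex a = trans (cong (λ π → lookup π a) (sym π≡)) (Vec.lookup∘tabulate (firstIndex x) a)

    lookup-pattern : ∀ a → lookup x (lookup π a) ≡ lookup x a
    lookup-pattern a = trans (cong (lookup x) (pattern-firstIndex a)) (lookup-firstIndex x a)

    pattern-cong : ∀ {a b} → lookup x a ≡ lookup x b → lookup π a ≡ lookup π b
    pattern-cong {a} {b} eq = trans (pattern-firstIndex a) (trans (firstIndex-cong x a b eq) (sym (pattern-firstIndex b)))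

    pattern-idem : ∀ a → lookup π (lookup π a) ≡ lookup π a
    pattern-idem a = pattern-cong (lookup-pattern a)

    pattern∈reps : ∀ a → lookup π a ∈ reps π
    pattern∈reps a = ∈-filter⁺ (λ a → lookup π a Fin.≟ a) (∈-allFin _) (pattern-idem a)

    reps-unique : Unique (map (lookup x) (reps π))
    reps-unique = unique-map (Unique.filter⁺ (λ a → lookup π a Fin.≟ a) (Unique.allFin⁺ n))
      (λ a∈ b∈ eq → trans (sym (rep a∈)) (trans (pattern-cong eq) (rep b∈)))
      where
      rep : ∀ {a} → a ∈ reps π → lookup π a ≡ a
      rep a∈ = proj₂ (∈-filter⁻ (λ a → lookup π a Fin.≟ a) {xs = allFin n} a∈)

    -- Positions with distinct entries have distinct representatives. Together with `reps-unique`
    -- this makes the length of `reps π` the number of distinct entries.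
    reps-maximal : ∀ bs → Unique (map (lookup x) bs) → length bs ≤ length (reps π)
    reps-maximal bs u = subst (_≤ length (reps π)) (length-map (lookup π) bs)
      (unique-length Fin._≟_
        (AllPairs.map⁺ (AllPairs.map (λ ne eq → ne (trans (sym (lookup-pattern _)) (trans (cong (lookup x) eq) (lookup-pattern _)))) (AllPairs.map⁻ u)))
        λ b∈ → let a , _ , eq = ∈-map⁻ (lookup π) b∈ in subst (_∈ reps π) (sym eq) (pattern∈reps a))

-- Zero-sum tuples with many distinct entries.

module ZeroSum {G : Set} (_≟_ : DecidableEquality G) {_+_ : Op₂ G} {0# : G}
  (isCommutativeMonoid : IsCommutativeMonoid _≡_ _+_ 0#)
  (cancelˡ : ∀ x {y z} → x + y ≡ x + z → y ≡ z)
  (elements : List G) (∈elements : ∀ g → g ∈ elements)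
  (p R : ℕ) (exponent : ∀ g → Vec.foldr (λ _ → G) _+_ 0# (replicate p g) ≡ 0#)
  (colored : ∀ {L} (z : Fin p → Fin L → G) → (∀ i → Vec.foldr (λ _ → G) _+_ 0# (tabulate (λ a → z a i)) ≡ 0#) → R < L →
    ∃[ x ] (∃[ a ] ∃[ b ] lookup x a ≢ lookup x b) × Vec.foldr (λ _ → G) _+_ 0# (mix z x) ≡ 0#)
  where

  open Pattern _≟_
  open IsCommutativeMonoid isCommutativeMonoid using (assoc; comm; identityʳ)

  private
    commutativeMonoid : CommutativeMonoid _ _
    commutativeMonoid = record { isCommutativeMonoid = isCommutativeMonoid }

  open import Algebra.Properties.CommutativeSemigroup (CommutativeMonoid.commutativeSemigroup commutativeMonoid) using (x∙yz≈y∙xz)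

  Σᵛ : ∀ {t} → Vec G t → G
  Σᵛ = Vec.foldr (λ _ → G) _+_ 0#

  -- The change of a sum under an update, with the old entry moved to the other side: only a
  -- cancellative monoid is available, so nothing is subtracted.
  Σᵛ-update : ∀ {t} (x : Vec G t) a g → lookup x a + Σᵛ (x [ a ]≔ g) ≡ g + Σᵛ x
  Σᵛ-update (h ∷ x) zero    g = x∙yz≈y∙xz h g (Σᵛ x)
  Σᵛ-update (h ∷ x) (suc a) g = begin
    lookup x a + (h + Σᵛ (x [ a ]≔ g))   ≡⟨ x∙yz≈y∙xz _ h _ ⟩
    h + (lookup x a + Σᵛ (x [ a ]≔ g))   ≡⟨ cong (h +_) (Σᵛ-update x a g) ⟩
    h + (g + Σᵛ x)                       ≡⟨ x∙yz≈y∙xz h g _ ⟩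
    g + (h + Σᵛ x)                       ∎
    where open ≡-Reasoning

  Σᵛ-update₂ : ∀ {t} (x : Vec G t) {a b} → b ≢ a → ∀ {g h} → g + h ≡ lookup x a + lookup x b →
    Σᵛ ((x [ a ]≔ g) [ b ]≔ h) ≡ Σᵛ x
  Σᵛ-update₂ x {a} {b} b≢a {g} {h} eq = cancelˡ (g + h) (begin
    (g + h) + Σᵛ y                            ≡⟨ cong (_+ Σᵛ y) eq ⟩
    (lookup x a + lookup x b) + Σᵛ y          ≡⟨ assoc _ _ _ ⟩
    lookup x a + (lookup x b + Σᵛ y)          ≡⟨ cong (λ v → lookup x a + (v + Σᵛ y)) (sym (Vec.lookup∘update′ b≢a x g)) ⟩
    lookup x a + (lookup (x [ a ]≔ g) b + Σᵛ y) ≡⟨ cong (lookup x a +_) (Σᵛ-update (x [ a ]≔ g) b h) ⟩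
    lookup x a + (h + Σᵛ (x [ a ]≔ g))        ≡⟨ x∙yz≈y∙xz _ h _ ⟩
    h + (lookup x a + Σᵛ (x [ a ]≔ g))        ≡⟨ cong (h +_) (Σᵛ-update x a g) ⟩
    h + (g + Σᵛ x)                            ≡⟨ sym (assoc h g _) ⟩
    (h + g) + Σᵛ x                            ≡⟨ cong (_+ Σᵛ x) (comm h g) ⟩
    (g + h) + Σᵛ x                            ∎)
    where
    open ≡-Reasoning
    y = (x [ a ]≔ g) [ b ]≔ h

  Q = length elements

  Cycle : List G → Vec G p → Set
  Cycle A x = (∀ a → lookup x a ∈ A) × Σᵛ x ≡ 0#

  Image : Vec G p → G → Set
  Image x g = ∃[ a ] lookup x a ≡ g

  image? : ∀ x g → Dec (Image x g)
  image? x g = Fin.any? (λ a → lookup x a ≟ g)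

  image-bound : ∀ x {gs} → Unique gs → (∀ {g} → g ∈ gs → Image x g) → length gs ≤ p
  image-bound x u im = ℕ.≤-trans
    (unique-length _≟_ u (λ {g} g∈ → let a , eq = im g∈ in subst (_∈ map (lookup x) (allFin p)) eq (∈-map⁺ (lookup x) (∈-allFin a))))
    (ℕ.≤-reflexive (trans (length-map (lookup x) (allFin p)) (length-tabulate {n = p} id)))

  Disjoint : Vec G p → Vec G p → Set
  Disjoint x y = ∀ a b → lookup x a ≢ lookup y b

  HasCycle : List G → ℕ → Set
  HasCycle A j = ∃[ x ] Cycle A x × j ≤ length (reps (pattern′ x))

  hasCycle? : ∀ A j → Dec (HasCycle A j)
  hasCycle? A j with any? (λ x → (Σᵛ x ≟ 0#) ×-dec (j ℕ.≤? length (reps (pattern′ x)))) (vecs A p)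
  ... | yes s = yes (let x , x∈ , sum0 , j≤ = find s in x , (∈-vecs⁻ x x∈ , sum0) , j≤)
  ... | no ¬s = no λ { (x , (x∈ , sum0) , j≤) → ¬s (lose (∈-vecs x x∈) (sum0 , j≤)) }

  -- Deleting the values of one tuple removes at most `p` elements, so a surplus of `p * m` over `B`
  -- suffices for `m` tuples.
  disjoint-cycles : ∀ j B → (∀ A → Unique A → B ≤ length A → HasCycle A j) →
    ∀ m A → Unique A → B ℕ.+ p ℕ.* m ≤ length A →
    ∃[ xs ] length xs ≡ m × (∀ {x} → x ∈ xs → Cycle A x × j ≤ length (reps (pattern′ x))) × AllPairs Disjoint xs
  disjoint-cycles j B K zero    A u big = [] , refl , (λ ()) , []
  disjoint-cycles j B K (suc m) A u big =
    let x , cyc , j≤ = K A u (ℕ.≤-trans (ℕ.m≤m+n B _) big)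
        A′ = filter (¬? ∘ image? x) A
        A′⊆ : ∀ {g} → g ∈ A′ → g ∈ A × ¬ Image x g
        A′⊆ = ∈-filter⁻ (¬? ∘ image? x)
        xs , len , cycs , disj = disjoint-cycles j B K m A′ (Unique.filter⁺ _ u) (ℕ.+-cancelˡ-≤ p _ _ (begin
          p ℕ.+ (B ℕ.+ p ℕ.* m)               ≡⟨ arrange p B m ⟩
          B ℕ.+ p ℕ.* suc m                   ≤⟨ big ⟩
          length A                            ≡⟨ sym (count-split (image? x) A) ⟩
          count (image? x) A ℕ.+ length A′    ≤⟨ ℕ.+-monoˡ-≤ (length A′) (image-bound x (Unique.filter⁺ (image? x) u) (λ g∈ → proj₂ (∈-filter⁻ (image? x) {xs = A} g∈))) ⟩
          p ℕ.+ length A′                     ∎))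
    in x ∷ xs , cong suc len
     , (λ { (here refl) → cyc , j≤ ; (there y∈) → let (y⊆ , sum0) , j≤′ = cycs y∈ in (proj₁ ∘ A′⊆ ∘ y⊆ , sum0) , j≤′ })
     , All.tabulate (λ y∈ a b eq → proj₂ (A′⊆ (proj₁ (proj₁ (cycs y∈)) b)) (a , eq)) ∷ disj
    where
    open ℕ.≤-Reasoning
    arrange : ∀ p B m → p ℕ.+ (B ℕ.+ p ℕ.* m) ≡ B ℕ.+ p ℕ.* suc m
    arrange = solve-∀

  -- `α` and `β` list the entries at two fixed positions. They are abstract because the count is
  -- applied twice for each position, with the roles of the two positions exchanged.
  module PairCount {M : ℕ} (α β : Fin M → G) (α-inj : ∀ {i k} → α i ≡ α k → i ≡ k) (β-inj : ∀ {i k} → β i ≡ β k → i ≡ k)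
    {E : Fin M × Fin M → Set} (E? : ∀ ik → Dec (E ik))
    (covered : ∀ {i i′} → E (i , i′) → ∃[ y ] ∀ {k k′} → E (k , k′) → α k + β k′ ≡ α i + β i′ → Image y (α k) ⊎ Image y (β k′)) where

    pairs : List (Fin M × Fin M)
    pairs = cartesianProduct (allFin M) (allFin M)

    private
      Sum : G → Fin M × Fin M → Set
      Sum c (i , i′) = α i + β i′ ≡ c

      sum? : ∀ c ik → Dec (Sum c ik)
      sum? c (i , i′) = (α i + β i′) ≟ c

      related : List (Fin M × Fin M)
      related = filter E? pairs

      class : G → List (Fin M × Fin M)
      class c = filter (sum? c) related

      class-E : ∀ {c ik} → ik ∈ class c → E ik × Sum c ik
      class-E {c} ik∈ = let ik∈′ , s = ∈-filter⁻ (sum? c) {xs = related} ik∈ in proj₂ (∈-filter⁻ E? {xs = pairs} ik∈′) , s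

      class-unique : ∀ c → Unique (class c)
      class-unique c = Unique.filter⁺ (sum? c) (Unique.filter⁺ E? (Unique.cartesianProduct⁺ (Unique.allFin⁺ M) (Unique.allFin⁺ M)))

      α-determines : ∀ {c i i′ k k′} → Sum c (i , i′) → Sum c (k , k′) → α i ≡ α k → (i , i′) ≡ (k , k′)
      α-determines s s′ eq = cong₂ _,_ (α-inj eq) (β-inj (cancelˡ _ (trans s (trans (sym s′) (cong (_+ _) (sym eq))))))

      β-determines : ∀ {c i i′ k k′} → Sum c (i , i′) → Sum c (k , k′) → β i′ ≡ β k′ → (i , i′) ≡ (k , k′)
      β-determines s s′ eq = cong₂ _,_ (α-inj (cancelˡ _ (trans (comm _ _) (trans s (trans (sym s′) (trans (comm _ _) (cong (_+ _) (sym eq)))))))) (β-inj eq)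

      -- Among pairs with a given sum, cancellation makes a pair known from its `α` alone, and
      -- likewise from its `β`. Each pair has one of these two among the at most `p` values of the
      -- tuple `y` that belongs to the first pair; hence at most `p` pairs of either kind.
      class-bound : ∀ c → length (class c) ≤ p ℕ.+ p
      class-bound c = go (class c) (class-unique c) class-E
        where
        open ℕ.≤-Reasoning
        go : ∀ cl → Unique cl → (∀ {ik} → ik ∈ cl → E ik × Sum c ik) → length cl ≤ p ℕ.+ p
        go [] _ _ = z≤n
        go cl@((i , i′) ∷ _) u cl-E =
          let e , s = cl-E (here refl)
              y , cov = covered e
              inL : ∀ (ik : Fin M × Fin M) → Dec (Image y (α (proj₁ ik)))
              inL ik = image? y (α (proj₁ ik))
              L = filter inL cl
              L⁻ : ∀ {ik} → ik ∈ L → ik ∈ cl × Image y (α (proj₁ ik))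
              L⁻ = ∈-filter⁻ inL
              N = filter (¬? ∘ inL) cl
              N⁻ : ∀ {ik} → ik ∈ N → ik ∈ cl × ¬ Image y (α (proj₁ ik))
              N⁻ = ∈-filter⁻ (¬? ∘ inL)
          in begin
            length cl              ≡⟨ sym (count-split inL cl) ⟩
            length L ℕ.+ length N  ≤⟨ ℕ.+-mono-≤
              (subst (_≤ p) (length-map (α ∘ proj₁) L) (image-bound y
                (unique-map (Unique.filter⁺ inL u) λ a∈ b∈ → α-determines (proj₂ (cl-E (proj₁ (L⁻ a∈)))) (proj₂ (cl-E (proj₁ (L⁻ b∈)))))
                (λ g∈ → let _ , a∈ , eq = ∈-map⁻ (α ∘ proj₁) g∈ in subst (Image y) (sym eq) (proj₂ (L⁻ a∈)))))
              (subst (_≤ p) (length-map (β ∘ proj₂) N) (image-bound y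
                (unique-map (Unique.filter⁺ (¬? ∘ inL) u) λ a∈ b∈ → β-determines (proj₂ (cl-E (proj₁ (N⁻ a∈)))) (proj₂ (cl-E (proj₁ (N⁻ b∈)))))
                (λ g∈ → let _ , a∈ , eq = ∈-map⁻ (β ∘ proj₂) g∈
                            e′ , s′ = cl-E (proj₁ (N⁻ a∈))
                        in subst (Image y) (sym eq) (right (cov e′ (trans s′ (sym s))) (proj₂ (N⁻ a∈)))))) ⟩
            p ℕ.+ p                ∎
          where
          right : ∀ {A B : Set} → A ⊎ B → ¬ A → B
          right (inj₁ a) ¬a = contradiction a ¬a
          right (inj₂ b) _  = b

    pair-count : count E? pairs ≤ Q ℕ.* (p ℕ.+ p)
    pair-count = begin
      length related                                    ≤⟨ length-cover sum? elements related (λ {ik} _ → _ , ∈elements _ , refl) ⟩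
      sum (map (λ c → count (sum? c) related) elements) ≤⟨ sum-map-mono _ _ elements (λ {c} _ → class-bound c) ⟩
      sum (map (λ _ → p ℕ.+ p) elements)                ≡⟨ sum-map-const (p ℕ.+ p) elements ⟩
      Q ℕ.* (p ℕ.+ p)                                   ∎
      where open ℕ.≤-Reasoning

  -- Two directions for each of `p` positions, `Q` possible sums for each of these, and at most
  -- `p + p` pairs for each sum.
  edge-bound : ℕ
  edge-bound = (p ℕ.* 2) ℕ.* (Q ℕ.* (p ℕ.+ p))

  -- The inductive step, argued by contradiction: `few` says that no cycle over `A` has more
  -- distinct entries than the common pattern `π`. The position `a₀` shares its entry with its
  -- representative `u`, so `a₀` can receive a new entry while the old one survives at `u`.
  module Step (A : List G) {M : ℕ} (xs : Fin M → Vec G p) (π : Vec (Fin p) p)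
    (cycles : ∀ i → Cycle A (xs i)) (pat : ∀ i → pattern′ (xs i) ≡ π)
    (disjoint : ∀ {i k} → i ≢ k → Disjoint (xs i) (xs k))
    (few : ∀ {y} → Cycle A y → ∀ {bs} → Unique (map (lookup y) bs) → length bs ≤ length (reps π))
    (a₀ : Fin p) (a₀-moved : lookup π a₀ ≢ a₀)
    where

    private
      r : Fin p → Fin p
      r = lookup π

      ρ : List (Fin p)
      ρ = reps π

      u : Fin p
      u = r a₀

      rep : ∀ {a} → a ∈ ρ → r a ≡ a
      rep a∈ = proj₂ (∈-filter⁻ (λ a → lookup π a Fin.≟ a) {xs = allFin p} a∈)

      r-cong : ∀ i {a b} → lookup (xs i) a ≡ lookup (xs i) b → r a ≡ r b
      r-cong i = pattern-cong {x = xs i} (pat i)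

      lookup-r : ∀ i a → lookup (xs i) (r a) ≡ lookup (xs i) a
      lookup-r i = lookup-pattern {x = xs i} (pat i)

      r-idem : Fin M → ∀ a → r (r a) ≡ r a
      r-idem i = pattern-idem {x = xs i} (pat i)

      entry-injective : ∀ {i k} a → lookup (xs i) a ≡ lookup (xs k) a → i ≡ k
      entry-injective {i} {k} a eq with i Fin.≟ k
      ... | yes i≡k = i≡k
      ... | no i≢k  = contradiction eq (disjoint i≢k a a)

      -- The position `a` in addition to the representatives would be one more distinct entry than
      -- `few` permits.
      no-growth : ∀ {y a} → Cycle A y → r a ≢ a →
        (∀ {b} → b ∈ ρ → lookup y a ≢ lookup y b) → (∀ {b c} → b ∈ ρ → c ∈ ρ → lookup y b ≡ lookup y c → b ≡ c) → ∀ {ℓ} {W : Set ℓ} → W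
      no-growth {y} {a} cyc moved new inj = contradiction (few {y} cyc {a ∷ ρ}
        (All.tabulate (λ g∈ eq → let b , b∈ , eq′ = ∈-map⁻ (lookup y) g∈ in new b∈ (trans eq eq′))
          ∷ unique-map (Unique.filter⁺ (λ a → lookup π a Fin.≟ a) (Unique.allFin⁺ p)) inj)) ℕ.1+n≰n

      -- When `π` is the pattern of some tuple, this amounts to `y` being a cycle with pattern `π`,
      -- put in the form in which it is applied.
      record Good (y : Vec G p) : Set where
        constructor good
        field
          cycle    : Cycle A y
          constant : ∀ a → lookup y (r a) ≡ lookup y a
          distinct : ∀ {b} → b ∈ ρ → ∀ {c} → c ∈ ρ → lookup y b ≡ lookup y c → b ≡ c

      good? : ∀ y → (∀ a → lookup y a ∈ A) → Dec (Good y)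
      good? y y∈ = map′ (λ { (sum0 , con , dis) → good (y∈ , sum0) con λ b∈ c∈ → All.lookup (All.lookup dis b∈) c∈ })
        (λ g → proj₂ (Good.cycle g) , Good.constant g , All.tabulate (λ b∈ → All.tabulate (λ c∈ → Good.distinct g b∈ c∈)))
        ((Σᵛ y ≟ 0#) ×-dec Fin.all? (λ a → lookup y (r a) ≟ lookup y a)
          ×-dec All.all? (λ b → All.all? (λ c → (lookup y b ≟ lookup y c) →-dec (b Fin.≟ c)) ρ) ρ)

      Extends : Fin p → Fin M → Fin M → Set
      Extends b i k = ∃[ y ] Good y × lookup y u ≡ lookup (xs i) u × lookup y b ≡ lookup (xs k) b

      extends? : ∀ b i k → Dec (Extends b i k)
      extends? b i k with any? (λ y → witness? y) (vecs A p)
        where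
        witness? : ∀ y → Dec (Good y × lookup y u ≡ lookup (xs i) u × lookup y b ≡ lookup (xs k) b)
        witness? y with Fin.all? (λ a → any? (λ g → lookup y a ≟ g) A)
        ... | no ∉A  = no λ (g , _) → ∉A (λ a → proj₁ (Good.cycle g) a)
        ... | yes ∈A = good? y ∈A ×-dec (lookup y u ≟ lookup (xs i) u) ×-dec (lookup y b ≟ lookup (xs k) b)
      ... | yes s = yes (let y , _ , w = find s in y , w)
      ... | no ¬s = no λ (y , g , e) → ¬s (lose (∈-vecs y (proj₁ (Good.cycle g))) (g , e))

      -- Otherwise splitting the value at u into g and moving b to h gives a cycle with more distinct entries.
      exchange : ∀ {y b g h} → Good y → b ∈ ρ → b ≢ u → g ∈ A → h ∈ A → g ≢ h →
        g + h ≡ lookup y u + lookup y b → Image y g ⊎ Image y h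
      exchange {y} {b} {g} {h} gd b∈ b≢u g∈ h∈ g≢h eq with image? y g | image? y h
      ... | yes im | _      = inj₁ im
      ... | no _   | yes im = inj₂ im
      ... | no ¬g  | no ¬h  = no-growth {y′} {a₀} (y′∈ , sum0) a₀-moved new inj
        where
        -- Only `a₀` and `b` change. The sum is kept because `y` has the same entry at `a₀` as at
        -- `u`; the representatives stay distinct, with `h` now at `b`, and `g` is the additional
        -- value.
        y′ = (y [ a₀ ]≔ g) [ b ]≔ h
        a₀∉ : ∀ {c} → c ∈ ρ → c ≢ a₀
        a₀∉ c∈ refl = a₀-moved (rep c∈)
        at-a₀ : lookup y′ a₀ ≡ g
        at-a₀ = trans (Vec.lookup∘update′ (a₀∉ b∈ ∘ sym) (y [ a₀ ]≔ g) h) (Vec.lookup∘update a₀ y g)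
        at-b : lookup y′ b ≡ h
        at-b = Vec.lookup∘update b (y [ a₀ ]≔ g) h
        elsewhere : ∀ {c} → c ≢ a₀ → c ≢ b → lookup y′ c ≡ lookup y c
        elsewhere c≢a₀ c≢b = trans (Vec.lookup∘update′ c≢b (y [ a₀ ]≔ g) h) (Vec.lookup∘update′ c≢a₀ y g)
        y′∈ : ∀ c → lookup y′ c ∈ A
        y′∈ c with c Fin.≟ b | c Fin.≟ a₀
        ... | yes refl | _        = subst (_∈ A) (sym at-b) h∈
        ... | no _     | yes refl = subst (_∈ A) (sym at-a₀) g∈
        ... | no c≢b   | no c≢a₀  = subst (_∈ A) (sym (elsewhere c≢a₀ c≢b)) (proj₁ (Good.cycle gd) c)
        sum0 : Σᵛ y′ ≡ 0#
        sum0 = trans (Σᵛ-update₂ y (a₀∉ b∈) (trans eq (cong (_+ lookup y b) (Good.constant gd a₀)))) (proj₂ (Good.cycle gd))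
        new : ∀ {c} → c ∈ ρ → lookup y′ a₀ ≢ lookup y′ c
        new {c} c∈ e with c Fin.≟ b
        ... | yes refl = g≢h (trans (sym at-a₀) (trans e at-b))
        ... | no c≢b   = ¬g (c , trans (sym (elsewhere (a₀∉ c∈) c≢b)) (trans (sym e) at-a₀))
        inj : ∀ {c c′} → c ∈ ρ → c′ ∈ ρ → lookup y′ c ≡ lookup y′ c′ → c ≡ c′
        inj {c} {c′} c∈ c′∈ e with c Fin.≟ b | c′ Fin.≟ b
        ... | yes refl | yes refl = refl
        ... | yes refl | no c′≢b  = contradiction (c′ , trans (sym (elsewhere (a₀∉ c′∈) c′≢b)) (trans (sym e) at-b)) ¬h
        ... | no c≢b   | yes refl = contradiction (c , trans (sym (elsewhere (a₀∉ c∈) c≢b)) (trans e at-b)) ¬h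
        ... | no c≢b   | no c′≢b  = Good.distinct gd c∈ c′∈ (trans (sym (elsewhere (a₀∉ c∈) c≢b)) (trans e (elsewhere (a₀∉ c′∈) c′≢b)))

      distinct-entries : ∀ {b} → b ∈ ρ → b ≢ u → ∀ i k → lookup (xs i) u ≢ lookup (xs k) b
      distinct-entries {b} b∈ b≢u i k eq with i Fin.≟ k
      ... | no i≢k   = disjoint i≢k u b eq
      ... | yes refl = b≢u (trans (sym (rep b∈)) (trans (sym (r-cong i eq)) (r-idem i a₀)))

      covered : ∀ {b} → b ∈ ρ → b ≢ u → ∀ {i i′} → Extends b i i′ →
        ∃[ y ] ∀ {k k′} → lookup (xs k) u + lookup (xs k′) b ≡ lookup (xs i) u + lookup (xs i′) b →
          Image y (lookup (xs k) u) ⊎ Image y (lookup (xs k′) b)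
      covered b∈ b≢u (y , gd , eq , eq′) = y , λ {k} {k′} s → exchange gd b∈ b≢u
        (proj₁ (cycles k) u) (proj₁ (cycles k′) _) (distinct-entries b∈ b≢u k k′) (trans s (cong₂ _+_ (sym eq) (sym eq′)))

      -- Adjacency is symmetric and quantifies over positions, whereas `PairCount` treats one
      -- position and one direction at a time. The tag records both.
      Arc : Fin p × Bool → Fin M × Fin M → Set
      Arc (b , true)  (i , k) = b ∈ ρ × b ≢ u × Extends b i k
      Arc (b , false) (i , k) = b ∈ ρ × b ≢ u × Extends b k i

      arc? : ∀ t ik → Dec (Arc t ik)
      arc? (b , true)  (i , k) = any? (b Fin.≟_) ρ ×-dec ¬? (b Fin.≟ u) ×-dec extends? b i k
      arc? (b , false) (i , k) = any? (b Fin.≟_) ρ ×-dec ¬? (b Fin.≟ u) ×-dec extends? b k i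

      pairs : List (Fin M × Fin M)
      pairs = cartesianProduct (allFin M) (allFin M)

      arc-count : ∀ t → count (arc? t) pairs ≤ Q ℕ.* (p ℕ.+ p)
      arc-count t@(b , true)  = PairCount.pair-count (λ i → lookup (xs i) u) (λ k → lookup (xs k) b) (entry-injective u) (entry-injective b) (arc? t)
        λ (b∈ , b≢u , e) → let y , cov = covered b∈ b≢u e in y , λ _ → cov
      arc-count t@(b , false) = PairCount.pair-count (λ i → lookup (xs i) b) (λ k → lookup (xs k) u) (entry-injective b) (entry-injective u) (arc? t)
        λ (b∈ , b≢u , e) → let y , cov = covered b∈ b≢u e in y , λ _ s → Sum.swap (cov (trans (comm _ _) (trans s (comm _ _))))

      tags : List (Fin p × Bool)
      tags = cartesianProduct (allFin p) (true ∷ false ∷ [])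

      Adjacent : Fin M → Fin M → Set
      Adjacent i k = ∃[ b ] b ∈ ρ × b ≢ u × (Extends b i k ⊎ Extends b k i)

      adjacent? : ∀ i k → Dec (Adjacent i k)
      adjacent? i k = Fin.any? (λ b → any? (b Fin.≟_) ρ ×-dec ¬? (b Fin.≟ u) ×-dec (extends? b i k ⊎-dec extends? b k i))

      edges : sum (map (λ i → count (adjacent? i) (allFin M)) (allFin M)) ≤ edge-bound
      edges = begin
        sum (map (λ i → count (adjacent? i) (allFin M)) (allFin M))  ≡⟨ sym (count-cartesianProduct (λ (i , k) → adjacent? i k) (allFin M) (allFin M)) ⟩
        count (λ (i , k) → adjacent? i k) pairs                      ≤⟨ count-union arc? (λ (i , k) → adjacent? i k) tags pairs tagged ⟩
        sum (map (λ t → count (arc? t) pairs) tags)                  ≤⟨ sum-map-mono _ _ tags (λ {t} _ → arc-count t) ⟩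
        sum (map (λ _ → Q ℕ.* (p ℕ.+ p)) tags)                       ≡⟨ sum-map-const (Q ℕ.* (p ℕ.+ p)) tags ⟩
        length tags ℕ.* (Q ℕ.* (p ℕ.+ p))                            ≡⟨ cong (ℕ._* (Q ℕ.* (p ℕ.+ p))) (trans (length-cartesianProductWith _,_ (allFin p) (true ∷ false ∷ [])) (cong (ℕ._* 2) (length-tabulate {n = p} id))) ⟩
        edge-bound                                                   ∎
        where
        open ℕ.≤-Reasoning
        tagged : ∀ {ik} → ik ∈ pairs → Adjacent (proj₁ ik) (proj₂ ik) → ∃[ t ] t ∈ tags × Arc t ik
        tagged _ (b , b∈ , b≢u , inj₁ e) = (b , true)  , ∈-cartesianProduct⁺ (∈-allFin b) (here refl) , b∈ , b≢u , e
        tagged _ (b , b∈ , b≢u , inj₂ e) = (b , false) , ∈-cartesianProduct⁺ (∈-allFin b) (there (here refl)) , b∈ , b≢u , e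

      module _ (is : List (Fin M)) (is-unique : Unique is) (independent : AllPairs (λ i k → ¬ Adjacent i k) is) where

        private
          at : Fin (length is) → Vec G p
          at l = xs (List.lookup is l)

          at-disjoint : ∀ {l m} → l ≢ m → Disjoint (at l) (at m)
          at-disjoint l≢m = disjoint (lookup-AllPairs (λ ne eq → ne (sym eq)) is-unique l≢m)

          same-index : ∀ {l m a b} → lookup (at l) a ≡ lookup (at m) b → l ≡ m
          same-index {l} {m} {a} {b} eq with l Fin.≟ m
          ... | yes l≡m = l≡m
          ... | no l≢m  = contradiction eq (at-disjoint l≢m a b)

          z : Fin p → Fin (length is) → G
          z a l = lookup (at l) a

        -- A larger family would yield a non-constant choice `ι` with sum zero. If `ι` differs
        -- between a position and its representative, disjointness makes the entry there different
        -- from those at all representatives, against `few`. Otherwise the mixed tuple is `Good`,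
        -- and some representative `b` has a choice other than that of `u`; then the mixed tuple
        -- joins two members of the family by an edge.
        independent-bound : length is ≤ R
        independent-bound with R ℕ.<? length is
        ... | no R≮ = ℕ.≮⇒≥ R≮
        ... | yes R< with colored z (λ l → trans (cong Σᵛ (Vec.tabulate∘lookup (at l))) (proj₂ (cycles (List.lookup is l)))) R<
        ...   | ι , (c₁ , c₂ , nonconst) , sum0 = result
          where
          y = mix z ι
          y-at : ∀ a → lookup y a ≡ lookup (at (lookup ι a)) a
          y-at = Vec.lookup∘tabulate (λ a → z a (lookup ι a))
          y-cycle : Cycle A y
          y-cycle = (λ a → subst (_∈ A) (sym (y-at a)) (proj₁ (cycles _) a)) , sum0
          ι-eq : ∀ {a b} → lookup y a ≡ lookup y b → lookup ι a ≡ lookup ι b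
          ι-eq {a} {b} eq = same-index {a = a} {b = b} (trans (sym (y-at a)) (trans eq (y-at b)))
          r-eq : ∀ {a b} → lookup y a ≡ lookup y b → r a ≡ r b
          r-eq {a} {b} eq = r-cong _ (trans (sym (y-at a)) (trans eq
            (trans (y-at b) (cong (λ l → lookup (at l) b) (sym (ι-eq eq))))))
          y-distinct : ∀ {b c} → b ∈ ρ → c ∈ ρ → lookup y b ≡ lookup y c → b ≡ c
          y-distinct b∈ c∈ eq = trans (sym (rep b∈)) (trans (r-eq eq) (rep c∈))
          result : length is ≤ R
          result with Fin.all? (λ a → lookup ι a Fin.≟ lookup ι (r a))
          ... | no ¬all = let a , ne = Fin.¬∀⟶∃¬ p _ (λ a → lookup ι a Fin.≟ lookup ι (r a)) ¬all in
            no-growth {y} {a} y-cycle (λ ra≡a → ne (cong (lookup ι) (sym ra≡a)))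
              (λ b∈ eq → ne (trans (ι-eq eq) (cong (lookup ι) (trans (sym (rep b∈)) (sym (r-eq eq)))))) y-distinct
          ... | yes all = contradiction (trans (to-u c₁) (sym (to-u c₂))) nonconst
            where
            y-good : Good y
            y-good = good y-cycle (λ a → trans (y-at (r a)) (trans (cong (λ l → lookup (at l) (r a)) (sym (all a)))
              (trans (lookup-r _ a) (sym (y-at a))))) (λ b∈ c∈ → y-distinct b∈ c∈)
            to-u′ : ∀ {b} → b ∈ ρ → lookup ι b ≡ lookup ι u
            to-u′ {b} b∈ with lookup ι u Fin.≟ lookup ι b
            ... | yes eq = sym eq
            ... | no ne  = contradiction
              (b , b∈ , (λ { refl → ne refl }) , inj₁ (y , y-good , y-at u , y-at b))
              (lookup-AllPairs (λ ¬adj (b , b∈ , b≢ , e) → ¬adj (b , b∈ , b≢ , Sum.swap e)) independent ne)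
            to-u : ∀ a → lookup ι a ≡ lookup ι u
            to-u a = trans (all a) (to-u′ (pattern∈reps {x = at (lookup ι a)} (pat _) a))

    family-bound : ∀ d → edge-bound ≤ suc d ℕ.* suc d ℕ.* R → M ≤ 2 ℕ.* (suc d ℕ.* R)
    family-bound d E≤ = let is , is-unique , ind , bound = independent-set adjacent? edge-bound d (allFin M) (Unique.allFin⁺ M) edges in
      ℕ.*-cancelʳ-≤ M (2 ℕ.* (suc d ℕ.* R)) (suc d) (begin
        M ℕ.* suc d                                                      ≡⟨ cong (ℕ._* suc d) (sym (length-tabulate {n = M} id)) ⟩
        length (allFin M) ℕ.* suc d                                      ≤⟨ bound ⟩
        edge-bound ℕ.+ suc d ℕ.* suc d ℕ.* length is                     ≤⟨ ℕ.+-mono-≤ E≤ (ℕ.*-monoʳ-≤ (suc d ℕ.* suc d) (independent-bound is is-unique ind)) ⟩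
        suc d ℕ.* suc d ℕ.* R ℕ.+ suc d ℕ.* suc d ℕ.* R                  ≡⟨ arrange (suc d) R ⟩
        2 ℕ.* (suc d ℕ.* R) ℕ.* suc d                                    ∎)
      where
      open ℕ.≤-Reasoning
      arrange : ∀ e R → e ℕ.* e ℕ.* R ℕ.+ e ℕ.* e ℕ.* R ≡ 2 ℕ.* (e ℕ.* R) ℕ.* e
      arrange = solve-∀

  module _ (d : ℕ) (E≤ : edge-bound ≤ suc d ℕ.* suc d ℕ.* R) where

    private
      patterns : List (Vec (Fin p) p)
      patterns = vecs (allFin p) p

      X increment : ℕ
      X = 2 ℕ.* (suc d ℕ.* R)
      increment = p ℕ.* suc (length patterns ℕ.* X)

      bound : ℕ → ℕ
      bound zero    = 1
      bound (suc j) = bound j ℕ.+ increment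

      pattern? : ∀ π (x : Vec G p) → Dec (pattern′ x ≡ π)
      pattern? π x = Vec.≡-dec Fin._≟_ (pattern′ x) π

      many-distinct : ∀ j → j ≤ p → ∀ A → Unique A → bound j ≤ length A → HasCycle A j
      many-distinct zero    _   (g ∷ A) _ _ = replicate p g , ((λ a → here (Vec.lookup-replicate a g)) , exponent g) , z≤n
      many-distinct (suc j) j<p A u big with hasCycle? A (suc j)
      ... | yes h = h
      ... | no ¬h with disjoint-cycles j (bound j) (many-distinct j (ℕ.<⇒≤ j<p)) (suc (length patterns ℕ.* X)) A u big
      ...   | xs , len , cycles , disjoint
        -- There is one tuple more than `X` for each possible pattern, so more than `X` tuples have
        -- the same pattern.
        with pigeonhole pattern? (λ _ → X) patterns xs (λ {x} _ → pattern′ x , ∈-vecs (pattern′ x) (λ a → ∈-allFin _) , refl)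
               (subst (sum (map (λ _ → X) patterns) <_) (sym len) (s≤s (ℕ.≤-reflexive (sum-map-const X patterns))))
      ...     | π , _ , X< = contradiction X< (ℕ.≤⇒≯ family≤)
        where
        family = filter (pattern? π) xs
        family⁻ : ∀ {x} → x ∈ family → x ∈ xs × pattern′ x ≡ π
        family⁻ = ∈-filter⁻ (pattern? π)
        f : Fin (length family) → Vec G p
        f = List.lookup family
        f∈ : ∀ i → f i ∈ xs × pattern′ (f i) ≡ π
        f∈ i = family⁻ (∈-lookup i)
        i₀ : Fin (length family)
        i₀ = fromℕ< (ℕ.≤-<-trans z≤n X<)
        reps-large : j ≤ length (reps π)
        reps-large = subst (λ π → j ≤ length (reps π)) (proj₂ (f∈ i₀)) (proj₂ (cycles (proj₁ (f∈ i₀))))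
        few : ∀ {y} → Cycle A y → ∀ {bs} → Unique (map (lookup y) bs) → length bs ≤ length (reps π)
        few {y} cyc {bs} uniq = ℕ.≤-trans (reps-maximal {x = y} refl bs uniq)
          (ℕ.≤-trans (ℕ.≤-pred (ℕ.≰⇒> λ j< → ¬h (y , cyc , j<))) reps-large)
        family≤ : length family ≤ X
        family≤ with Fin.any? (λ a → ¬? (lookup π a Fin.≟ a))
        ... | yes (a₀ , moved) = Step.family-bound A f π (λ i → proj₁ (cycles (proj₁ (f∈ i)))) (λ i → proj₂ (f∈ i))
          (lookup-AllPairs (λ dis a b eq → dis b a (sym eq)) (AllPairs.filter⁺ (pattern? π) disjoint)) (λ {y} → few {y}) a₀ moved d E≤
        -- If every position is its own representative, then all `p` entries are distinct, which
        -- exceeds `j`, against `¬h`.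
        ... | no fixed = contradiction (f i₀ , proj₁ (cycles (proj₁ (f∈ i₀))) , subst (λ π → suc j ≤ length (reps π)) (sym (proj₂ (f∈ i₀)))
            (subst (suc j ≤_) (sym (trans (cong length all-reps) (length-tabulate {n = p} id))) j<p)) ¬h
          where
          all-reps : reps π ≡ allFin p
          all-reps = filter-all (λ a → lookup π a Fin.≟ a) (All.tabulate λ {a} _ → decidable-stable (lookup π a Fin.≟ a) (λ ne → fixed (a , ne)))

      bound≡ : ∀ j → bound j ≡ 1 ℕ.+ j ℕ.* increment
      bound≡ zero    = refl
      bound≡ (suc j) = trans (cong (ℕ._+ increment) (bound≡ j)) (cong suc (ℕ.+-comm (j ℕ.* increment) increment))

    distinct-zero-sum : ∀ A → Unique A → 1 ℕ.+ p ℕ.* (p ℕ.* suc (p ^ p ℕ.* (2 ℕ.* (suc d ℕ.* R)))) ≤ length A →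
      ∃[ x ] Cycle A x × Unique (map (lookup x) (allFin p))
    distinct-zero-sum A u big =
      let x , cyc , p≤ = many-distinct p ℕ.≤-refl A u (subst (_≤ length A) (sym (trans (bound≡ p)
            (cong (λ P → 1 ℕ.+ p ℕ.* (p ℕ.* suc (P ℕ.* X))) (trans (length-vecs (allFin p) p) (cong (_^ p) (length-tabulate {n = p} id)))))) big)
          all-reps = filter-complete (λ a → lookup (pattern′ x) a Fin.≟ a) (ℕ.≤-antisym
            (length-filter _ (allFin p)) (subst (_≤ length (reps (pattern′ x))) (sym (length-tabulate {n = p} id)) p≤))
      in x , cyc , subst (λ bs → Unique (map (lookup x) bs)) all-reps (reps-unique {x = x} refl)

open import Data.List.Relation.Binary.Permutation.Propositional using (_↭_; prep; swap; ↭-sym; ↭⇒↭ₛ) renaming (refl to ↭-refl; trans to ↭-trans)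
open import Data.List.Relation.Binary.Sublist.Propositional as Sublist using (_⊆_; []; _∷_; _∷ʳ_; ⊆-trans; minimum)

-- Here `suc d` is √(E/R) rounded up. For positive `d`, minimality gives d^2 R < E, and d + 1 ≤ 2d
-- costs the factor 4; for `d` zero the hypothesis `R ≤ E` takes over.
balance : ∀ R E → 1 ≤ R → R ≤ E → ∃[ d ] E ≤ suc d ℕ.* suc d ℕ.* R × (suc d ℕ.* R) ℕ.* (suc d ℕ.* R) ≤ 4 ℕ.* (E ℕ.* R)
balance R E 1≤R R≤E with least (λ d → E ℕ.≤? suc d ℕ.* suc d ℕ.* R) E (begin
    E                          ≤⟨ ℕ.n≤1+n E ⟩
    suc E                      ≤⟨ ℕ.m≤m*n (suc E) (suc E) ⟩
    suc E ℕ.* suc E            ≤⟨ ℕ.m≤m*n (suc E ℕ.* suc E) R {{ℕ.>-nonZero 1≤R}} ⟩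
    suc E ℕ.* suc E ℕ.* R      ∎)
  where open ℕ.≤-Reasoning
... | zero , _ , E≤ , _ = 0 , E≤ , (begin
    (1 ℕ.* R) ℕ.* (1 ℕ.* R)    ≡⟨ cong₂ ℕ._*_ (ℕ.*-identityˡ R) (ℕ.*-identityˡ R) ⟩
    R ℕ.* R                    ≤⟨ ℕ.*-monoˡ-≤ R R≤E ⟩
    E ℕ.* R                    ≤⟨ ℕ.m≤n*m (E ℕ.* R) 4 ⟩
    4 ℕ.* (E ℕ.* R)            ∎)
  where open ℕ.≤-Reasoning
... | suc d , _ , E≤ , min = suc d , E≤ , (begin
    (suc (suc d) ℕ.* R) ℕ.* (suc (suc d) ℕ.* R)     ≤⟨ ℕ.*-mono-≤ double double ⟩
    (2 ℕ.* (suc d ℕ.* R)) ℕ.* (2 ℕ.* (suc d ℕ.* R)) ≡⟨ arrange (suc d) R ⟩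
    4 ℕ.* (suc d ℕ.* suc d ℕ.* R ℕ.* R)             ≤⟨ ℕ.*-monoʳ-≤ 4 (ℕ.*-monoˡ-≤ R (ℕ.<⇒≤ (ℕ.≰⇒> λ E≤′ → ℕ.1+n≰n (min d E≤′)))) ⟩
    4 ℕ.* (E ℕ.* R)                                 ∎)
  where
  open ℕ.≤-Reasoning
  double : suc (suc d) ℕ.* R ≤ 2 ℕ.* (suc d ℕ.* R)
  double = ℕ.≤-trans (ℕ.*-monoˡ-≤ R (ℕ.≤-trans (ℕ.≤-reflexive (ℕ.+-comm 1 (suc d))) (ℕ.+-monoʳ-≤ (suc d) (s≤s z≤n)))) (ℕ.≤-reflexive (ℕ.*-assoc 2 (suc d) R))
  arrange : ∀ e R → (2 ℕ.* (e ℕ.* R)) ℕ.* (2 ℕ.* (e ℕ.* R)) ≡ 4 ℕ.* (e ℕ.* e ℕ.* R ℕ.* R)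
  arrange = solve-∀

-- From zero-sum tuples of values to subsequences.

module _ {G : Set} (_≟_ : DecidableEquality G) where

  without : G → List G → List G
  without v = filter (¬? ∘ (_≟ v))

  extract-↭ : ∀ {v vs} → Unique vs → v ∈ vs → vs ↭ v ∷ without v vs
  extract-↭ {v} {v ∷ vs} (v∉ ∷ u) (here refl) = prep v (subst (vs ↭_)
    (sym (trans (filter-reject (¬? ∘ (_≟ v)) (λ ¬e → ¬e refl)) (filter-all (¬? ∘ (_≟ v)) (All.map (λ ne e → ne (sym e)) v∉)))) ↭-refl)
  extract-↭ {v} {w ∷ vs} (w∉ ∷ u) (there v∈) = subst (λ zs → w ∷ vs ↭ v ∷ zs)
    (sym (filter-accept (¬? ∘ (_≟ v)) (All.lookup w∉ v∈)))
    (↭-trans (prep w (extract-↭ u v∈)) (swap w v ↭-refl))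

  -- A subsequence must follow the order of `S`, while the values of a zero-sum tuple come in any
  -- order; hence a permutation.
  realize : ∀ {a} {A : Set a} (y : A → G) S vs → Unique vs → (∀ {v} → v ∈ vs → v ∈ map y S) →
    ∃[ S′ ] S′ ⊆ S × map y S′ ↭ vs
  realize y [] []       u sub = [] , [] , ↭-refl
  realize y [] (v ∷ vs) u sub = contradiction (sub (here refl)) λ ()
  realize y (s ∷ S) vs u sub with any? (y s ≟_) vs
  ... | no ys∉ =
    let S′ , S′⊆ , perm = realize y S vs u (λ v∈ → tail (sub v∈) (λ { refl → ys∉ v∈ }))
    in S′ , s ∷ʳ S′⊆ , perm
    where
    tail : ∀ {v w ws} → v ∈ w ∷ ws → v ≢ w → v ∈ ws
    tail (here eq)  ne = contradiction eq ne
    tail (there v∈) _  = v∈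
  ... | yes ys∈ =
    let S′ , S′⊆ , perm = realize y S (without (y s) vs) (Unique.filter⁺ _ u) (λ v∈ →
          let v∈vs , ne = ∈-filter⁻ (¬? ∘ (_≟ y s)) {xs = vs} v∈ in tail (sub v∈vs) ne)
    in s ∷ S′ , refl ∷ S′⊆ , ↭-trans (prep (y s) perm) (↭-sym (extract-↭ u ys∈))
    where
    tail : ∀ {v w ws} → v ∈ w ∷ ws → v ≢ w → v ∈ ws
    tail (here eq)  ne = contradiction eq ne
    tail (there v∈) _  = v∈

  constant-subsequence : ∀ {a} {A : Set a} (y : A → G) S g p → p ≤ count (λ s → y s ≟ g) S →
    ∃[ S′ ] S′ ⊆ S × length S′ ≡ p × (∀ {s} → s ∈ S′ → y s ≡ g)
  constant-subsequence y S g p many =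
    take p T , ⊆-trans (take-⊆ p T) (filter-⊆ (λ s → y s ≟ g) S) , trans (length-take p T) (ℕ.m≤n⇒m⊓n≡m many)
    , λ s∈ → proj₂ (∈-filter⁻ (λ s → y s ≟ g) {xs = S} (∈-take p s∈))
    where
    T = filter (λ s → y s ≟ g) S
    ∈-take : ∀ {a} {A : Set a} n {xs : List A} {x} → x ∈ take n xs → x ∈ xs
    ∈-take (suc n) {_ ∷ _} (here eq)  = here eq
    ∈-take (suc n) {_ ∷ _} (there x∈) = there (∈-take n x∈)

module Sequences {G : Set} (_≟_ : DecidableEquality G) {_+_ : Op₂ G} {0# : G}
  (isCommutativeMonoid : IsCommutativeMonoid _≡_ _+_ 0#)
  (p : ℕ) (exponent : ∀ g → Vec.foldr (λ _ → G) _+_ 0# (replicate p g) ≡ 0#) where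

  DistinctZeroSum : ℕ → Set
  DistinctZeroSum B = ∀ A → Unique A → B ≤ length A →
    ∃[ x ] ((∀ a → lookup x a ∈ A) × Vec.foldr (λ _ → G) _+_ 0# x ≡ 0#) × Unique (map (lookup x) (allFin p))

  private
    Σˡ : List G → G
    Σˡ = foldr _+_ 0#

    Σˡ-tabulate : ∀ {n} (x : Vec G n) → Σˡ (List.tabulate (lookup x)) ≡ Vec.foldr (λ _ → G) _+_ 0# x
    Σˡ-tabulate []      = refl
    Σˡ-tabulate (g ∷ x) = cong (g +_) (Σˡ-tabulate x)

    Σˡ-↭ : ∀ {xs ys} → xs ↭ ys → Σˡ xs ≡ Σˡ ys
    Σˡ-↭ perm = ↭ₛ.foldr-commMonoid (setoid G) isCommutativeMonoid (↭⇒↭ₛ perm)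

  Σˡ-constant : ∀ {a} {A : Set a} (y : A → G) {g} xs → (∀ {x} → x ∈ xs → y x ≡ g) →
    Σˡ (map y xs) ≡ Vec.foldr (λ _ → G) _+_ 0# (replicate (length xs) g)
  Σˡ-constant y []       _  = refl
  Σˡ-constant y (x ∷ xs) eq = cong₂ _+_ (eq (here refl)) (Σˡ-constant y xs (eq ∘ there))

  -- If the distinct values are too few for the length, one of them occurs `p` times and its p-fold
  -- sum vanishes. Otherwise there are at least `B` distinct values.
  zero-sum-subsequence : 2 ≤ p → ∀ {B} → DistinctZeroSum B → ∀ {a} {A : Set a} (y : A → G) (S : List A) → (p ℕ.∸ 1) ℕ.* B ≤ length S →
    ∃[ S′ ] S′ ⊆ S × length S′ ≡ p × Σˡ (map y S′) ≡ 0#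
  zero-sum-subsequence 2≤p {B} distinct y S big = case ((p ℕ.∸ 1) ℕ.* length D ℕ.<? length S)
    where
    D = deduplicate _≟_ (map y S)
    case : Dec ((p ℕ.∸ 1) ℕ.* length D < length S) → ∃[ S′ ] S′ ⊆ S × length S′ ≡ p × Σˡ (map y S′) ≡ 0#
    case (yes few) =
      let g , _ , many = pigeonhole (λ g s → y s ≟ g) (λ _ → p ℕ.∸ 1) D S (λ {s} s∈ → y s , ∈-deduplicate⁺ _≟_ (∈-map⁺ y s∈) , refl)
            (subst (_< length S) (trans (ℕ.*-comm (p ℕ.∸ 1) (length D)) (sym (sum-map-const (p ℕ.∸ 1) D))) few)
          S′ , S′⊆ , len , const = constant-subsequence _≟_ y S g p (ℕ.≤-trans (ℕ.≤-reflexive (sym (ℕ.m+[n∸m]≡n (ℕ.<⇒≤ 2≤p)))) many)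
      in S′ , S′⊆ , len , trans (Σˡ-constant y S′ const) (trans (cong (λ n → Vec.foldr (λ _ → G) _+_ 0# (replicate n g)) len) (exponent g))
    case (no ¬few) =
      let x , (x∈ , sum0) , uniq = distinct D (UniqueDec.deduplicate-! _≟_ (map y S))
            (ℕ.*-cancelˡ-≤ (p ℕ.∸ 1) {{ℕ.>-nonZero (ℕ.m<n⇒0<n∸m 2≤p)}} (ℕ.≤-trans big (ℕ.≮⇒≥ ¬few)))
          S′ , S′⊆ , perm = realize _≟_ y S (map (lookup x) (allFin p)) uniq
            (λ v∈ → let a , _ , eq = ∈-map⁻ (lookup x) v∈ in subst (_∈ map y S) (sym eq) (∈-deduplicate⁻ _≟_ (map y S) (x∈ a)))
      in S′ , S′⊆ , trans (sym (length-map y S′)) (trans (↭-length perm) (trans (length-map (lookup x) (allFin p)) (length-tabulate {n = p} id)))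
       , trans (Σˡ-↭ perm) (trans (cong Σˡ (map-tabulate id (lookup x))) (trans (Σˡ-tabulate x) sum0))

lookup-unique : ∀ {a} {A : Set a} {xs : List A} → Unique xs → ∀ {i j} → List.lookup xs i ≡ List.lookup xs j → i ≡ j
lookup-unique {xs = xs} u {i} {j} eq with i Fin.≟ j
... | yes i≡j = i≡j
... | no i≢j  = contradiction eq (lookup-AllPairs (λ ne e → ne (sym e)) u i≢j)

-- Thresholds for distinct zero-sum tuples of vectors.

module Vectors (F : DecField) {q k d : ℕ} (enum : DecField.Carrier F ↔ Fin q)
  (pp : Prime (suc d)) (1≤k : 1 ≤ k) (q≡ : q ≡ suc d ^ k) (n : ℕ) where
  open DecField F
  open FieldFacts F using (_·_; char-annihilates)
  open VectorSpace F
  open Colored F enum pp 1≤k q≡ using (p; char; colored)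
  open Inverse enum using (to; from; strictlyInverseʳ)
  open import Algebra.Properties.Ring ring using (+-cancelˡ)

  V : Set
  V = Vec Carrier n

  _≟ⱽ_ : (u v : V) → Dec (u ≡ v)
  _≟ⱽ_ = Vec.≡-dec _≟_

  _⊹_ : V → V → V
  _⊹_ = zipWith _+_

  ⊹-isCommutativeMonoid : IsCommutativeMonoid _≡_ _⊹_ 0ᵛ
  ⊹-isCommutativeMonoid = record
    { isMonoid = record
      { isSemigroup = record
        { isMagma = record { isEquivalence = isEquivalence ; ∙-cong = cong₂ _⊹_ }
        ; assoc = Vec.zipWith-assoc +-assoc }
      ; identity = Vec.zipWith-identityˡ +-identityˡ , Vec.zipWith-identityʳ +-identityʳ }
    ; comm = Vec.zipWith-comm +-comm }

  ⊹-comm : ∀ u v → u ⊹ v ≡ v ⊹ u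
  ⊹-comm = IsCommutativeMonoid.comm ⊹-isCommutativeMonoid

  ⊹-cancelˡ : ∀ u {v w} → u ⊹ v ≡ u ⊹ w → v ≡ w
  ⊹-cancelˡ u {v} {w} eq = lookup-injective v w λ c → +-cancelˡ (lookup u c) _ _
    (trans (sym (Vec.lookup-zipWith _+_ c u v)) (trans (cong (λ x → lookup x c) eq) (Vec.lookup-zipWith _+_ c u w)))

  lookup-sumᵛ-replicate : ∀ t (g : V) c → lookup (sumᵛ (replicate t g)) c ≡ t · lookup g c
  lookup-sumᵛ-replicate zero    g c = Vec.lookup-replicate c 0#
  lookup-sumᵛ-replicate (suc t) g c = trans (Vec.lookup-zipWith _+_ c g _) (cong (lookup g c +_) (lookup-sumᵛ-replicate t g c))

  exponent : ∀ (g : V) → sumᵛ (replicate p g) ≡ 0ᵛ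
  exponent g = lookup-injective _ _ λ c → trans (lookup-sumᵛ-replicate p g c)
    (trans (char-annihilates p (lookup g c) char) (sym (Vec.lookup-replicate c 0#)))

  scalars : List Carrier
  scalars = map from (allFin q)

  ∈scalars : ∀ x → x ∈ scalars
  ∈scalars x = subst (_∈ scalars) (strictlyInverseʳ x) (∈-map⁺ from (∈-allFin (to x)))

  elements : List V
  elements = vecs scalars n

  ∈elements : ∀ v → v ∈ elements
  ∈elements v = ∈-vecs v (∈scalars ∘ lookup v)

  length-elements : length elements ≡ q ^ n
  length-elements = trans (length-vecs scalars n) (cong (_^ n) (trans (length-map from (allFin q)) (length-tabulate {n = q} id)))

  open Sequences _≟ⱽ_ ⊹-isCommutativeMonoid p exponent public

  -- The hypothesis gives 4^(nk) ≤ q^n and with it `R ≤ E`, as `balance` requires. All lower-order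
  -- terms of `B` are absorbed into a multiple of `Y`, which is at least 1. The bound is on the
  -- square of `B` because its main term contains √q.
  distinct-general : 4 ≤ p → ∃[ B ] DistinctZeroSum B ×
    B ℕ.* B ≤ (4 ℕ.* p ℕ.* p ℕ.* suc (p ℕ.* (p ℕ.* suc (p ^ p ℕ.* 2)))) ^ 2 ℕ.* (4 ^ k ℕ.* q) ^ n
  distinct-general 4≤p =
    let d′ , E≤ , YY≤ = balance R E 1≤R R≤E
        Y = suc d′ ℕ.* R
        B = 1 ℕ.+ p ℕ.* (p ℕ.* suc (p ^ p ℕ.* (2 ℕ.* Y)))
    in B , (λ A → ZeroSum.distinct-zero-sum _≟ⱽ_ ⊹-isCommutativeMonoid ⊹-cancelˡ elements ∈elements p R exponent
                    (λ z diag R< → colored z diag (ℕ.≤-<-trans slices≤ R<)) d′ E≤ A)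
       , (begin
      B ℕ.* B                                   ≤⟨ ℕ.*-mono-≤ (B≤ Y (ℕ.≤-trans 1≤R (ℕ.m≤n*m R (suc d′)))) (B≤ Y (ℕ.≤-trans 1≤R (ℕ.m≤n*m R (suc d′)))) ⟩
      (C ℕ.* Y) ℕ.* (C ℕ.* Y)                   ≡⟨ square C Y ⟩
      C ℕ.* C ℕ.* (Y ℕ.* Y)                     ≤⟨ ℕ.*-monoʳ-≤ (C ℕ.* C) YY≤ ⟩
      -- The constant found here contains p^3; one more factor `p` makes it a square.
      C ℕ.* C ℕ.* (4 ℕ.* (E ℕ.* R))             ≡⟨ arrange C p Q (4 ^ (n ℕ.* k)) ⟩
      16 ℕ.* p ℕ.* p ℕ.* p ℕ.* C ℕ.* C ℕ.* (4 ^ (n ℕ.* k) ℕ.* Q)  ≤⟨ ℕ.m≤n*m _ p ⟩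
      p ℕ.* (16 ℕ.* p ℕ.* p ℕ.* p ℕ.* C ℕ.* C ℕ.* (4 ^ (n ℕ.* k) ℕ.* Q))  ≡⟨ arrange′ C p (4 ^ (n ℕ.* k) ℕ.* Q) ⟩
      (4 ℕ.* p ℕ.* p ℕ.* C) ^ 2 ℕ.* (4 ^ (n ℕ.* k) ℕ.* Q)   ≡⟨ cong ((4 ℕ.* p ℕ.* p ℕ.* C) ^ 2 ℕ.*_) (trans (cong₂ ℕ._*_ (4^ k n) length-elements) (sym (^-distribʳ-* n (4 ^ k) q))) ⟩
      (4 ℕ.* p ℕ.* p ℕ.* C) ^ 2 ℕ.* (4 ^ k ℕ.* q) ^ n       ∎)
    where
    open ℕ.≤-Reasoning
    Q = length elements
    R = p ℕ.* 4 ^ (n ℕ.* k)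
    E = (p ℕ.* 2) ℕ.* (Q ℕ.* (p ℕ.+ p))
    C = suc (p ℕ.* (p ℕ.* suc (p ^ p ℕ.* 2)))
    slices≤ : p ℕ.* length (low p d (n ℕ.* k)) ≤ R
    slices≤ = ℕ.*-monoʳ-≤ p (low-bound-4 d (n ℕ.* k))
    4^ : ∀ k n → 4 ^ (n ℕ.* k) ≡ (4 ^ k) ^ n
    4^ k n = trans (cong (4 ^_) (ℕ.*-comm n k)) (sym (ℕ.^-*-assoc 4 k n))
    1≤R : 1 ≤ R
    1≤R = ℕ.*-mono-≤ {1} {p} {1} (s≤s z≤n) (ℕ.m^n>0 4 (n ℕ.* k))
    R≤E : R ≤ E
    R≤E = ℕ.≤-trans (ℕ.*-mono-≤ (ℕ.m≤m*n p 2) 4^≤Q) (ℕ.*-monoʳ-≤ (p ℕ.* 2) (ℕ.m≤m*n Q (p ℕ.+ p)))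
      where
      4^≤Q : 4 ^ (n ℕ.* k) ≤ Q
      4^≤Q = begin
        4 ^ (n ℕ.* k)    ≡⟨ 4^ k n ⟩
        (4 ^ k) ^ n      ≤⟨ ℕ.^-monoˡ-≤ n (ℕ.^-monoˡ-≤ k 4≤p) ⟩
        (p ^ k) ^ n      ≡⟨ cong (_^ n) (sym q≡) ⟩
        q ^ n            ≡⟨ sym length-elements ⟩
        Q                ∎
    B≤ : ∀ Y → 1 ≤ Y → 1 ℕ.+ p ℕ.* (p ℕ.* suc (p ^ p ℕ.* (2 ℕ.* Y))) ≤ C ℕ.* Y
    B≤ Y 1≤Y = begin
      1 ℕ.+ p ℕ.* (p ℕ.* suc (p ^ p ℕ.* (2 ℕ.* Y)))     ≤⟨ ℕ.+-mono-≤ 1≤Y (ℕ.*-monoʳ-≤ p (ℕ.*-monoʳ-≤ p (ℕ.+-monoˡ-≤ (p ^ p ℕ.* (2 ℕ.* Y)) 1≤Y))) ⟩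
      Y ℕ.+ p ℕ.* (p ℕ.* (Y ℕ.+ p ^ p ℕ.* (2 ℕ.* Y)))   ≡⟨ collect p (p ^ p) Y ⟩
      C ℕ.* Y                                           ∎
      where
      collect : ∀ p P Y → Y ℕ.+ p ℕ.* (p ℕ.* (Y ℕ.+ P ℕ.* (2 ℕ.* Y))) ≡ suc (p ℕ.* (p ℕ.* suc (P ℕ.* 2))) ℕ.* Y
      collect = solve-∀
    square : ∀ C Y → (C ℕ.* Y) ℕ.* (C ℕ.* Y) ≡ C ℕ.* C ℕ.* (Y ℕ.* Y)
    square = solve-∀
    arrange : ∀ C p Q f → C ℕ.* C ℕ.* (4 ℕ.* ((p ℕ.* 2) ℕ.* (Q ℕ.* (p ℕ.+ p)) ℕ.* (p ℕ.* f))) ≡ 16 ℕ.* p ℕ.* p ℕ.* p ℕ.* C ℕ.* C ℕ.* (f ℕ.* Q)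
    arrange = solve-∀
    arrange′ : ∀ C p x → p ℕ.* (16 ℕ.* p ℕ.* p ℕ.* p ℕ.* C ℕ.* C ℕ.* x) ≡ (4 ℕ.* p ℕ.* p ℕ.* C) ℕ.* ((4 ℕ.* p ℕ.* p ℕ.* C) ℕ.* 1) ℕ.* x
    arrange′ = solve-∀

module _ (F : DecField) {q k : ℕ} (enum : DecField.Carrier F ↔ Fin q)
  (pp : Prime 3) (1≤k : 1 ≤ k) (q≡ : q ≡ 3 ^ k) (n : ℕ) where
  open Vectors F enum pp 1≤k q≡ n
  open VectorSpace F
  open Colored F enum pp 1≤k q≡ using (colored)

  -- In characteristic 3, a zero-sum triple with two equal entries is constant.
  distinct-ternary : DistinctZeroSum (suc (3 ℕ.* length (low 3 2 (n ℕ.* k))))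
  -- All three colour classes are the list `A` itself, so the diagonal consists of the triples of
  -- equal vectors.
  distinct-ternary A u big with colored {n = n} (λ _ → List.lookup A) (λ i → exponent (List.lookup A i)) big
  ... | i ∷ j ∷ k ∷ [] , (a , b , ne) , sum0 =
    (g i ∷ g j ∷ g k ∷ []) , ((λ { 0F → ∈-lookup i ; 1F → ∈-lookup j ; 2F → ∈-lookup k }) , sum0)
    , (i≢j ∷ i≢k ∷ []) ∷ (j≢k ∷ []) ∷ [] ∷ []
    where
    open ≡-Reasoning
    g = List.lookup A
    third : ∀ {u v} → u ⊹ (u ⊹ (v ⊹ 0ᵛ)) ≡ 0ᵛ → v ≡ u
    third {u} {v} e = ⊹-cancelˡ 0ᵛ (trans (⊹-comm _ _) (trans (⊹-cancelˡ u (⊹-cancelˡ u (trans e (sym (exponent u))))) (⊹-comm _ _)))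
    constant : i ≡ j → j ≡ k → ∀ a b → lookup (i ∷ j ∷ k ∷ []) a ≡ lookup (i ∷ j ∷ k ∷ []) b
    constant refl refl a b = trans (all a) (sym (all b))
      where
      all : ∀ a → lookup (i ∷ i ∷ i ∷ []) a ≡ i
      all 0F = refl
      all 1F = refl
      all 2F = refl
    swap₁ : ∀ u v w → u ⊹ (v ⊹ w) ≡ v ⊹ (u ⊹ w)
    swap₁ u v w = trans (sym (assoc u v w)) (trans (cong (_⊹ w) (⊹-comm u v)) (assoc v u w))
      where open IsCommutativeMonoid ⊹-isCommutativeMonoid using (assoc)
    i≢j : g i ≢ g j
    i≢j e = ne (constant i≡j (trans (sym i≡j) (sym k≡i)) a b)
      where
      i≡j = lookup-unique u e
      k≡i = lookup-unique u (third (trans (cong (λ v → g i ⊹ (v ⊹ (g k ⊹ 0ᵛ))) e) sum0))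
    i≢k : g i ≢ g k
    i≢k e = ne (constant (sym j≡i) (trans j≡i (lookup-unique u e)) a b)
      where
      j≡i = lookup-unique u (third {g i} {g j} (begin
        g i ⊹ (g i ⊹ (g j ⊹ 0ᵛ))   ≡⟨ cong (g i ⊹_) (swap₁ (g i) (g j) 0ᵛ) ⟩
        g i ⊹ (g j ⊹ (g i ⊹ 0ᵛ))   ≡⟨ cong (λ v → g i ⊹ (g j ⊹ (v ⊹ 0ᵛ))) e ⟩
        g i ⊹ (g j ⊹ (g k ⊹ 0ᵛ))   ≡⟨ sum0 ⟩
        0ᵛ                         ∎))
    j≢k : g j ≢ g k
    j≢k e = ne (constant i≡j (lookup-unique u e) a b)
      where
      i≡j = lookup-unique u (third {g j} {g i} (begin
        g j ⊹ (g j ⊹ (g i ⊹ 0ᵛ))   ≡⟨ cong (g j ⊹_) (swap₁ (g j) (g i) 0ᵛ) ⟩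
        g j ⊹ (g i ⊹ (g j ⊹ 0ᵛ))   ≡⟨ swap₁ (g j) (g i) _ ⟩
        g i ⊹ (g j ⊹ (g j ⊹ 0ᵛ))   ≡⟨ cong (λ v → g i ⊹ (g j ⊹ (v ⊹ 0ᵛ))) e ⟩
        g i ⊹ (g j ⊹ (g k ⊹ 0ᵛ))   ≡⟨ sum0 ⟩
        0ᵛ                         ∎))

-- Elementary symmetric polynomials, reciprocals and supports.

module _ {c ℓ} (R : CommutativeRing c ℓ) where
  private module R = CommutativeRing R
  open R hiding (refl; sym; trans)

  private
    Σₗ Πₗ : List Carrier → Carrier
    Σₗ = foldr _+_ 0#
    Πₗ = foldr _*_ 1#

    Σₗ-++ : ∀ xs ys → Σₗ (xs ++ ys) ≈ Σₗ xs + Σₗ ys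
    Σₗ-++ []       ys = R.sym (+-identityˡ _)
    Σₗ-++ (x ∷ xs) ys = R.trans (+-congˡ (Σₗ-++ xs ys)) (R.sym (+-assoc x _ _))

    Σₗ-extend : ∀ x xss → Σₗ (map Πₗ (map (x ∷_) xss)) ≈ x * Σₗ (map Πₗ xss)
    Σₗ-extend x []         = R.sym (zeroʳ x)
    Σₗ-extend x (xs ∷ xss) = R.trans (+-congˡ (Σₗ-extend x xss)) (R.sym (distribˡ x _ _))

  e-zero : ∀ xs → e R 0 xs ≈ 1#
  e-zero xs = +-identityʳ 1#

  e-cons : ∀ m x xs → e R (suc m) (x ∷ xs) ≈ x * e R m xs + e R (suc m) xs
  e-cons m x xs = R.trans (reflexive (cong Σₗ (map-++ Πₗ (map (x ∷_) (choices m xs)) _)))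
    (R.trans (Σₗ-++ (map Πₗ (map (x ∷_) (choices m xs))) _) (+-congʳ (Σₗ-extend x (choices m xs))))

module _ (F : DecField) where
  open DecField F

  record RingMap {c ℓ} (R : CommutativeRing c ℓ) : Set (c ⊔ ℓ) where
    private module R = CommutativeRing R
    field
      ⟦_⟧    : R.Carrier → Carrier
      ⟦⟧-cong : ∀ {x y} → x R.≈ y → ⟦ x ⟧ ≡ ⟦ y ⟧
      +-homo : ∀ x y → ⟦ x R.+ y ⟧ ≡ ⟦ x ⟧ + ⟦ y ⟧
      *-homo : ∀ x y → ⟦ x R.* y ⟧ ≡ ⟦ x ⟧ * ⟦ y ⟧
      0-homo : ⟦ R.0# ⟧ ≡ 0#
      1-homo : ⟦ R.1# ⟧ ≡ 1#

    e-homo : ∀ m xs → ⟦ e R m xs ⟧ ≡ e commutativeRing m (map ⟦_⟧ xs)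
    e-homo zero xs = trans (⟦⟧-cong (e-zero R xs)) (trans 1-homo (sym (e-zero commutativeRing (map ⟦_⟧ xs))))
    e-homo (suc m) [] = 0-homo
    e-homo (suc m) (x ∷ xs) = begin
      ⟦ e R (suc m) (x ∷ xs) ⟧                                      ≡⟨ ⟦⟧-cong (e-cons R m x xs) ⟩
      ⟦ x R.* e R m xs R.+ e R (suc m) xs ⟧                         ≡⟨ trans (+-homo _ _) (cong (_+ _) (*-homo x _)) ⟩
      ⟦ x ⟧ * ⟦ e R m xs ⟧ + ⟦ e R (suc m) xs ⟧                     ≡⟨ cong₂ (λ u v → ⟦ x ⟧ * u + v) (e-homo m xs) (e-homo (suc m) xs) ⟩
      ⟦ x ⟧ * e commutativeRing m (map ⟦_⟧ xs) + e commutativeRing (suc m) (map ⟦_⟧ xs)  ≡⟨ sym (e-cons commutativeRing m ⟦ x ⟧ (map ⟦_⟧ xs)) ⟩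
      e commutativeRing (suc m) (map ⟦_⟧ (x ∷ xs))                  ∎
      where open ≡-Reasoning

  private
    E : ℕ → List Carrier → Carrier
    E = e commutativeRing

    Π Σ⁻¹ : List Carrier → Carrier
    Π   = foldr _*_ 1#
    Σ⁻¹ = foldr _+_ 0# ∘ map _⁻¹

  e-overfull : ∀ m xs → length xs < m → E m xs ≡ 0#
  e-overfull (suc m) []       _         = refl
  e-overfull (suc m) (x ∷ xs) (s≤s len) = trans (e-cons commutativeRing m x xs) (trans
    (cong₂ (λ u v → x * u + v) (e-overfull m xs len) (e-overfull (suc m) xs (ℕ.m<n⇒m<1+n len)))
    (trans (+-identityʳ _) (zeroʳ x)))

  e-full : ∀ xs → E (length xs) xs ≡ Π xs
  e-full []       = +-identityʳ 1#
  e-full (x ∷ xs) = trans (e-cons commutativeRing (length xs) x xs) (trans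
    (cong₂ (λ u v → x * u + v) (e-full xs) (e-overfull (suc (length xs)) xs ℕ.≤-refl)) (+-identityʳ _))

  -- Each term of e_m on m + 1 elements omits exactly one factor of the full product.
  e-reciprocals : ∀ m xs → length xs ≡ suc m → (∀ {x} → x ∈ xs → x ≢ 0#) → E m xs ≡ Π xs * Σ⁻¹ xs
  e-reciprocals zero (x ∷ []) _ nz = trans (+-identityʳ 1#) (sym (trans
    (cong₂ _*_ (*-identityʳ x) (+-identityʳ (x ⁻¹))) (*-inverseʳ (nz (here refl)))))
  e-reciprocals (suc m) (x ∷ xs) len nz = begin
    E (suc m) (x ∷ xs)                     ≡⟨ e-cons commutativeRing m x xs ⟩
    x * E m xs + E (suc m) xs              ≡⟨ cong₂ (λ u v → x * u + v) (e-reciprocals m xs len′ (nz ∘ there)) (subst (λ n → E n xs ≡ Π xs) len′ (e-full xs)) ⟩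
    x * (Π xs * Σ⁻¹ xs) + Π xs             ≡⟨ cong₂ _+_ (sym (*-assoc x _ _)) (sym (trans (cong (_* Π xs) (*-inverseʳ (nz (here refl)))) (*-identityˡ _))) ⟩
    x * Π xs * Σ⁻¹ xs + x * x ⁻¹ * Π xs    ≡⟨ cong (x * Π xs * Σ⁻¹ xs +_) (trans (*-assoc x _ _) (trans (cong (x *_) (*-comm _ _)) (sym (*-assoc x _ _)))) ⟩
    x * Π xs * Σ⁻¹ xs + x * Π xs * x ⁻¹    ≡⟨ sym (distribˡ (x * Π xs) _ _) ⟩
    x * Π xs * (Σ⁻¹ xs + x ⁻¹)             ≡⟨ cong (x * Π xs *_) (+-comm _ _) ⟩
    x * Π xs * (x ⁻¹ + Σ⁻¹ xs)             ∎
    where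
    open ≡-Reasoning
    len′ = ℕ.suc-injective len

  e-zeros : ∀ m xs → (∀ {x} → x ∈ xs → x ≡ 0#) → E (suc m) xs ≡ 0#
  e-zeros m []       _  = refl
  e-zeros m (x ∷ xs) z = trans (e-cons commutativeRing m x xs) (trans
    (cong₂ (λ u v → u * E m xs + v) (z (here refl)) (e-zeros m xs (z ∘ there)))
    (trans (+-identityʳ _) (zeroˡ _)))

  support : ∀ {n} → Vec Carrier n → Vec Bool n
  support = Vec.map (λ x → not (does (x ≟ 0#)))

  restrict : ∀ {n} (σ : Vec Bool n) → Vec Carrier n → Vec Carrier (size σ)
  restrict []          []      = []
  restrict (true ∷ σ)  (x ∷ v) = x ∷ restrict σ v
  restrict (false ∷ σ) (x ∷ v) = restrict σ v

  open VectorSpace F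

  restrict-+ : ∀ {n} (σ : Vec Bool n) u v → restrict σ (zipWith _+_ u v) ≡ zipWith _+_ (restrict σ u) (restrict σ v)
  restrict-+ []          []      []      = refl
  restrict-+ (true ∷ σ)  (x ∷ u) (y ∷ v) = cong (x + y ∷_) (restrict-+ σ u v)
  restrict-+ (false ∷ σ) (x ∷ u) (y ∷ v) = restrict-+ σ u v

  restrict-0 : ∀ {n} (σ : Vec Bool n) → restrict σ 0ᵛ ≡ 0ᵛ
  restrict-0 []          = refl
  restrict-0 (true ∷ σ)  = cong (0# ∷_) (restrict-0 σ)
  restrict-0 (false ∷ σ) = restrict-0 σ

  restrict≡0 : ∀ {n} (σ : Vec Bool n) v → restrict σ v ≡ 0ᵛ → ∀ c → Vec.lookup σ c ≡ true → Vec.lookup v c ≡ 0#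
  restrict≡0 (true ∷ σ)  (x ∷ v) eq zero    _ = cong Vec.head eq
  restrict≡0 (true ∷ σ)  (x ∷ v) eq (suc c) t = restrict≡0 σ v (cong Vec.tail eq) c t
  restrict≡0 (false ∷ σ) (x ∷ v) eq (suc c) t = restrict≡0 σ v eq c t

  module _ {n} {a} {A : Set a} (code : A → Vec Carrier n) where

    reciprocal : (σ : Vec Bool n) → A → Vec Carrier (size σ)
    reciprocal σ s = restrict σ (Vec.map _⁻¹ (code s))

    private
      Σᵛ⁻¹ : List A → Vec Carrier n
      Σᵛ⁻¹ = foldr (zipWith _+_) 0ᵛ ∘ map (Vec.map _⁻¹ ∘ code)

      restrict-Σ : ∀ σ S → restrict σ (Σᵛ⁻¹ S) ≡ foldr (zipWith _+_) 0ᵛ (map (reciprocal σ) S)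
      restrict-Σ σ []      = restrict-0 σ
      restrict-Σ σ (s ∷ S) = trans (restrict-+ σ (Vec.map _⁻¹ (code s)) (Σᵛ⁻¹ S)) (cong (zipWith _+_ (reciprocal σ s)) (restrict-Σ σ S))

      lookup-Σ : ∀ S c → Vec.lookup (Σᵛ⁻¹ S) c ≡ Σ⁻¹ (map (λ s → Vec.lookup (code s) c) S)
      lookup-Σ []      c = Vec.lookup-replicate c 0#
      lookup-Σ (s ∷ S) c = trans (Vec.lookup-zipWith _+_ c (Vec.map _⁻¹ (code s)) (Σᵛ⁻¹ S))
        (cong₂ _+_ (Vec.lookup-map c _⁻¹ (code s)) (lookup-Σ S c))

    -- Outside `σ` all terms vanish, and inside `σ` none does, so the reciprocals decide. The degree
    -- is a successor because e_0 = 1 would not vanish on zeros.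
    common-support : ∀ m σ S → length S ≡ suc (suc m) → (∀ {s} → s ∈ S → support (code s) ≡ σ) →
      foldr (zipWith _+_) 0ᵛ (map (reciprocal σ) S) ≡ 0ᵛ → ∀ c → E (suc m) (map (λ s → Vec.lookup (code s) c) S) ≡ 0#
    common-support m σ S len supp sum0 c with Vec.lookup σ c in eq
    ... | false = e-zeros m (map (λ s → Vec.lookup (code s) c) S) λ x∈ →
      let s , s∈ , x≡ = ∈-map⁻ (λ s → Vec.lookup (code s) c) x∈ in trans x≡ (vanishes s∈)
      where
      vanishes : ∀ {s} → s ∈ S → Vec.lookup (code s) c ≡ 0#
      vanishes {s} s∈ with Vec.lookup (code s) c ≟ 0# | trans (sym (Vec.lookup-map c (λ x → not (does (x ≟ 0#))) (code s))) (trans (cong (λ σ → Vec.lookup σ c) (supp s∈)) eq)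
      ... | yes z | _  = z
      ... | no _  | ()
    ... | true = begin
      E (suc m) xs             ≡⟨ e-reciprocals (suc m) xs (trans (length-map _ S) len) (λ x∈ →
                                    let s , s∈ , x≡ = ∈-map⁻ (λ s → Vec.lookup (code s) c) x∈ in λ z → nonzero s∈ (trans (sym x≡) z)) ⟩
      Π xs * Σ⁻¹ xs            ≡⟨ cong (Π xs *_) (trans (sym (lookup-Σ S c)) (restrict≡0 σ (Σᵛ⁻¹ S) (trans (restrict-Σ σ S) sum0) c eq)) ⟩
      Π xs * 0#                ≡⟨ zeroʳ _ ⟩
      0#                       ∎
      where
      open ≡-Reasoning
      xs = map (λ s → Vec.lookup (code s) c) S
      nonzero : ∀ {s} → s ∈ S → Vec.lookup (code s) c ≢ 0#
      nonzero {s} s∈ with Vec.lookup (code s) c ≟ 0# | trans (sym (Vec.lookup-map c (λ x → not (does (x ≟ 0#))) (code s))) (trans (cong (λ σ → Vec.lookup σ c) (supp s∈)) eq)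
      ... | yes _ | ()
      ... | no nz | _  = nz

-- The two ways of finding a solution: repetition and common support.

module Subsequences (F : DecField) {q k d : ℕ} (enum : DecField.Carrier F ↔ Fin q)
  (pp : Prime (suc (suc d))) (1≤k : 1 ≤ k) (q≡ : q ≡ suc (suc d) ^ k) (n : ℕ)
  {a} {A : Set a} (code : A → Vec (DecField.Carrier F) n) where
  open DecField F

  private
    p : ℕ
    p = suc (suc d)

    2≤p : 2 ≤ p
    2≤p = s≤s (s≤s z≤n)

  module V i = Vectors F enum pp 1≤k q≡ i

  Solution : List A → Set a
  Solution S = ∃[ S′ ] S′ ⊆ S × length S′ ≡ p × ∀ c → e commutativeRing (suc d) (map (λ s → Vec.lookup (code s) c) S′) ≡ 0#

  -- Equal terms have a common support, and `p` equal reciprocals sum to zero in characteristic `p`.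
  by-repetition : ∀ S → suc d ℕ.* q ^ n < length S → Solution S
  by-repetition S big =
    let g , _ , many = pigeonhole (λ g s → V._≟ⱽ_ n (code s) g) (λ _ → suc d) (V.elements n) S
          (λ {s} _ → code s , V.∈elements n (code s) , refl)
          (subst (_< length S) (trans (ℕ.*-comm (suc d) _) (trans (cong (ℕ._* suc d) (sym (V.length-elements n)))
            (sym (sum-map-const (suc d) (V.elements n))))) big)
        S′ , S′⊆ , len , const = constant-subsequence (V._≟ⱽ_ n) code S g p many
        σ = support F g
    in S′ , S′⊆ , len , common-support F code d σ S′ len (λ s∈ → cong (support F) (const s∈))
      (constant-sum (size σ) (λ s∈ → cong (restrict F σ ∘ Vec.map _⁻¹) (const s∈)) len)
    where
    constant-sum : ∀ i {y : A → Vec Carrier i} {S g} → (∀ {s} → s ∈ S → y s ≡ g) → length S ≡ p → foldr (zipWith _+_) (VectorSpace.0ᵛ F) (map y S) ≡ VectorSpace.0ᵛ F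
    constant-sum i {y} {S} {g} const len = trans (V.Σˡ-constant i y S const)
      (trans (cong (λ m → VectorSpace.sumᵛ F {n = i} (Vec.replicate m g)) len) (V.exponent i g))

  by-support : ∀ (B : ℕ → ℕ) → (∀ i → V.DistinctZeroSum i (B i)) → ∀ S →
    sum (map (λ σ → suc d ℕ.* B (size σ)) (vecs bools n)) < length S → Solution S
  by-support B distinct S big =
    let σ , _ , many = pigeonhole (λ σ s → Vec.≡-dec Bool._≟_ (support F (code s)) σ) (λ σ → suc d ℕ.* B (size σ)) (vecs bools n) S
          (λ {s} _ → support F (code s) , ∈-vecs _ (λ c → ∈bools _) , refl) big
        has-σ = λ s → Vec.≡-dec Bool._≟_ (support F (code s)) σ
        T = filter has-σ S
        S′ , S′⊆ , len , sum0 = V.zero-sum-subsequence (size σ) 2≤p (distinct (size σ)) (reciprocal F code σ) T (ℕ.<⇒≤ many)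
    in S′ , ⊆-trans S′⊆ (filter-⊆ has-σ S) , len
     , common-support F code d σ S′ len (λ s∈ → proj₂ (∈-filter⁻ has-σ {xs = S} (Sublist.lookup S′⊆ s∈))) sum0

-- Sublists, transport to a finite type, and the exact value of EGZ.

module _ {a} {A : Set a} where

  choices-sound : ∀ t (S : List A) {S′} → S′ ∈ choices t S → S′ ⊆ S × length S′ ≡ t
  choices-sound zero    S       (here refl) = minimum S , refl
  choices-sound (suc t) (s ∷ S) S′∈ with ∈-++⁻ (map (s ∷_) (choices t S)) S′∈
  ... | inj₂ S′∈ʳ = let S′⊆ , len = choices-sound (suc t) S S′∈ʳ in s ∷ʳ S′⊆ , len
  ... | inj₁ S′∈ˡ with ∈-map⁻ (s ∷_) S′∈ˡ
  ...   | _ , T∈ , refl = let T⊆ , len = choices-sound t S T∈ in refl ∷ T⊆ , cong suc len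

  choices-complete : ∀ {S S′ : List A} → S′ ⊆ S → S′ ∈ choices (length S′) S
  choices-complete {S′ = []}     _                 = here refl
  choices-complete {S′ = s ∷ S′} (t ∷ʳ S′⊆)        = ∈-++⁺ʳ _ (choices-complete S′⊆)
  choices-complete {S′ = s ∷ S′} (refl ∷ S′⊆)    = ∈-++⁺ˡ (∈-map⁺ (s ∷_) (choices-complete S′⊆))

  ⊆-map⁻ : ∀ {b} {B : Set b} (f : B → A) {T S} → T ⊆ map f S → ∃[ S′ ] S′ ⊆ S × T ≡ map f S′
  ⊆-map⁻ f {S = []}    []           = [] , [] , refl
  ⊆-map⁻ f {S = s ∷ S} (_ ∷ʳ T⊆)    = let S′ , S′⊆ , eq = ⊆-map⁻ f T⊆ in S′ , s ∷ʳ S′⊆ , eq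
  ⊆-map⁻ f {S = s ∷ S} (refl ∷ T⊆) = let S′ , S′⊆ , eq = ⊆-map⁻ f T⊆ in s ∷ S′ , refl ∷ S′⊆ , cong (f s ∷_) eq

  prefix : ∀ L (S : List A) → L ≤ length S → Vec A L
  prefix zero    S       _        = []
  prefix (suc L) (s ∷ S) (s≤s L≤) = s ∷ prefix L S L≤

  prefix-⊆ : ∀ L S (L≤ : L ≤ length S) → Vec.toList (prefix L S L≤) ⊆ S
  prefix-⊆ zero    S       _        = minimum S
  prefix-⊆ (suc L) (s ∷ S) (s≤s L≤) = refl ∷ prefix-⊆ L S L≤

-- The field is replaced by an isomorphic one on Fin q, where equality is propositional.
module Transport {c ℓ q} (F : FiniteField c ℓ q) where
  private
    module F = FiniteField F
    module R = CommutativeRing F.commutativeRing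
  open Inverse F.order using (to; from; to-cong; from-cong; strictlyInverseˡ; strictlyInverseʳ) public

  private
    rawRing : RawRing 0ℓ 0ℓ
    rawRing = record
      { Carrier = Fin q
      ; _≈_ = _≡_
      ; _+_ = λ x y → to (from x R.+ from y)
      ; _*_ = λ x y → to (from x R.* from y)
      ; -_  = λ x → to (R.- from x)
      ; 0#  = to R.0#
      ; 1#  = to R.1#
      }

    from-injective : ∀ {x y} → from x R.≈ from y → x ≡ y
    from-injective {x} {y} eq = trans (sym (strictlyInverseˡ x)) (trans (to-cong eq) (strictlyInverseˡ y))

  to-injective : ∀ {x y} → to x ≡ to y → x R.≈ y
  to-injective eq = R.trans (R.sym (strictlyInverseʳ _)) (R.trans (from-cong eq) (strictlyInverseʳ _))

  private
    inverse : Fin q → Fin q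
    inverse x with x Fin.≟ to R.0#
    -- Zero is its own reciprocal by convention: whole vectors are inverted before they are
    -- restricted to a support.
    ... | yes _ = x
    ... | no x≢0 = to (proj₁ (F.invertible (from x) λ e → x≢0 (trans (sym (strictlyInverseˡ x)) (to-cong e))))

    inverseʳ : ∀ {x} → x ≢ to R.0# → to (from x R.* from (inverse x)) ≡ to R.1#
    inverseʳ {x} x≢0 with x Fin.≟ to R.0#
    ... | yes x≡0 = contradiction x≡0 x≢0
    ... | no x≢0′ = to-cong (R.trans (R.*-congˡ (strictlyInverseʳ _))
      (proj₂ (F.invertible (from x) λ e → x≢0′ (trans (sym (strictlyInverseˡ x)) (to-cong e)))))

  𝔽 : DecField
  𝔽 = record
    { isCommutativeRing = RingMonomorphism.isCommutativeRing {R₁ = rawRing} {R₂ = R.rawRing} {⟦_⟧ = from} (record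
      { isRingHomomorphism = record
        { isSemiringHomomorphism = record
          { isNearSemiringHomomorphism = record
            { +-isMonoidHomomorphism = record
              { isMagmaHomomorphism = record
                { isRelHomomorphism = record { cong = from-cong }
                ; homo = λ _ _ → strictlyInverseʳ _ }
              ; ε-homo = strictlyInverseʳ _ }
            ; *-homo = λ _ _ → strictlyInverseʳ _ }
          ; 1#-homo = strictlyInverseʳ _ }
        ; -‿homo = λ _ → strictlyInverseʳ _ }
      ; injective = from-injective }) R.isCommutativeRing
    ; _≟_ = Fin._≟_
    ; 1≢0 = λ e → F.1≉0 (to-injective e)
    ; _⁻¹ = inverse
    ; *-inverseʳ = inverseʳ
    }

  open DecField 𝔽 using (0#; 1#; _≟_) renaming (commutativeRing to 𝔽-ring)

  module _ {n : ℕ} where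

    private
      module Rⁿ = CommutativeRing (𝔽^ F n)

    coordinate : Fin n → RingMap 𝔽 (𝔽^ F n)
    coordinate i = record
      { ⟦_⟧     = λ g → to (g i)
      ; ⟦⟧-cong = λ eq → to-cong (eq i)
      ; +-homo = λ x y → to-cong (R.sym (R.+-cong (strictlyInverseʳ (x i)) (strictlyInverseʳ (y i))))
      ; *-homo = λ x y → to-cong (R.sym (R.*-cong (strictlyInverseʳ (x i)) (strictlyInverseʳ (y i))))
      ; 0-homo = refl
      ; 1-homo = refl
      }

    code : Rⁿ.Carrier → Vec (Fin q) n
    code g = Vec.tabulate (to ∘ g)

    decode : Vec (Fin q) n → Rⁿ.Carrier
    decode v i = from (Vec.lookup v i)

    Vanishes : ℕ → List (Vec (Fin q) n) → Set
    Vanishes m vs = ∀ i → e 𝔽-ring m (map (λ v → Vec.lookup v i) vs) ≡ 0#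

    vanishes? : ∀ m → Decidable (Vanishes m)
    vanishes? m vs = Fin.all? (λ i → e 𝔽-ring m (map (λ v → Vec.lookup v i) vs) ≟ 0#)

    private
      coordinates : ∀ i S → map (λ v → Vec.lookup v i) (map code S) ≡ map (λ g → to (g i)) S
      coordinates i S = trans (sym (map-∘ S)) (map-cong (λ g → Vec.lookup∘tabulate (to ∘ g) i) S)

    vanishes⇒≈0 : ∀ m S → Vanishes m (map code S) → e (𝔽^ F n) m S Rⁿ.≈ Rⁿ.0#
    vanishes⇒≈0 m S van i = to-injective (trans (RingMap.e-homo (coordinate i) m S)
      (trans (cong (e 𝔽-ring m) (sym (coordinates i S))) (van i)))

    ≈0⇒vanishes : ∀ m S → e (𝔽^ F n) m S Rⁿ.≈ Rⁿ.0# → Vanishes m (map code S)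
    ≈0⇒vanishes m S z i = trans (cong (e 𝔽-ring m) (coordinates i S))
      (trans (sym (RingMap.e-homo (coordinate i) m S)) (to-cong (z i)))

    code-decode : ∀ v → code (decode v) ≡ v
    code-decode v = trans (Vec.tabulate-cong (λ i → strictlyInverseˡ (Vec.lookup v i))) (Vec.tabulate∘lookup v)

    private
      codes : List (Vec (Fin q) n)
      codes = vecs (allFin q) n

      Good : ℕ → ℕ → ∀ {L} → Vec (Vec (Fin q) n) L → Set
      Good t m vs = Any (Vanishes m) (choices t (Vec.toList vs))

    -- It is enough to test the finitely many sequences of codes of length exactly `L`: a longer
    -- sequence contains its prefix, and `e` vanishes on ring elements exactly if it vanishes on
    -- their codes.
    forces? : ∀ t m L → Dec (Forces (𝔽^ F n) t m L)
    forces? t m L = map′ sound complete (All.all? (λ vs → any? (vanishes? m) (choices t (Vec.toList vs))) (vecs codes L))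
      where
      sound : All (Good t m) (vecs codes L) → Forces (𝔽^ F n) t m L
      sound good S L≤ =
        let pre = prefix L S L≤
            vs = Vec.map code pre
            T , T∈ , van = find (All.lookup good (∈-vecs vs (λ i → ∈-vecs (Vec.lookup vs i) (λ j → ∈-allFin _))))
            T⊆ , len = choices-sound t (Vec.toList vs) T∈
            S′ , S′⊆ , T≡ = ⊆-map⁻ code (subst (T ⊆_) (Vec.toList-map code pre) T⊆)
        in S′ , ⊆-trans S′⊆ (prefix-⊆ L S L≤) , trans (sym (length-map code S′)) (trans (cong length (sym T≡)) len)
         , vanishes⇒≈0 m S′ (subst (Vanishes m) T≡ van)
      complete : Forces (𝔽^ F n) t m L → All (Good t m) (vecs codes L)
      complete forces = All.tabulate λ {vs} _ → goal vs
        where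
        goal : ∀ (vs : Vec (Vec (Fin q) n) L) → Good t m vs
        goal vs =
          let S′ , S′⊆ , len , z = forces (map decode (Vec.toList vs)) (ℕ.≤-reflexive (sym (trans (length-map decode (Vec.toList vs)) (Vec.length-toList vs))))
              T , T⊆ , S′≡ = ⊆-map⁻ decode S′⊆
              code-S′ = trans (cong (map code) S′≡) (trans (sym (map-∘ T)) (trans (map-cong code-decode T) (map-id T)))
          in lose (subst (λ l → T ∈ choices l (Vec.toList vs)) (trans (sym (trans (cong length S′≡) (length-map decode T))) len) (choices-complete T⊆))
               (subst (Vanishes m) code-S′ (≈0⇒vanishes m S′ z))

    exact : ∀ t m L → 1 ≤ L → Forces (𝔽^ F n) t m L → ∃[ L′ ] L′ ≤ L × IsEGZ t (𝔽^ F n) m [ L′ ]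
    exact t m L 1≤L forces =
      let L′ , L′≤L , (1≤L′ , forces′) , min = least (λ l → 1 ℕ.≤? l ×-dec forces? t m l) L (1≤L , forces)
      in L′ , L′≤L , 1≤L′ , forces′ , λ l 1≤l f → min l (1≤l , f)

  module Infinite {p} (pp : Prime p) {r j} (rp : Prime r) (q≡ : q ≡ r ^ j) (p≢r : p ≢ r) where
    open DecField 𝔽 using (_+_; _*_; _⁻¹; *-inverseʳ; *-identityˡ; 1≢0; +-identityʳ)
    open FieldFacts 𝔽
    open Finite (↔-id (Fin q))

    p≢0 : p · 1# ≢ 0#
    p≢0 = coprime-char (primes-coprime rp pp (p≢r ∘ sym)) (^-char r j (trans (cong (_· 1#) (sym q≡)) order-char))

    -- The product of the entries is 1 and their m + 1 reciprocals sum to m + 1, so no binomial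
    -- coefficient has to be computed.
    e-ones : ∀ m xs → length xs ≡ suc m → (∀ {x} → x ∈ xs → x ≡ 1#) → e 𝔽-ring m xs ≡ suc m · 1#
    e-ones m xs len ones = trans (e-reciprocals 𝔽 m xs len (λ x∈ z → 1≢0 (trans (sym (ones x∈)) z)))
      (trans (cong₂ _*_ (prods xs ones) (trans (sums xs ones) (cong (_· 1#) len))) (*-identityˡ _))
      where
      1⁻¹ : 1# ⁻¹ ≡ 1#
      1⁻¹ = trans (sym (*-identityˡ _)) (*-inverseʳ 1≢0)
      prods : ∀ xs → (∀ {x} → x ∈ xs → x ≡ 1#) → foldr _*_ 1# xs ≡ 1#
      prods []       _    = refl
      prods (x ∷ xs) ones = trans (cong₂ _*_ (ones (here refl)) (prods xs (ones ∘ there))) (*-identityˡ 1#)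
      sums : ∀ xs → (∀ {x} → x ∈ xs → x ≡ 1#) → foldr _+_ 0# (map _⁻¹ xs) ≡ length xs · 1#
      sums []       _    = refl
      sums (x ∷ xs) ones = cong₂ _+_ (trans (cong _⁻¹ (ones (here refl))) 1⁻¹) (sums xs (ones ∘ there))

    ¬forces : ∀ {n} → 1 ≤ n → ∀ L → ¬ Forces (𝔽^ F n) p (p ∸ 1) L
    ¬forces {suc n} _ L forces =
      let S , S⊆ , len , z = forces (List.replicate L 1ⁿ) (ℕ.≤-reflexive (sym (length-replicate L)))
      in p≢0 (trans (cong (_· 1#) (sym p≡)) (trans
           (sym (e-ones (p ∸ 1) (map (λ v → Vec.lookup v zero) (map code S))
             (trans (length-map _ (map code S)) (trans (length-map code S) (trans len (sym p≡))))
             (λ x∈ → let v , v∈ , x≡ = ∈-map⁻ (λ v → Vec.lookup v zero) x∈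
                         s , s∈ , v≡ = ∈-map⁻ code v∈
                     in trans x≡ (trans (cong (λ v → Vec.lookup v zero) v≡) (cong (λ s → to (s zero)) (constant L (Sublist.lookup S⊆ s∈)))))))
           (≈0⇒vanishes (p ∸ 1) S z zero)))
      where
      1ⁿ = CommutativeRing.1# (𝔽^ F (suc n))
      p≡ : suc (p ∸ 1) ≡ p
      p≡ = ℕ.m+[n∸m]≡n (ℕ.<⇒≤ (ℕ.nonTrivial⇒n>1 p {{prime⇒nonTrivial pp}}))
      constant : ∀ {a} {A : Set a} L {x y : A} → y ∈ List.replicate L x → y ≡ x
      constant (suc L) (here eq)  = eq
      constant (suc L) (there y∈) = constant L y∈

  module _ {n k d : ℕ} (pp : Prime (suc (suc d))) (1≤k : 1 ≤ k) (q≡ : q ≡ suc (suc d) ^ k) where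
    private
      module S = Subsequences 𝔽 (↔-id (Fin q)) pp 1≤k q≡ n {A = CommutativeRing.Carrier (𝔽^ F n)} code

    forces-by-solutions : ∀ L → (∀ S → L < length S → S.Solution S) → Forces (𝔽^ F n) (suc (suc d)) (suc d) (suc L)
    forces-by-solutions L solve S L< =
      let S′ , S′⊆ , len , z = solve S L< in
      S′ , S′⊆ , len , vanishes⇒≈0 (suc d) S′ (λ i → trans (cong (e 𝔽-ring (suc d)) (sym (map-∘ S′))) (z i))

    egz-by-solutions : ∀ L → (∀ S → L < length S → S.Solution S) →
      ∃[ L′ ] L′ ≤ suc L × IsEGZ (suc (suc d)) (𝔽^ F n) (suc d) [ L′ ]
    egz-by-solutions L solve = exact (suc (suc d)) (suc d) (suc L) (s≤s z≤n) (forces-by-solutions L solve)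

-- Assembly of the three upper bounds.

module UpperBounds {c ℓ q} (F : FiniteField c ℓ q) {d k} (pp : Prime (suc (suc d))) (1≤k : 1 ≤ k) (q≡ : q ≡ suc (suc d) ^ k) where
  open Transport F

  private
    p : ℕ
    p = suc (suc d)

    Value : ℕ → _
    Value n = IsEGZ p (𝔽^ F n) (suc d)

    module Sub n = Subsequences 𝔽 (↔-id (Fin q)) pp 1≤k q≡ n {A = CommutativeRing.Carrier (𝔽^ F n)} code

    DistinctZeroSum : ℕ → ℕ → Set
    DistinctZeroSum i = Vectors.DistinctZeroSum 𝔽 (↔-id (Fin q)) pp 1≤k q≡ i

    supports-bound : (B : ℕ → ℕ) → (∀ i → DistinctZeroSum i (B i)) → ∀ n →
      ∃[ L ] L ≤ suc (size-sum (λ i → suc d ℕ.* B i) n) × Value n [ L ]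
    supports-bound B distinct n = egz-by-solutions pp 1≤k q≡ _ (Sub.by-support n B distinct)

  repetition-bound : Bounded ℕ-scale q Value
  repetition-bound = (λ _ → 1) , const-littleO 1 , λ n _ →
    let L , L≤ , is = egz-by-solutions pp 1≤k q≡ _ (Sub.by-repetition n)
    in L , is , (begin
      L                                   ≤⟨ L≤ ⟩
      1 ℕ.+ suc d ℕ.* q ^ n               ≤⟨ ℕ.+-monoˡ-≤ (suc d ℕ.* q ^ n) (ℕ.m^n>0 q {{ℕ.>-nonZero (ℕ.≤-trans (s≤s z≤n) p≤q)}} n) ⟩
      p ℕ.* q ^ n                         ≤⟨ ℕ.*-monoˡ-≤ (q ^ n) p≤q ⟩
      q ^ suc n                           ≡⟨ cong (q ^_) (sym (ℕ.+-comm n 1)) ⟩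
      q ^ (n ℕ.+ 1)                       ≡⟨ ^-agrees (n ℕ.+ 1) ⟩
      q ^ᴷ (n ℕ.+ 1)                      ∎)
    where
    open ℕ.≤-Reasoning
    open RawSemiringDefs ℕ.+-*-rawSemiring using () renaming (_^_ to _^ᴷ_)
    ^-agrees : ∀ m → q ^ m ≡ q ^ᴷ m
    ^-agrees zero    = refl
    ^-agrees (suc m) = cong (q ℕ.*_) (^-agrees m)
    p≤q : p ≤ q
    p≤q = ℕ.≤-trans (ℕ.≤-reflexive (sym (ℕ.^-identityʳ p))) (ℕ.≤-trans (ℕ.^-monoʳ-≤ p 1≤k) (ℕ.≤-reflexive (sym q≡)))

  -- Here β = 2^k √q, and `M i` is the integer part of β^i, obtained from its square `W i`.
  -- Comparing squares bounds `B i` by `C * 2 * M i`, where 2 is the loss of `integer-root`.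
  general-bound : 4 ≤ p → Bounded (√-scale q) (base√ k q) Value
  -- In the scale, the surd part of β + 1 computes to `2 ^ k + 0`.
  general-bound 4≤p = subst (λ b → Bounded (√-scale q) b Value) (cong (1 +√_) (ℕ.+-identityʳ (2 ^ k)))
    (bounded-by-supports (Surd.laws q) Value {Surd.√s q s} M (λ i → suc d ℕ.* B i) (suc d ℕ.* (C ℕ.* 2)) 2≼
      (λ i → proj₁ (proj₂ (root i))) (λ i → Surd.≼-power q s i (proj₁ (proj₂ (proj₂ (root i))))) N≤
      (supports-bound B (λ i → proj₁ (proj₂ (distinct i)))))
    where
    open ℕ.≤-Reasoning
    s = 2 ^ k
    C = 4 ℕ.* p ℕ.* p ℕ.* suc (p ℕ.* (p ℕ.* suc (p ^ p ℕ.* 2)))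
    distinct : ∀ i → ∃[ B ] DistinctZeroSum i B × B ℕ.* B ≤ C ^ 2 ℕ.* (4 ^ k ℕ.* q) ^ i
    distinct i = Vectors.distinct-general 𝔽 (↔-id (Fin q)) pp 1≤k q≡ i 4≤p
    B : ℕ → ℕ
    B i = proj₁ (distinct i)
    1≤q : 1 ≤ q
    1≤q = subst (1 ≤_) (sym q≡) (ℕ.m^n>0 p k)
    W : ℕ → ℕ
    W i = (s ℕ.* s ℕ.* q) ^ i
    1≤ssq : 1 ≤ s ℕ.* s ℕ.* q
    1≤ssq = ℕ.*-mono-≤ (ℕ.*-mono-≤ (ℕ.m^n>0 2 k) (ℕ.m^n>0 2 k)) 1≤q
    root : ∀ i → ∃[ M ] 1 ≤ M × M ℕ.* M ≤ W i × W i ≤ (2 ℕ.* M) ℕ.* (2 ℕ.* M)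
    root i = integer-root (W i) (ℕ.m^n>0 (s ℕ.* s ℕ.* q) {{ℕ.>-nonZero 1≤ssq}} i)
    M : ℕ → ℕ
    M i = proj₁ (root i)
    B≤ : ∀ i → B i ≤ C ℕ.* 2 ℕ.* M i
    B≤ i = ^-cancelˡ-≤ 2 (B i) (C ℕ.* 2 ℕ.* M i) (begin
      B i ^ 2                                    ≡⟨ cong (B i ℕ.*_) (ℕ.*-identityʳ (B i)) ⟩
      B i ℕ.* B i                                ≤⟨ proj₂ (proj₂ (distinct i)) ⟩
      C ^ 2 ℕ.* (4 ^ k ℕ.* q) ^ i                ≡⟨ cong (λ x → C ^ 2 ℕ.* (x ℕ.* q) ^ i) (^-distribʳ-* k 2 2) ⟩
      C ^ 2 ℕ.* W i                              ≤⟨ ℕ.*-monoʳ-≤ (C ^ 2) (proj₂ (proj₂ (proj₂ (root i)))) ⟩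
      C ^ 2 ℕ.* ((2 ℕ.* M i) ℕ.* (2 ℕ.* M i))    ≡⟨ arrange C (M i) ⟩
      (C ℕ.* 2 ℕ.* M i) ^ 2                      ∎)
      where
      arrange : ∀ C M → C ℕ.* (C ℕ.* 1) ℕ.* ((2 ℕ.* M) ℕ.* (2 ℕ.* M)) ≡ (C ℕ.* 2 ℕ.* M) ℕ.* ((C ℕ.* 2 ℕ.* M) ℕ.* 1)
      arrange = solve-∀
    N≤ : ∀ i → suc d ℕ.* B i ≤ suc d ℕ.* (C ℕ.* 2) ℕ.* M i
    N≤ i = ℕ.≤-trans (ℕ.*-monoʳ-≤ (suc d) (B≤ i)) (ℕ.≤-reflexive (sym (ℕ.*-assoc (suc d) (C ℕ.* 2) (M i))))
    2≼ : 1 ≤ (s ℕ.+ 0) ^ 2 ℕ.* q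
    2≼ = ℕ.*-mono-≤ (ℕ.^-monoˡ-≤ 2 (ℕ.≤-trans (ℕ.m^n>0 2 k) (ℕ.m≤m+n s 0))) 1≤q

-- `M i` is raised to at least 1 so that the summand 1 in 2(1 + 3D) can be absorbed, which makes the
-- constant 2 · 4 = 8.
ternary-bound : ∀ {c ℓ q} (F : FiniteField c ℓ q) {k} → Prime 3 → 1 ≤ k → q ≡ 3 ^ k →
  Bounded ℚ-scale (base₃ k) (λ n → IsEGZ 3 (𝔽^ F n) 2)
ternary-bound {q = q} F {k} pp 1≤k q≡ = bounded-by-supports ℚ-laws (λ n → IsEGZ 3 (𝔽^ F n) 2) M (λ i → 2 ℕ.* suc (3 ℕ.* D i)) 8
  (+-≼ {1} {1} (≼-2·756 {1} k (ℕ.≤-trans (ℕ.≤-reflexive (ℕ.*-identityˡ (1000 ^ k))) (1000≤2756 k))) ℚ.≤-refl)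
  (λ i → ℕ.m≤n⊔m (D i) 1)
  (λ i → subst (ι (M i) ℚ.≤_) (sym (^ℚ-assoc _ k i)) (≼-2·756 {M i} (i ℕ.* k) (M≤ i)))
  N≤
  (λ n → egz-by-solutions pp 1≤k q≡ _ (Subsequences.by-support 𝔽 (↔-id (Fin q)) pp 1≤k q≡ n code
    (λ i → suc (3 ℕ.* D i)) (distinct-ternary 𝔽 (↔-id (Fin q)) pp 1≤k q≡)))
  where
  open Transport F
  open ScaleLaws ℚ-laws using (+-≼)
  open ℕ.≤-Reasoning
  D M : ℕ → ℕ
  D i = length (low 3 2 (i ℕ.* k))
  M i = D i ℕ.⊔ 1
  1000≤2756 : ∀ m → 1000 ^ m ≤ 2756 ^ m
  1000≤2756 m = ℕ.^-monoˡ-≤ m (ℕ.≤ᵇ⇒≤ 1000 2756 _)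
  M≤ : ∀ i → M i ℕ.* 1000 ^ (i ℕ.* k) ≤ 2756 ^ (i ℕ.* k)
  M≤ i = ℕ.≤-trans (ℕ.≤-reflexive (ℕ.*-distribʳ-⊔ (1000 ^ (i ℕ.* k)) (D i) 1))
    (ℕ.⊔-lub (low-bound-3 (i ℕ.* k)) (ℕ.≤-trans (ℕ.≤-reflexive (ℕ.*-identityˡ _)) (1000≤2756 (i ℕ.* k))))
  N≤ : ∀ i → 2 ℕ.* suc (3 ℕ.* D i) ≤ 8 ℕ.* M i
  N≤ i = begin
    2 ℕ.* (1 ℕ.+ 3 ℕ.* D i)      ≤⟨ ℕ.*-monoʳ-≤ 2 (ℕ.+-mono-≤ (ℕ.m≤n⊔m (D i) 1) (ℕ.*-monoʳ-≤ 3 (ℕ.m≤m⊔n (D i) 1))) ⟩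
    2 ℕ.* (M i ℕ.+ 3 ℕ.* M i)    ≡⟨ sym (ℕ.*-assoc 2 4 (M i)) ⟩
    8 ℕ.* M i                    ∎

theorem4p3 : ∀ {c ℓ} (p q : ℕ) → Prime p → 2 ∤ p → PrimePower q →
    (F : FiniteField c ℓ q) →
    (¬ (∃[ j ] q ≡ p ^ j) → ∀ n → 1 ≤ n → IsEGZ p (𝔽^ F n) (p ∸ 1) ⊤⁺)
    × (∀ k → 1 ≤ k → q ≡ p ^ k →
    ((p ≡ 3 ⊎ p ≡ 5) → k ≡ 1 →
    Bounded ℕ-scale q (λ n → IsEGZ p (𝔽^ F n) (p ∸ 1)))
    × (p ≡ 3 → 2 ≤ k →
    Bounded ℚ-scale (base₃ k) (λ n → IsEGZ p (𝔽^ F n) (p ∸ 1)))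
    × (p ≢ 3 → 7 ≤ q →
    Bounded (√-scale q) (base√ k q) (λ n → IsEGZ p (𝔽^ F n) (p ∸ 1))))
theorem4p3 p q pp 2∤p (r , j , rp , _ , q≡r^j) F =
    -- If the prime `r` below `q` were `p`, then `q` would be a power of `p`.
    (λ not-power n 1≤n L _ → Transport.Infinite.¬forces F pp {j = j} rp q≡r^j (λ { refl → not-power (j , q≡r^j) }) 1≤n L)
  , λ k 1≤k q≡ → bounds p pp 2∤p k 1≤k q≡
  where
  bounds : ∀ p → Prime p → 2 ∤ p → ∀ k → 1 ≤ k → q ≡ p ^ k →
    ((p ≡ 3 ⊎ p ≡ 5) → k ≡ 1 → Bounded ℕ-scale q (λ n → IsEGZ p (𝔽^ F n) (p ∸ 1)))
    × (p ≡ 3 → 2 ≤ k → Bounded ℚ-scale (base₃ k) (λ n → IsEGZ p (𝔽^ F n) (p ∸ 1)))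
    × (p ≢ 3 → 7 ≤ q → Bounded (√-scale q) (base√ k q) (λ n → IsEGZ p (𝔽^ F n) (p ∸ 1)))
  bounds 0 pp _ _ _ _ = contradiction pp ¬prime[0]
  bounds 1 pp _ _ _ _ = contradiction pp ¬prime[1]
  bounds 2 _ 2∤2 _ _ _ = contradiction ∣-refl 2∤2
  bounds p@(suc (suc (suc d))) pp _ k 1≤k q≡ =
      (λ _ _ → UpperBounds.repetition-bound F pp 1≤k q≡)
    , (λ { refl _ → ternary-bound F pp 1≤k q≡ })
    , λ p≢3 _ → UpperBounds.general-bound F pp 1≤k q≡ (ℕ.≤∧≢⇒< (s≤s (s≤s (s≤s z≤n))) (p≢3 ∘ sym))
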